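{- Let $q\ge5$ be odd with $q\equiv\xi\pmod3$, $\xi\in\{1,-1\}$. The E$\Gamma$-lines form two $G_q$-orbits of size $\frac12(q^3-q)$, and they can be labelled $\mathcal O_1,\mathcal O_2$ so that, writing $\Pi_{\pi,j}$ for the number of $\pi$-planes through any line of $\mathcal O_j$ and $\Lambda_{j,\pi}$ for the number of lines of $\mathcal O_j$ in a $\pi$-plane: $\Pi_{2_{\mathcal C},1}=\Lambda_{1,2_{\mathcal C}}=0$; $\Pi_{2_{\mathcal C},2}=2$, $\Lambda_{2,2_{\mathcal C}}=q-1$; $\Pi_{3_{\mathcal C},1}=\frac16(q-\xi)$; $\Lambda_{1,3_{\mathcal C}}=\Lambda_{1,0_{\mathcal C}}=\Lambda_{2,0_{\mathcal C}}=\frac12(q-\xi)$; $\Pi_{0_{\mathcal C},1}=\Pi_{0_{\mathcal C},2}=\frac13(q-\xi)$; $\Pi_{\overline{1_{\mathcal C}},1}=\Lambda_{1,\overline{1_{\mathcal C}}}=\frac12(q+\xi)$; $\Pi_{\overline{1_{\mathcal C}},2}=\Lambda_{2,\overline{1_{\mathcal C}}}=\frac12(q+\xi-2)$; $\Pi_{3_{\mathcal C},2}=\frac16(q-\xi-6)$, $\Lambda_{2,3_{\mathcal C}}=\frac12(q-\xi-6)$.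
   Context: Let $\mathrm{PG}(3,q)$ have points $\mathbf{P}(x_0,x_1,x_2,x_3)$; put $P(t)=\mathbf{P}(t^3,t^2,t,1)$ ($t\in\mathbb{F}_q$), $P(\infty)=\mathbf{P}(1,0,0,0)$, $\mathcal{C}=\{P(t):t\in\mathbb{F}_q\cup\{\infty\}\}$ the twisted cubic, $G_q$ the group of projectivities fixing $\mathcal C$. Write $\boldsymbol{\pi}(c_0,c_1,c_2,c_3)$ for the plane $c_0x_0+c_1x_1+c_2x_2+c_3x_3=0$. $\Gamma$-planes: osculating planes $\boldsymbol{\pi}(1,-3t,3t^2,-t^3)$ ($t\in\mathbb{F}_q$) and $\boldsymbol{\pi}(0,0,0,1)$. A $d_{\mathcal C}$-plane ($d\in\{0,2,3\}$) contains exactly $d$ points of $\mathcal C$; a $\overline{1_{\mathcal C}}$-plane is a non-$\Gamma$-plane with exactly one point of $\mathcal C$ (each plane type is a $G_q$-orbit for $q\ge5$). A real axis is the intersection line of two distinct $\Gamma$-planes. An E$\Gamma$-line is a line containing no point of $\mathcal C$, lying in some $\Gamma$-plane, which is not a real axis. Known fact: for odd $q\ge5$, $q\not\equiv0\pmod3$, the E$\Gamma$-lines form exactly two $G_q$-orbits, each of size $\frac12(q^3-q)$: the orbits of $\boldsymbol{\pi}(1,0,0,0)\cap\boldsymbol{\pi}(0,-3,0,-1)$ and of $\boldsymbol{\pi}(1,0,0,0)\cap\boldsymbol{\pi}(0,-3\rho,0,-1)$, $\rho$ a non-square in $\mathbb{F}_q$. -}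

module Defs where

open import Level using (0ℓ)
open import Data.Bool using (Bool; true; false; not; _∧_; _∨_; if_then_else_; T)
open import Data.Nat using (ℕ; zero; suc; _≡ᵇ_; _≤ᵇ_)
open import Data.Product using (∃; _,_)
open import Data.List using (List; []; _∷_; length; map; concatMap; deduplicate)
open import Data.Bool.ListAction using (any; all)
open import Data.List.Membership.Propositional using (_∈_)
open import Data.List.Relation.Unary.Unique.Propositional using (Unique)
import Data.List.Properties as LP
open import Data.Vec as V using (Vec; []; _∷_)
import Data.Vec.Properties as VP
open import Relation.Binary.PropositionalEquality using (_≡_; _≢_)
open import Relation.Binary.Definitions using (DecidableEquality)
open import Relation.Nullary.Decidable using (⌊_⌋)
open import Algebra.Structures using (IsCommutativeRing)

record FiniteField : Set₁ where
  infixl 6 _+_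
  infixl 7 _*_
  field
    Carrier  : Set
    _+_ _*_  : Carrier → Carrier → Carrier
    -_       : Carrier → Carrier
    0# 1#    : Carrier
    isCommutativeRing : IsCommutativeRing _≡_ _+_ _*_ -_ 0# 1#
    0≢1      : 0# ≢ 1#
    inverse  : ∀ x → x ≢ 0# → ∃ λ y → x * y ≡ 1#
    _≟_      : DecidableEquality Carrier
    elems    : List Carrier
    elems-complete : ∀ x → x ∈ elems
    elems-unique   : Unique elems

  q : ℕ
  q = length elems

allVecs : {A : Set} → List A → (n : ℕ) → List (Vec A n)
allVecs xs zero    = [] ∷ []
allVecs xs (suc n) = concatMap (λ x → map (x ∷_) (allVecs xs n)) xs

filterᵇ : {A : Set} → (A → Bool) → List A → List A
filterᵇ p []       = []
filterᵇ p (x ∷ xs) = if p x then x ∷ filterᵇ p xs else filterᵇ p xs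

count : {A : Set} → (A → Bool) → List A → ℕ
count p xs = length (filterᵇ p xs)

-- The projective space PG(3,q) over a finite field F.
--
-- Conventions: a point (resp. a plane) of PG(3,q) is represented by its
-- unique normalised coordinate vector, i.e. the nonzero vector in F^4
-- whose first nonzero coordinate is 1.  A plane π(c0,c1,c2,c3) contains
-- the point P(x0,..,x3) iff c0x0+c1x1+c2x2+c3x3 = 0.  A line is
-- represented by its set of points, as the sublist of `points` (in the
-- fixed enumeration order) of points lying on it; hence two lines are
-- equal iff their representations are equal.

module PG (F : FiniteField) where
  open FiniteField F

  Vec4 : Set
  Vec4 = Vec Carrier 4

  Point : Set
  Point = Vec4

  Plane : Set
  Plane = Vec4

  Line : Set
  Line = List Point

  _==_ : Carrier → Carrier → Bool
  x == y = ⌊ x ≟ y ⌋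

  _=v_ : {n : ℕ} → Vec Carrier n → Vec Carrier n → Bool
  u =v v = ⌊ VP.≡-dec _≟_ u v ⌋

  _=l_ : Line → Line → Bool
  l =l m = ⌊ LP.≡-dec (VP.≡-dec _≟_) l m ⌋

  isZeroVec : {n : ℕ} → Vec Carrier n → Bool
  isZeroVec v = V.foldr (λ _ → Bool) (λ x b → (x == 0#) ∧ b) true v

  dot : {n : ℕ} → Vec Carrier n → Vec Carrier n → Carrier
  dot u v = V.foldr (λ _ → Carrier) _+_ 0# (V.zipWith _*_ u v)

  scale : {n : ℕ} → Carrier → Vec Carrier n → Vec Carrier n
  scale a v = V.map (a *_) v

  _⊕_ : {n : ℕ} → Vec Carrier n → Vec Carrier n → Vec Carrier n
  u ⊕ v = V.zipWith _+_ u v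

  proportional : Vec4 → Vec4 → Bool
  proportional u v = any (λ a → not (a == 0#) ∧ (u =v scale a v)) elems

  normalised : {n : ℕ} → Vec Carrier n → Bool
  normalised []       = false
  normalised (x ∷ xs) = if x == 0# then normalised xs else x == 1#

  allVec4 : List Vec4
  allVec4 = allVecs elems 4

  points : List Point
  points = filterᵇ normalised allVec4

  planes : List Plane
  planes = filterᵇ normalised allVec4

  incident : Plane → Point → Bool
  incident π P = dot π P == 0#

  onSpan : Point → Point → Point → Bool
  onSpan P Q R = any (λ a → any (λ b → proportional R (scale a P ⊕ scale b Q)) elems) elems

  lineThrough : Point → Point → Line
  lineThrough P Q = filterᵇ (onSpan P Q) points

  lines : List Line
  lines = deduplicate (LP.≡-dec (VP.≡-dec _≟_))
            (concatMap (λ P → map (lineThrough P)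
                                  (filterᵇ (λ Q → not (P =v Q)) points)) points)

  containsLine : Plane → Line → Bool
  containsLine π ℓ = all (incident π) ℓ

  ofℕ : ℕ → Carrier
  ofℕ zero    = 0#
  ofℕ (suc n) = 1# + ofℕ n

  P : Carrier → Point
  P t = (t * t * t) ∷ (t * t) ∷ t ∷ 1# ∷ []

  P∞ : Point
  P∞ = 1# ∷ 0# ∷ 0# ∷ 0# ∷ []

  curve : List Vec4
  curve = P∞ ∷ map P elems

  onCurve : Vec4 → Bool
  onCurve X = any (proportional X) curve

  nCurvePoints : Plane → ℕ
  nCurvePoints π = count (incident π) curve

  -- Γ-planes: osculating planes π(1,-3t,3t^2,-t^3) and π(0,0,0,1)
  osc : Carrier → Plane
  osc t = 1# ∷ (- (ofℕ 3 * t)) ∷ (ofℕ 3 * (t * t)) ∷ (- (t * t * t)) ∷ []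

  osc∞ : Plane
  osc∞ = 0# ∷ 0# ∷ 0# ∷ 1# ∷ []

  isΓPlane : Plane → Bool
  isΓPlane π = any (proportional π) (osc∞ ∷ map osc elems)

  is0C is2C is3C is1barC : Plane → Bool
  is0C π    = nCurvePoints π ≡ᵇ 0
  is2C π    = nCurvePoints π ≡ᵇ 2
  is3C π    = nCurvePoints π ≡ᵇ 3
  is1barC π = (nCurvePoints π ≡ᵇ 1) ∧ not (isΓPlane π)

  nΓPlanesThrough : Line → ℕ
  nΓPlanesThrough ℓ = count (λ π → isΓPlane π ∧ containsLine π ℓ) planes

  isRealAxis : Line → Bool
  isRealAxis ℓ = 2 ≤ᵇ nΓPlanesThrough ℓ

  meetsCurve : Line → Bool
  meetsCurve ℓ = any onCurve ℓ

  isEΓLine : Line → Bool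
  isEΓLine ℓ = not (meetsCurve ℓ) ∧ (1 ≤ᵇ nΓPlanesThrough ℓ) ∧ not (isRealAxis ℓ)

  -- The group G_q of projectivities fixing C.  A projectivity is induced
  -- by a nonsingular 4×4 matrix M (x ↦ M x); matrices differing by a
  -- nonzero scalar induce the same projectivity, which does not affect
  -- orbits.

  Mat : Set
  Mat = Vec Vec4 4

  allMats : List Mat
  allMats = allVecs allVec4 4

  apply : Mat → Vec4 → Vec4
  apply M v = V.map (λ row → dot row v) M

  nonsingular : Mat → Bool
  nonsingular M = all (λ v → isZeroVec v ∨ not (isZeroVec (apply M v))) allVec4

  fixesCurve : Mat → Bool
  fixesCurve M = all (λ X → onCurve (apply M X)) curve
               ∧ all (λ Y → any (λ X → proportional Y (apply M X)) curve) curve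

  inGq : Mat → Bool
  inGq M = nonsingular M ∧ fixesCurve M

  imageLine : Mat → Line → Line
  imageLine M ℓ = filterᵇ (λ R → any (λ X → proportional R (apply M X)) ℓ) points

  inOrbit : Line → Line → Bool
  inOrbit ℓ ℓ' = any (λ M → inGq M ∧ (imageLine M ℓ =l ℓ')) allMats

  Π[_∣_] : (Plane → Bool) → Line → ℕ
  Π[ type ∣ ℓ ] = count (λ π → type π ∧ containsLine π ℓ) planes

  Λ[_∣_] : (Line → Bool) → Plane → ℕ
  Λ[ O ∣ π ] = count (λ ℓ → O ℓ ∧ containsLine π ℓ) lines

  size : (Line → Bool) → ℕ
  size O = count O lines

{-# OPTIONS --safe #-}
-- A plane c₀x₀ + c₁x₁ + c₂x₂ + c₃x₃ = 0 meets the cubic in the roots of f = c₀t³ + c₁t² + c₂t + c₃, so a line is a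
-- pencil of cubics. Möbius maps t ↦ κt + k and t ↦ σ + 1/(κt + k) act on pencils, and every element of G_q is one of
-- them: composed with a Möbius map that brings its images of ∞ and 0 back, it is a diagonal matrix. An EΓ-line of the
-- osculating plane at ∞ is a pencil t³ + at² + bt + λ with a² − 3b ≠ 0; its orbit is decided by whether a² − 3b is a
-- square (𝒪₂) or not (𝒪₁).
--
-- Planes through a line: normalise to t³ + bt + λ. With a root t the remaining quadratic has discriminant
-- −3t² − 4b, so the number of roots depends on the quadratic character of the discriminant of f, and the characters
-- of x² − d are counted on the hyperbola uv = d. The counts force ξ to be the character of −3.
--
-- Lines in a plane: the osculating plane at τ meets the plane f in a line whose class is that of the Hessian of f at
-- τ, provided f(τ) ≠ 0. The Hessian is a binary quadratic form of discriminant −3 disc f, which is a square as often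
-- as a nonsquare on the projective line unless disc f = 0, and which is a square at the simple roots of f.
module Submission where

open import Defs
open import Algebra.Bundles using (CommutativeRing)
open import Algebra.Solver.Ring.AlmostCommutativeRing
  using (AlmostCommutativeRing; fromCommutativeRing; _-Raw-AlmostCommutative⟶_; -raw-almostCommutative⟶)
open import Algebra.Structures using (IsCommutativeRing)
open import Data.Bool using (Bool; true; false; T; not; _∧_; _∨_)
open import Data.Bool.ListAction using (any; all)
open import Data.Empty using (⊥; ⊥-elim)
open import Data.Integer as ℤ using (ℤ; -[1+_]; +[1+_]) renaming (+_ to pos)
import Data.Integer.Divisibility as ℤD
import Data.Integer.Divisibility.Signed as ℤS
import Data.Integer.Properties as ℤP
open import Data.List using (List; []; _∷_; map; length; cartesianProduct)
import Data.List.Properties as LP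
open import Data.List.Membership.Propositional using (_∈_; find; lose)
open import Data.List.Membership.Propositional.Properties
  using (∈-map⁺; ∈-map⁻; ∈-concatMap⁺; ∈-concatMap⁻; ∈-deduplicate⁺; ∈-deduplicate⁻;
         ∈-cartesianProduct⁺)
open import Data.List.Relation.Unary.All using ([]; _∷_)
open import Data.List.Relation.Unary.All.Properties using (¬Any⇒All¬)
open import Data.List.Relation.Unary.AllPairs using ([]; _∷_)
open import Data.List.Relation.Unary.Any as Any using (here; there)
open import Data.List.Relation.Unary.Unique.Propositional using (Unique)
import Data.List.Relation.Unary.Unique.Propositional.Properties as Unique
import Data.List.Relation.Unary.Unique.DecPropositional.Properties as DecUnique
open import Data.Maybe as Maybe using (Maybe; just; nothing; is-just)
open import Data.Maybe.Properties using (just-injective)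
open import Data.Nat as ℕ using (ℕ; zero; suc; _≤_; z≤n; s≤s; _≡ᵇ_; _≤ᵇ_; _^_; _∸_; _%_)
import Data.Nat.Divisibility as ℕD
import Data.Nat.Properties as ℕP
open import Data.Product using (_×_; _,_; proj₁; proj₂; ∃)
open import Data.Sum using (_⊎_; inj₁; inj₂; [_,_]′)
open import Data.Unit using (⊤)
open import Data.Vec as V using (Vec; []; _∷_)
open import Data.Vec.N-ary using (N-ary; _$ⁿ_; curryⁿ; ∀ⁿ)
import Data.Vec.Properties as VP
open import Function using (_∘_; case_of_; _⇔_; mk⇔)
open import Level using (0ℓ)
open import Relation.Binary.Definitions using (DecidableEquality)
open import Relation.Binary.PropositionalEquality
open import Relation.Nullary
open import Relation.Nullary.Decidable using (toWitness; fromWitness; map′; dec⇒maybe)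

-- No extension field occurs. That a cubic with nonsquare discriminant has exactly one root is
-- usually read off from the Frobenius action on its roots; here an injection between equinumerous
-- sets supplies the root, and completing the square excludes a second one. The quadratic character
-- does not separate cubics with no root from those with three. Neither number is found directly:
-- once the members of a pencil with one or two roots are counted, two linear relations determine
-- the rest, one counting all members and the other the pairs of a member and one of its roots. For
-- the members without a root the result is 3n = q - χ(-3). As 3 also divides q - ξ, this gives
-- χ(-3) = ξ without quadratic reciprocity. Division by 2 and 3 is justified from q alone. The bound
-- q ≥ 5 supplies the four nonzero arguments at which a cubic polynomial must vanish before its
-- coefficients can be compared.

almostRing : {A : Set} {_+_ _*_ : A → A → A} { -_ : A → A} {0# 1# : A} →
             IsCommutativeRing _≡_ _+_ _*_ -_ 0# 1# → AlmostCommutativeRing 0ℓ 0ℓ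
almostRing isCommutativeRing = fromCommutativeRing (record { isCommutativeRing = isCommutativeRing })

-- Polynomial identities, and consequences of equations by explicit cofactors

module PolynomialIdentity {A : Set} {_+_ _*_ : A → A → A} { -_ : A → A} {0# 1# : A}
  (isCommutativeRing : IsCommutativeRing _≡_ _+_ _*_ -_ 0# 1#)
  (morphism : ℤ.+-*-rawRing -Raw-AlmostCommutative⟶ almostRing isCommutativeRing) where
  import Algebra.Solver.Ring as Solver
  open ≡-Reasoning

  private
    open _-Raw-AlmostCommutative⟶_ morphism using (⟦_⟧)

    _≟ᶜ_ : ∀ i j → Maybe (⟦ i ⟧ ≡ ⟦ j ⟧)
    i ≟ᶜ j = Maybe.map (cong ⟦_⟧) (dec⇒maybe (i ℤP.≟ j))

    module S = Solver ℤ.+-*-rawRing (almostRing isCommutativeRing) morphism _≟ᶜ_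
  open S public using (Polynomial; _:+_; _:*_; _:-_; :-_)

  κ : ∀ {n} → ℕ → Polynomial n
  κ n = S.con (ℤ.+ n)

  private
    vars : ∀ n → Vec (Polynomial n) n
    vars n = V.map S.var (V.allFin n)

    R : CommutativeRing _ _
    R = record { isCommutativeRing = isCommutativeRing }

    open CommutativeRing R using (-‿inverseʳ; +-identityʳ; zeroʳ)
    open import Algebra.Properties.Group (CommutativeRing.+-group R) using (x∙y⁻¹≈ε⇒x≈y)

  Equation : ℕ → Set
  Equation n = Polynomial n × Polynomial n

  infix 4 _⊜_
  _⊜_ : ∀ {n} → Polynomial n → Polynomial n → Equation n
  _⊜_ = _,_

  infix 3 _×[_]
  _×[_] : ∀ {n} → Polynomial n → Equation n → Polynomial n × Equation n
  _×[_] = _,_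

  Holds : ∀ {n} → Vec A n → Equation n → Set
  Holds ρ (u , v) = S.⟦ u ⟧ ρ ≡ S.⟦ v ⟧ ρ

  AllHold : ∀ {n} → Vec A n → List (Polynomial n × Equation n) → Set
  AllHold ρ []             = ⊤
  AllHold ρ ((_ , e) ∷ es) = Holds ρ e × AllHold ρ es

  private
    combination : ∀ {n} → List (Polynomial n × Equation n) → Polynomial n
    combination []                 = κ 0
    combination ((c , u , v) ∷ es) = c :* (u :- v) :+ combination es

    combination≡0 : ∀ {n} (ρ : Vec A n) es → AllHold ρ es → S.⟦ combination es ⟧ ρ ≡ 0#
    combination≡0 ρ [] _ = _-Raw-AlmostCommutative⟶_.0-homo morphism
    combination≡0 ρ ((c , u , v) ∷ es) (h , hs) = trans (cong₂ _+_
      (trans (cong (S.⟦ c ⟧ ρ *_) (trans (cong (λ x → x + (- S.⟦ v ⟧ ρ)) h) (-‿inverseʳ _))) (zeroʳ _))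
      (combination≡0 ρ es hs)) (+-identityʳ 0#)

    -- The normal forms are closed terms, so a boolean test evaluates on them.
    _≈?_ : ∀ {n} → Polynomial n → Polynomial n → Bool
    e₁ ≈? e₂ = is-just (S.normalise e₁ S.≟N S.normalise e₂)

    sound : ∀ {n} (e₁ e₂ : Polynomial n) → T (e₁ ≈? e₂) → ∀ ρ → S.⟦ e₁ ⟧ ρ ≡ S.⟦ e₂ ⟧ ρ
    sound e₁ e₂ t ρ with S.normalise e₁ S.≟N S.normalise e₂
    ... | just eq = trans (sym (S.correct e₁ ρ)) (trans (S.⟦ eq ⟧N-cong ρ) (S.correct e₂ ρ))

    curry-∀ⁿ : ∀ {n} {P : Vec A n → Set} → (∀ ρ → P ρ) → ∀ⁿ n (curryⁿ P)
    curry-∀ⁿ {ℕ.zero}  f = f []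
    curry-∀ⁿ {ℕ.suc n} f = λ x → curry-∀ⁿ (λ ρ → f (x ∷ ρ))

  -- The implicit argument is a closed boolean test that evaluates to `true` for a valid identity,
  -- so its type becomes the unit type and is filled in by unification.
  ring : ∀ n (f : N-ary n (Polynomial n) (Equation n)) →
         let (l , r) = f $ⁿ vars n in
         {T (l ≈? r)} → ∀ⁿ n (curryⁿ λ ρ → Holds ρ (l , r))
  ring n f {t} = let (l , r) = f $ⁿ vars n in curry-∀ⁿ (sound l r t)

  -- l = r follows from u = v, …, once l − r = c (u − v) + … is a polynomial identity.
  lin : ∀ n (f : N-ary n (Polynomial n) (Equation n × List (Polynomial n × Equation n))) →
        let ((l , r) , es) = f $ⁿ vars n in
        {T ((l :- r) ≈? combination es)} → ∀ⁿ n (curryⁿ λ ρ → AllHold ρ es → Holds ρ (l , r))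
  lin n f {t} = let ((l , r) , es) = f $ⁿ vars n in curry-∀ⁿ λ ρ hs →
    x∙y⁻¹≈ε⇒x≈y _ _ (trans (sound (l :- r) (combination es) t ρ) (combination≡0 ρ es hs))

-- Integer coefficients in a field

module FieldSolver (F : FiniteField) where
  open FiniteField F
  open PG F using (ofℕ)
  open ≡-Reasoning

  commutativeRing : CommutativeRing _ _
  commutativeRing = record { isCommutativeRing = isCommutativeRing }

  open CommutativeRing commutativeRing public
    using ( +-assoc; +-comm; +-identityˡ; +-identityʳ; -‿inverseˡ; -‿inverseʳ
          ; *-assoc; *-comm; *-identityˡ; *-identityʳ; distribˡ; distribʳ; zeroˡ; zeroʳ )
  open import Algebra.Properties.Ring (CommutativeRing.ring commutativeRing)
    using (-‿distribˡ-*; -‿involutive; -0#≈0#)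
  open import Algebra.Properties.AbelianGroup (CommutativeRing.+-abelianGroup commutativeRing)
    using (⁻¹-∙-comm)

  private
    ofℤ′ : ℤ → Carrier
    ofℤ′ (pos n)    = ofℕ n
    ofℤ′ -[1+ n ] = - ofℕ (suc n)

  -- ℤ → F, with the value at 1 literally 1# so that the solver's constant 1 reads back as 1#.
  ofℤ : ℤ → Carrier
  ofℤ +[1+ 0 ]  = 1#
  ofℤ -[1+ 0 ]  = - 1#
  ofℤ (pos n)     = ofℕ n
  ofℤ -[1+ n ]  = - ofℕ (suc n)

  private
    ofℤ≡ofℤ′ : ∀ i → ofℤ i ≡ ofℤ′ i
    ofℤ≡ofℤ′ (pos 0)             = refl
    ofℤ≡ofℤ′ (pos 1)             = sym (+-identityʳ 1#)
    ofℤ≡ofℤ′ (pos (suc (suc n)))   = refl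
    ofℤ≡ofℤ′ -[1+ 0 ]          = cong -_ (sym (+-identityʳ 1#))
    ofℤ≡ofℤ′ -[1+ suc n ]      = refl

    ofℕ-+ : ∀ m n → ofℕ (m ℕ.+ n) ≡ ofℕ m + ofℕ n
    ofℕ-+ zero    n = sym (+-identityˡ _)
    ofℕ-+ (suc m) n = trans (cong (1# +_) (ofℕ-+ m n)) (sym (+-assoc _ _ _))

    ofℕ-* : ∀ m n → ofℕ (m ℕ.* n) ≡ ofℕ m * ofℕ n
    ofℕ-* zero    n = sym (zeroˡ _)
    ofℕ-* (suc m) n = begin
      ofℕ (n ℕ.+ m ℕ.* n)             ≡⟨ ofℕ-+ n _ ⟩
      ofℕ n + ofℕ (m ℕ.* n)           ≡⟨ cong₂ _+_ (sym (*-identityˡ _)) (ofℕ-* m n) ⟩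
      1# * ofℕ n + ofℕ m * ofℕ n      ≡⟨ distribʳ _ _ _ ⟨
      (1# + ofℕ m) * ofℕ n            ∎

    ofℤ′-neg : ∀ i → ofℤ′ (ℤ.- i) ≡ - ofℤ′ i
    ofℤ′-neg (pos zero)  = sym -0#≈0#
    ofℤ′-neg +[1+ n ]  = refl
    ofℤ′-neg -[1+ n ]  = sym (-‿involutive _)

    ofℤ′-⊖ : ∀ m n → ofℤ′ (m ℤ.⊖ n) ≡ ofℕ m + - ofℕ n
    ofℤ′-⊖ m       zero    = sym (trans (cong (ofℕ m +_) -0#≈0#) (+-identityʳ _))
    ofℤ′-⊖ zero    (suc n) = sym (+-identityˡ _)
    ofℤ′-⊖ (suc m) (suc n) = begin
      ofℤ′ (suc m ℤ.⊖ suc n)                    ≡⟨ cong ofℤ′ (ℤP.[1+m]⊖[1+n]≡m⊖n m n) ⟩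
      ofℤ′ (m ℤ.⊖ n)                            ≡⟨ ofℤ′-⊖ m n ⟩
      ofℕ m + - ofℕ n                           ≡⟨ cong (_+ - ofℕ n) (+-identityˡ _) ⟨
      (0# + ofℕ m) + - ofℕ n                    ≡⟨ cong (λ z → (z + ofℕ m) + - ofℕ n) (-‿inverseʳ 1#) ⟨
      ((1# + - 1#) + ofℕ m) + - ofℕ n ≡⟨ cong (_+ - ofℕ n) (trans (+-assoc _ _ _) (trans (cong (1# +_) (+-comm _ _))
        (sym (+-assoc _ _ _)))) ⟩
      ((1# + ofℕ m) + - 1#) + - ofℕ n           ≡⟨ +-assoc _ _ _ ⟩
      (1# + ofℕ m) + (- 1# + - ofℕ n)           ≡⟨ cong (ofℕ (suc m) +_) (⁻¹-∙-comm 1# (ofℕ n)) ⟩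
      (1# + ofℕ m) + - (1# + ofℕ n)             ∎

    ofℤ′-+ : ∀ i j → ofℤ′ (i ℤ.+ j) ≡ ofℤ′ i + ofℤ′ j
    ofℤ′-+ (pos m)    (pos n)    = ofℕ-+ m n
    ofℤ′-+ (pos m)    -[1+ n ] = ofℤ′-⊖ m (suc n)
    ofℤ′-+ -[1+ m ] (pos n)    = trans (ofℤ′-⊖ n (suc m)) (+-comm _ _)
    ofℤ′-+ -[1+ m ] -[1+ n ] = begin
      - ofℕ (suc (suc (m ℕ.+ n))) ≡⟨ cong (λ k → - (1# + k)) (trans (cong (1# +_) (ofℕ-+ m n))
        (trans (sym (+-assoc _ _ _)) (trans (cong (_+ ofℕ n) (+-comm _ _)) (+-assoc _ _ _)))) ⟩
      - (1# + (ofℕ m + ofℕ (suc n)))    ≡⟨ cong -_ (+-assoc _ _ _) ⟨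
      - (ofℕ (suc m) + ofℕ (suc n))     ≡⟨ ⁻¹-∙-comm _ _ ⟨
      - ofℕ (suc m) + - ofℕ (suc n)     ∎

    ofℤ′-pos* : ∀ m j → ofℤ′ (pos m ℤ.* j) ≡ ofℕ m * ofℤ′ j
    ofℤ′-pos* m (pos n) = trans (cong ofℤ′ (sym (ℤP.pos-* m n))) (ofℕ-* m n)
    ofℤ′-pos* m -[1+ n ] = begin
      ofℤ′ (pos m ℤ.* -[1+ n ])          ≡⟨ cong ofℤ′ (ℤP.neg-distribʳ-* (pos m) (pos (suc n))) ⟨
      ofℤ′ (ℤ.- (pos m ℤ.* pos (suc n)))     ≡⟨ ofℤ′-neg (pos m ℤ.* pos (suc n)) ⟩
      - ofℤ′ (pos m ℤ.* pos (suc n))         ≡⟨ cong -_ (ofℤ′-pos* m (pos (suc n))) ⟩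
      - (ofℕ m * ofℕ (suc n))          ≡⟨ cong -_ (*-comm _ _) ⟩
      - (ofℕ (suc n) * ofℕ m)          ≡⟨ -‿distribˡ-* _ _ ⟩
      - ofℕ (suc n) * ofℕ m            ≡⟨ *-comm _ _ ⟩
      ofℕ m * - ofℕ (suc n)            ∎

    ofℤ′-* : ∀ i j → ofℤ′ (i ℤ.* j) ≡ ofℤ′ i * ofℤ′ j
    ofℤ′-* (pos m)    j = ofℤ′-pos* m j
    ofℤ′-* -[1+ m ] j = begin
      ofℤ′ (-[1+ m ] ℤ.* j)            ≡⟨ cong ofℤ′ (ℤP.neg-distribˡ-* (pos (suc m)) j) ⟨
      ofℤ′ (ℤ.- (pos (suc m) ℤ.* j))       ≡⟨ ofℤ′-neg (pos (suc m) ℤ.* j) ⟩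
      - ofℤ′ (pos (suc m) ℤ.* j)           ≡⟨ cong -_ (ofℤ′-pos* (suc m) j) ⟩
      - (ofℕ (suc m) * ofℤ′ j)         ≡⟨ -‿distribˡ-* _ _ ⟩
      - ofℕ (suc m) * ofℤ′ j           ∎

    morphism : ℤ.+-*-rawRing -Raw-AlmostCommutative⟶ almostRing isCommutativeRing
    morphism = record
      { ⟦_⟧    = ofℤ
      ; +-homo = λ i j → via i j (i ℤ.+ j) _+_ (ofℤ′-+ i j)
      ; *-homo = λ i j → via i j (i ℤ.* j) _*_ (ofℤ′-* i j)
      ; -‿homo = λ i → trans (ofℤ≡ofℤ′ (ℤ.- i)) (trans (ofℤ′-neg i) (cong -_ (sym (ofℤ≡ofℤ′ i))))
      ; 0-homo = refl
      ; 1-homo = refl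
      }
      where
      via : ∀ i j k (_∙_ : Carrier → Carrier → Carrier) →
            ofℤ′ k ≡ ofℤ′ i ∙ ofℤ′ j → ofℤ k ≡ ofℤ i ∙ ofℤ j
      via i j k _∙_ eq = trans (ofℤ≡ofℤ′ k) (trans eq (sym (cong₂ _∙_ (ofℤ≡ofℤ′ i) (ofℤ≡ofℤ′ j))))

  open PolynomialIdentity isCommutativeRing morphism public

module IntegerSolver where

  open PolynomialIdentity ℤP.+-*-isCommutativeRing (-raw-almostCommutative⟶ _) public

-- Counting by boolean predicates on duplicate-free lists

module Counting where
  open import Defs using (filterᵇ; count; allVecs)
  open import Data.Bool using (Bool; true; false; if_then_else_; T; T?; not; _∧_; _∨_)
  open import Data.Nat
  open import Data.Nat.Properties
  open import Data.Nat.ListAction using (sum)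
  open import Data.List using (List; []; _∷_; _++_; length; map; filter; concatMap; cartesianProduct; cartesianProductWith)
  open import Data.List.Properties using (length-++; length-map)
  open import Data.List.Membership.Propositional using (_∈_; find; lose)
  open import Data.List.Membership.Propositional.Properties
  open import Data.List.Relation.Unary.Any using (here; there)
  open import Data.List.Relation.Unary.Any.Properties using (any⁺; any⁻)
  open import Data.List.Relation.Unary.All as All using (All; []; _∷_)
  open import Data.List.Relation.Unary.All.Properties using (all⁺; all⁻; All¬⇒¬Any; ¬Any⇒All¬)
  open import Data.List.Relation.Unary.AllPairs using ([]; _∷_)
  open import Data.List.Relation.Unary.Unique.Propositional using (Unique)
  import Data.List.Relation.Unary.Unique.Propositional.Properties as Unique
  open import Data.Bool.ListAction using (any; all)
  open import Data.Product using (_×_; _,_; ∃; uncurry)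
  open import Data.Sum using (_⊎_; inj₁; inj₂)
  open import Data.Vec as Vec using (Vec; []; _∷_)
  open import Data.Vec.Properties using (∷-injective)
  open import Data.Empty using (⊥-elim)
  open import Function using (_∘_)
  open import Relation.Nullary
  open import Relation.Binary.PropositionalEquality
  open import Relation.Binary.Definitions using (DecidableEquality)

  private variable
    A B : Set
    p r : A → Bool
    xs ys : List A

  ι : Bool → ℕ
  ι b = if b then 1 else 0

  ∑ : List A → (A → ℕ) → ℕ
  ∑ xs f = sum (map f xs)

  filterᵇ≡filter : ∀ (p : A → Bool) xs → filterᵇ p xs ≡ filter (T? ∘ p) xs
  filterᵇ≡filter p []       = refl
  filterᵇ≡filter p (x ∷ xs) with p x
  ... | true  = cong (x ∷_) (filterᵇ≡filter p xs)
  ... | false = filterᵇ≡filter p xs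

  ∈-filterᵇ⁺ : ∀ {x : A} → x ∈ xs → T (p x) → x ∈ filterᵇ p xs
  ∈-filterᵇ⁺ {xs = xs} {p = p} x∈ px = subst (_ ∈_) (sym (filterᵇ≡filter p xs)) (∈-filter⁺ (T? ∘ p) x∈ px)

  ∈-filterᵇ⁻ : ∀ {x : A} xs → x ∈ filterᵇ p xs → x ∈ xs × T (p x)
  ∈-filterᵇ⁻ {p = p} xs x∈ = ∈-filter⁻ (T? ∘ p) (subst (_ ∈_) (filterᵇ≡filter p xs) x∈)

  filterᵇ-unique : Unique xs → Unique (filterᵇ p xs)
  filterᵇ-unique {xs = xs} {p = p} u = subst Unique (sym (filterᵇ≡filter p xs)) (Unique.filter⁺ (T? ∘ p) u)

  filterᵇ-cong : (∀ x → x ∈ xs → (T (p x) → T (r x)) × (T (r x) → T (p x))) → filterᵇ p xs ≡ filterᵇ r xs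
  filterᵇ-cong {xs = []} h = refl
  filterᵇ-cong {xs = x ∷ xs} {p} {r} h with p x | r x | h x (here refl)
  ... | true  | true  | _ = cong (x ∷_) (filterᵇ-cong (λ y → h y ∘ there))
  ... | false | false | _ = filterᵇ-cong (λ y → h y ∘ there)
  ... | true  | false | f , _ = ⊥-elim (f _)
  ... | false | true  | _ , g = ⊥-elim (g _)

  count-cong : (∀ x → x ∈ xs → (T (p x) → T (r x)) × (T (r x) → T (p x))) → count p xs ≡ count r xs
  count-cong {xs = xs} {p} {r} h = cong length (filterᵇ-cong {xs = xs} {p} {r} h)

  T-any : ∀ {x : A} → x ∈ xs → T (p x) → T (any p xs)
  T-any {p = p} x∈ px = any⁺ p (lose x∈ px)

  any-T : ∀ xs → T (any p xs) → ∃ λ (x : A) → x ∈ xs × T (p x)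
  any-T {p = p} xs t = find (any⁻ p xs t)

  T-all : (∀ x → x ∈ xs → T (p x)) → T (all p xs)
  T-all h = all⁻ _ (All.tabulate (h _))

  all-T : ∀ {x : A} xs → T (all p xs) → x ∈ xs → T (p x)
  all-T xs t x∈ = All.lookup (all⁺ _ xs t) x∈

  T-∧⁺ : ∀ {a b} → T a → T b → T (a ∧ b)
  T-∧⁺ {true} _ t = t

  T-∧⁻ : ∀ {a b} → T (a ∧ b) → T a × T b
  T-∧⁻ {true} t = _ , t

  T-not⁺ : ∀ {b} → ¬ T b → T (not b)
  T-not⁺ {true}  n = n _
  T-not⁺ {false} _ = _

  T-not⁻ : ∀ {b} → T (not b) → ¬ T b
  T-not⁻ {false} _ ()

  T-∨⁻ : ∀ {a b} → T (a ∨ b) → T a ⊎ T b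
  T-∨⁻ {true}  t = inj₁ _
  T-∨⁻ {false} t = inj₂ t

  T-∨⁺ˡ : ∀ {a b} → T a → T (a ∨ b)
  T-∨⁺ˡ {true} _ = _

  T-∨⁺ʳ : ∀ {a b} → T b → T (a ∨ b)
  T-∨⁺ʳ {true}  _ = _
  T-∨⁺ʳ {false} t = t

  -- Pigeonhole, deleting the head of `xs` from `ys` at each step; uniqueness ensures that no later
  -- entry of `xs` is the deleted one.
  unique-⊆-length : Unique xs → (∀ {x : A} → x ∈ xs → x ∈ ys) → length xs ≤ length ys
  unique-⊆-length [] _ = z≤n
  unique-⊆-length {ys = ys} (_∷_ {x} {xs} x∉ u) sub with ∈-∃++ (sub (here refl))
  ... | as , bs , refl = begin
    suc (length xs)                 ≤⟨ s≤s (unique-⊆-length u sub′) ⟩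
    suc (length (as ++ bs))         ≡⟨ cong suc (length-++ as) ⟩
    suc (length as + length bs)     ≡⟨ +-suc _ _ ⟨
    length as + suc (length bs)     ≡⟨ length-++ as ⟨
    length (as ++ x ∷ bs)           ∎
    where
    open ≤-Reasoning
    sub′ : ∀ {y} → y ∈ xs → y ∈ as ++ bs
    sub′ y∈ with ∈-++⁻ as (sub (there y∈))
    ... | inj₁ y∈as         = ∈-++⁺ˡ y∈as
    ... | inj₂ (there y∈bs) = ∈-++⁺ʳ as y∈bs
    ... | inj₂ (here refl)  = ⊥-elim (All¬⇒¬Any x∉ y∈)

  unique-≈-length : Unique xs → Unique ys → (∀ {x : A} → x ∈ xs → x ∈ ys) → (∀ {x} → x ∈ ys → x ∈ xs) →
                    length xs ≡ length ys
  unique-≈-length u v f g = ≤-antisym (unique-⊆-length u f) (unique-⊆-length v g)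

  -- A missing `y` could be put in front of `xs`, giving a duplicate-free list inside `ys` that is
  -- longer than `ys`.
  unique-⊆-length⇒⊇ : DecidableEquality A → Unique xs → (∀ {x : A} → x ∈ xs → x ∈ ys) →
                      length ys ≤ length xs → ∀ {y} → y ∈ ys → y ∈ xs
  unique-⊆-length⇒⊇ {xs = xs} _≟_ u sub le {y} y∈ with any? y xs
    where open import Data.List.Membership.DecPropositional _≟_ renaming (_∈?_ to any?)
  ... | yes y∈xs = y∈xs
  ... | no y∉xs = ⊥-elim (<⇒≱ (unique-⊆-length (¬Any⇒All¬ _ y∉xs ∷ u)
    (λ { (here refl) → y∈ ; (there i) → sub i })) le)

  module _ {xs : List A} {ys : List B} (u : Unique xs) (v : Unique ys) (g : A → B)
    (g-inj : ∀ {x x′} → x ∈ xs → T (p x) → x′ ∈ xs → T (p x′) → g x ≡ g x′ → x ≡ x′) where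

    private
      map-unique : ∀ {zs} → Unique zs → (∀ {x} → x ∈ zs → x ∈ xs × T (p x)) → Unique (map g zs)
      map-unique [] _ = []
      map-unique {zs = z ∷ zs} (z∉ ∷ u) h =
        ¬Any⇒All¬ _ (λ gz∈ → let (x , x∈ , e) = ∈-map⁻ g gz∈
                                 (z∈xs , pz) = h (here refl)
                                 (x∈xs , px) = h (there x∈)
                             in All¬⇒¬Any z∉ (subst (_∈ zs) (sym (g-inj z∈xs pz x∈xs px e)) x∈))
        ∷ map-unique u (h ∘ there)

      image-unique : Unique (map g (filterᵇ p xs))
      image-unique = map-unique (filterᵇ-unique u) (∈-filterᵇ⁻ xs)

      image-⊆ : (∀ {x} → x ∈ xs → T (p x) → g x ∈ ys × T (r (g x))) →
                ∀ {y} → y ∈ map g (filterᵇ p xs) → y ∈ filterᵇ r ys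
      image-⊆ to y∈ with ∈-map⁻ g y∈
      ... | x , x∈ , refl = let (x∈xs , px) = ∈-filterᵇ⁻ xs x∈
                                (gx∈ , rgx) = to x∈xs px in ∈-filterᵇ⁺ gx∈ rgx

    count-bij : (∀ {x} → x ∈ xs → T (p x) → g x ∈ ys × T (r (g x))) →
                (∀ {y} → y ∈ ys → T (r y) → ∃ λ x → x ∈ xs × T (p x) × g x ≡ y) →
                count p xs ≡ count r ys
    count-bij {r = r} to surj = trans (sym (length-map g (filterᵇ p xs)))
      (unique-≈-length image-unique (filterᵇ-unique v) (image-⊆ to) back)
      where
      back : ∀ {y} → y ∈ filterᵇ r ys → y ∈ map g (filterᵇ p xs)
      back y∈ = let (y∈ys , ry) = ∈-filterᵇ⁻ ys y∈
                    (x , x∈ , px , e) = surj y∈ys ry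
                in subst (_∈ _) e (∈-map⁺ g (∈-filterᵇ⁺ x∈ px))

    -- An injection into a set that is no larger is onto. This produces preimages for which no
    -- formula is at hand: quotients of nonsquares that are squares, and roots of cubics.
    count-inj-surj : DecidableEquality B →
                (∀ {x} → x ∈ xs → T (p x) → g x ∈ ys × T (r (g x))) →
                count r ys ≤ count p xs →
                ∀ {y} → y ∈ ys → T (r y) → ∃ λ x → x ∈ xs × T (p x) × g x ≡ y
    count-inj-surj {r = r} _≟_ to le y∈ ry =
      let (x , x∈ , e) = ∈-map⁻ g (unique-⊆-length⇒⊇ _≟_ image-unique (image-⊆ to)
                           (≤-trans le (≤-reflexive (sym (length-map g (filterᵇ p xs))))) (∈-filterᵇ⁺ y∈ ry))
          (x∈xs , px) = ∈-filterᵇ⁻ xs x∈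
      in x , x∈xs , px , sym e

  count-enum : ∀ {xs zs : List A} → Unique xs → Unique zs → (∀ {x} → x ∈ xs → T (p x) → x ∈ zs) →
               (∀ {x} → x ∈ zs → x ∈ xs × T (p x)) → count p xs ≡ length zs
  count-enum {xs = xs} u v f g =
    unique-≈-length (filterᵇ-unique u) v (λ x∈ → uncurry f (∈-filterᵇ⁻ xs x∈)) (λ x∈ → uncurry ∈-filterᵇ⁺ (g x∈))

  count-none : (∀ {x : A} → x ∈ xs → ¬ T (p x)) → count p xs ≡ 0
  count-none {xs = []} h = refl
  count-none {xs = x ∷ xs} {p} h with p x in e
  ... | true  = ⊥-elim (h (here refl) (subst T (sym e) _))
  ... | false = count-none (h ∘ there)

  count-suc⇒∃ : ∀ (xs : List A) → 1 ≤ count p xs → ∃ λ x → x ∈ xs × T (p x)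
  count-suc⇒∃ {p = p} xs le with filterᵇ p xs in e
  ... | y ∷ _ = y , ∈-filterᵇ⁻ xs (subst (y ∈_) (sym e) (here refl))

  count-∷ : ∀ x (xs : List A) → count p (x ∷ xs) ≡ ι (p x) + count p xs
  count-∷ {p = p} x xs with p x
  ... | true  = refl
  ... | false = refl

  count≡∑ : ∀ (xs : List A) → count p xs ≡ ∑ xs (ι ∘ p)
  count≡∑ []       = refl
  count≡∑ {p = p} (x ∷ xs) = trans (count-∷ {p = p} x xs) (cong (_ +_) (count≡∑ xs))

  count-map : ∀ (g : A → B) xs → count p (map g xs) ≡ count (p ∘ g) xs
  count-map g [] = refl
  count-map {p = p} g (x ∷ xs) with p (g x)
  ... | true  = cong suc (count-map g xs)
  ... | false = count-map g xs

  count-not : ∀ (p : A → Bool) xs → count p xs + count (not ∘ p) xs ≡ length xs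
  count-not p [] = refl
  count-not p (x ∷ xs) with p x
  ... | true  = cong suc (count-not p xs)
  ... | false = trans (+-suc _ _) (cong suc (count-not p xs))

  ∑-cong : ∀ {f g : A → ℕ} xs → (∀ x → x ∈ xs → f x ≡ g x) → ∑ xs f ≡ ∑ xs g
  ∑-cong []       h = refl
  ∑-cong (x ∷ xs) h = cong₂ _+_ (h x (here refl)) (∑-cong xs (λ y → h y ∘ there))

  ∑-+ : ∀ (f g : A → ℕ) xs → ∑ xs (λ x → f x + g x) ≡ ∑ xs f + ∑ xs g
  ∑-+ f g []       = refl
  ∑-+ f g (x ∷ xs) = trans (cong (f x + g x +_) (∑-+ f g xs)) (+-interchange (f x) _ _ _)
    where
    open import Algebra.Properties.CommutativeSemigroup +-commutativeSemigroup using () renaming (interchange to +-interchange)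

  ∑-* : ∀ c (f : A → ℕ) xs → ∑ xs (λ x → c * f x) ≡ c * ∑ xs f
  ∑-* c f []       = sym (*-zeroʳ c)
  ∑-* c f (x ∷ xs) = trans (cong (c * f x +_) (∑-* c f xs)) (sym (*-distribˡ-+ c _ _))

  ∑-1 : ∀ (xs : List A) → ∑ xs (λ _ → 1) ≡ length xs
  ∑-1 []       = refl
  ∑-1 (x ∷ xs) = cong suc (∑-1 xs)

  ∑-0 : ∀ (xs : List A) → ∑ xs (λ _ → 0) ≡ 0
  ∑-0 []       = refl
  ∑-0 (x ∷ xs) = ∑-0 xs

  -- Summing the fibre sizes of g recovers the size of its domain.
  ∑-fibres : ∀ {ys : List B} (_≟_ : DecidableEquality B) → Unique ys → (g : A → B) → ∀ xs →
             (∀ {x} → x ∈ xs → g x ∈ ys) → ∑ ys (λ y → count (λ x → ⌊ g x ≟ y ⌋) xs) ≡ length xs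
  ∑-fibres {ys = ys} _≟_ u g [] h = ∑-0 ys
  ∑-fibres {ys = ys} _≟_ u g (x ∷ xs) h = begin
    ∑ ys (λ y → count (λ z → ⌊ g z ≟ y ⌋) (x ∷ xs)) ≡⟨ ∑-cong ys (λ y _ → count-∷ {p = λ z → ⌊ g z ≟ y ⌋} x xs) ⟩
    ∑ ys (λ y → ι ⌊ g x ≟ y ⌋ + count (λ z → ⌊ g z ≟ y ⌋) xs)                       ≡⟨ ∑-+ _ _ ys ⟩
    ∑ ys (λ y → ι ⌊ g x ≟ y ⌋) + ∑ ys (λ y → count (λ z → ⌊ g z ≟ y ⌋) xs) ≡⟨ cong₂ _+_ one
      (∑-fibres _≟_ u g xs (h ∘ there)) ⟩
    suc (length xs)                                                                ∎
    where
    open ≡-Reasoning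
    one : ∑ ys (λ y → ι ⌊ g x ≟ y ⌋) ≡ 1
    one = trans (sym (count≡∑ ys)) (count-enum {zs = g x ∷ []} u ([] ∷ [])
      (λ _ t → here (sym (toWitness t))) (λ { (here refl) → h (here refl) , fromWitness refl }))
      where open import Relation.Nullary.Decidable using (toWitness; fromWitness)

  count-product : ∀ (p : A × B → Bool) xs ys →
                  count p (cartesianProduct xs ys) ≡ ∑ xs (λ x → count (λ y → p (x , y)) ys)
  count-product p [] ys = refl
  count-product p (x ∷ xs) ys = begin
    count p (map (x ,_) ys ++ cartesianProduct xs ys)                ≡⟨ count-++ (map (x ,_) ys) ⟩
    count p (map (x ,_) ys) + count p (cartesianProduct xs ys) ≡⟨ cong₂ _+_ (count-map (x ,_) ys)
      (count-product p xs ys) ⟩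
    count (λ y → p (x , y)) ys + ∑ xs (λ x → count (λ y → p (x , y)) ys) ∎
    where
    open ≡-Reasoning
    count-++ : ∀ as {bs} → count p (as ++ bs) ≡ count p as + count p bs
    count-++ [] = refl
    count-++ (a ∷ as) with p a
    ... | true  = cong suc (count-++ as)
    ... | false = count-++ as

  allVecs≡ : ∀ (xs : List A) n → allVecs xs (suc n) ≡ cartesianProductWith _∷_ xs (allVecs xs n)
  allVecs≡ xs n = go xs
    where
    go : ∀ ys → concatMap (λ x → map (x ∷_) (allVecs xs n)) ys ≡ cartesianProductWith _∷_ ys (allVecs xs n)
    go []       = refl
    go (y ∷ ys) = cong (map (y ∷_) (allVecs xs n) ++_) (go ys)

  allVecs-complete : (∀ (x : A) → x ∈ xs) → ∀ {n} (v : Vec A n) → v ∈ allVecs xs n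
  allVecs-complete c [] = here refl
  allVecs-complete {xs = xs} c {suc n} (x ∷ v) = subst (_ ∈_) (sym (allVecs≡ xs n))
    (∈-cartesianProductWith⁺ _∷_ (c x) (allVecs-complete c v))

  allVecs-unique : Unique xs → ∀ n → Unique (allVecs xs n)
  allVecs-unique u zero    = [] ∷ []
  allVecs-unique {xs = xs} u (suc n) = subst Unique (sym (allVecs≡ xs n))
    (Unique.cartesianProductWith⁺ _∷_ ∷-injective u (allVecs-unique u n))

open Counting

-- Quadratic classes and the linear arithmetic of the counts

module Arith where
  open IntegerSolver
  open import Data.Nat
  open import Data.Nat.Properties using (m+n∸n≡m)
  open import Data.Nat.Tactic.RingSolver using (solve-∀)
  open import Data.Integer as ℤ using (ℤ; -[1+_]) renaming (+_ to pos)
  open import Data.Integer.Properties using (+-injective)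
  open import Data.List using ([]; _∷_)
  open import Data.Product using (_,_)
  open import Relation.Binary.PropositionalEquality
  open import Relation.Binary.Definitions using (DecidableEquality)
  open import Relation.Nullary
  open import Data.Empty using (⊥-elim)

  data Class : Set where
    null square nonsquare : Class

  infixl 7 _·_
  _·_ : Class → Class → Class
  null      · _         = null
  square    · c         = c
  nonsquare · null      = null
  nonsquare · square    = nonsquare
  nonsquare · nonsquare = square

  _≟ᶜ_ : DecidableEquality Class
  null      ≟ᶜ null      = yes refl
  null      ≟ᶜ square    = no λ ()
  null      ≟ᶜ nonsquare = no λ ()
  square    ≟ᶜ null      = no λ ()
  square    ≟ᶜ square    = yes refl
  square    ≟ᶜ nonsquare = no λ ()
  nonsquare ≟ᶜ null      = no λ ()
  nonsquare ≟ᶜ square    = no λ ()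
  nonsquare ≟ᶜ nonsquare = yes refl

  -- The number of square roots of an element of the given class, that is, one plus the value of the
  -- quadratic character.
  #roots : Class → ℕ
  #roots null      = 1
  #roots square    = 2
  #roots nonsquare = 0

  ℕ→ℤ : ∀ {m n} → m ≡ n → pos m ≡ pos n
  ℕ→ℤ = cong pos

  -- In the next lemmas z, s, n are the numbers of arguments at which a quantity is zero, a nonzero square or a nonsquare.
  conic-nonsquares : ∀ {z s n q} → z + 2 * s + 1 ≡ q → z + s + n ≡ q → n ≡ s + 1
  conic-nonsquares {z} {s} {n} {q} h h′ = +-injective
    (lin 4 (λ z s n q → (n ⊜ s :+ κ 1) , (κ 1 ×[ z :+ s :+ n ⊜ q ]) ∷
      (:- (κ 1) ×[ z :+ (s :+ (s :+ κ 0)) :+ κ 1 ⊜ q ]) ∷ []) (pos z) (pos s) (pos n) (pos q) (ℕ→ℤ h′ , ℕ→ℤ h , _))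

  squares≡nonsquares : ∀ {s n q} → 1 + 2 * s ≡ q → 1 + s + n ≡ q → n ≡ s
  squares≡nonsquares {s} {n} {q} h h′ = +-injective
    (lin 3 (λ s n q → (n ⊜ s) , (κ 1 ×[ κ 1 :+ s :+ n ⊜ q ]) ∷ (:- (κ 1) ×[ κ 1 :+ (s :+ (s :+ κ 0)) ⊜ q ]) ∷ [])
      (pos s) (pos n) (pos q) (ℕ→ℤ h′ , ℕ→ℤ h , _))

  conic-squares : ∀ {z s q} → z + 2 * s + 1 ≡ q → 2 * (s + 1) + z ≡ q + 1
  conic-squares {z} {s} {q} h = +-injective
    (lin 3 (λ z s q → (s :+ κ 1 :+ (s :+ κ 1 :+ κ 0) :+ z ⊜ q :+ κ 1) ,
      (κ 1 ×[ z :+ (s :+ (s :+ κ 0)) :+ κ 1 ⊜ q ]) ∷ []) (pos z) (pos s) (pos q) (ℕ→ℤ h , _))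

  line-squares : ∀ {s q} → 1 + 2 * s ≡ q → 2 * s + 2 ≡ q + 1
  line-squares {s} {q} h = +-injective
    (lin 2 (λ s q → (s :+ (s :+ κ 0) :+ κ 2 ⊜ q :+ κ 1) , (κ 1 ×[ κ 1 :+ (s :+ (s :+ κ 0)) ⊜ q ]) ∷ []) (pos s)
      (pos q) (ℕ→ℤ h , _))

  sign : Class → ℤ
  sign null      = pos 0
  sign square    = pos 1
  sign nonsquare = -[1+ 0 ]

  simple-roots-square : ∀ {r s q n} → r + 2 * s + 1 ≡ q → n ≡ s + 1 → pos 2 ℤ.* pos n
    ≡ pos q ℤ.+ sign square ℤ.- pos r
  simple-roots-square {r} {s} {q} {n} h h′ =
    (lin 4 (λ r s q n → (κ 2 :* n ⊜ q :+ κ 1 :- r) , (κ 2 ×[ n ⊜ s :+ κ 1 ]) ∷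
      (κ 1 ×[ r :+ (s :+ (s :+ κ 0)) :+ κ 1 ⊜ q ]) ∷ []) (pos r) (pos s) (pos q) (pos n) (ℕ→ℤ h′ , ℕ→ℤ h , _))

  simple-roots-nonsquare : ∀ {r s q n} → r + 2 * s + 1 ≡ q → n ≡ s → pos 2 ℤ.* pos n
    ≡ pos q ℤ.+ sign nonsquare ℤ.- pos r
  simple-roots-nonsquare {r} {s} {q} {n} h h′ =
    (lin 4 (λ r s q n → (κ 2 :* n ⊜ q :+ :- (κ 1) :- r) , (κ 2 ×[ n ⊜ s ]) ∷
      (κ 1 ×[ r :+ (s :+ (s :+ κ 0)) :+ κ 1 ⊜ q ]) ∷ []) (pos r) (pos s) (pos q) (pos n) (ℕ→ℤ h′ , ℕ→ℤ h , _))

  -- `n₁`, `n₂`, `n₃` are the numbers of members of a pencil with one, two or three roots, so the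
  -- weighted sum counts pairs of a member and a root of it. `e` is the sign of -3, and `r` the
  -- number of members with a double root.
  triple-roots : ∀ {q e r n₁ n₂ n₃} → n₁ + 2 * n₂ + 3 * n₃ ≡ q → n₂ ≡ r → pos 2 ℤ.* pos n₁ ≡ pos q ℤ.+ e ℤ.- pos r →
                 pos 6 ℤ.* pos n₃ ≡ pos q ℤ.- e ℤ.- pos 3 ℤ.* pos r
  triple-roots {q} {e} {r} {n₁} {n₂} {n₃} h h₂ h₁ =
    (lin 6 (λ q e r n₁ n₂ n₃ → (κ 6 :* n₃ ⊜ q :- e :- κ 3 :* r) , (κ 2 ×[ n₁ :+ (n₂ :+ (n₂ :+ κ 0)) :+
      (n₃ :+ (n₃ :+ (n₃ :+ κ 0))) ⊜ q ]) ∷ (:- (κ 4) ×[ n₂ ⊜ r ]) ∷ (:- (κ 1) ×[ κ 2 :* n₁ ⊜ q :+ e :- r ]) ∷ [])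
      (pos q) e (pos r) (pos n₁) (pos n₂) (pos n₃) (ℕ→ℤ h , ℕ→ℤ h₂ , h₁ , _))

  no-roots : ∀ {q e r n₀ n₁ n₂ n₃} → n₀ + n₁ + n₂ + n₃ ≡ q → n₁ + 2 * n₂ + 3 * n₃ ≡ q → n₂ ≡ r →
             pos 2 ℤ.* pos n₁ ≡ pos q ℤ.+ e ℤ.- pos r → pos 3 ℤ.* pos n₀ ≡ pos q ℤ.- e
  no-roots {q} {e} {r} {n₀} {n₁} {n₂} {n₃} t h h₂ h₁ =
    (lin 7 (λ q e r n₀ n₁ n₂ n₃ → (κ 3 :* n₀ ⊜ q :- e) , (κ 3 ×[ n₀ :+ n₁ :+ n₂ :+ n₃ ⊜ q ]) ∷
      (:- (κ 1) ×[ n₁ :+ (n₂ :+ (n₂ :+ κ 0)) :+ (n₃ :+ (n₃ :+ (n₃ :+ κ 0))) ⊜ q ]) ∷ (:- (κ 1) ×[ n₂ ⊜ r ]) ∷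
      (:- (κ 1) ×[ κ 2 :* n₁ ⊜ q :+ e :- r ]) ∷ []) (pos q) e (pos r) (pos n₀) (pos n₁) (pos n₂) (pos n₃)
      (ℕ→ℤ t , ℕ→ℤ h , ℕ→ℤ h₂ , h₁ , _))

  -- A form with discriminant of class `e` has `#roots e` zeros on the projective line; `f` is the
  -- number of points where it takes one given nonzero class, and `n` of these are to be left out.
  axes-through : ∀ e {m n f q} → e ≢ null → m + n ≡ f → 2 * f + #roots e ≡ q + 1 → pos 2 ℤ.* pos m
    ≡ pos q ℤ.- sign e ℤ.- pos 2 ℤ.* pos n
  axes-through null e≢ = ⊥-elim (e≢ refl)
  axes-through square {m} {n} {f} {q} _ h h′ =
    (lin 4 (λ m n f q → (κ 2 :* m ⊜ q :- κ 1 :- κ 2 :* n) , (κ 2 ×[ m :+ n ⊜ f ]) ∷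
      (κ 1 ×[ f :+ (f :+ κ 0) :+ κ 2 ⊜ q :+ κ 1 ]) ∷ []) (pos m) (pos n) (pos f) (pos q) (ℕ→ℤ h , ℕ→ℤ h′ , _))
  axes-through nonsquare {m} {n} {f} {q} _ h h′ =
    (lin 4 (λ m n f q → (κ 2 :* m ⊜ q :- :- (κ 1) :- κ 2 :* n) , (κ 2 ×[ m :+ n ⊜ f ]) ∷
      (κ 1 ×[ f :+ (f :+ κ 0) :+ κ 0 ⊜ q :+ κ 1 ]) ∷ []) (pos m) (pos n) (pos f) (pos q) (ℕ→ℤ h , ℕ→ℤ h′ , _))

  orbit-size : ∀ s q → 1 + 2 * s ≡ q → 2 * (s * q * suc q) ≡ q ^ 3 ∸ q
  -- Adding `q` on both sides turns the truncated difference into a polynomial identity in `s`.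
  orbit-size s q refl = trans (sym (m+n∸n≡m (2 * (s * q * suc q)) q)) (cong (_∸ q) (identity s))
    where
    identity : ∀ s → 2 * (s * (1 + 2 * s) * (1 + (1 + 2 * s))) + (1 + 2 * s) ≡ (1 + 2 * s) *
      ((1 + 2 * s) * ((1 + 2 * s) * 1))
    identity = solve-∀

open Arith

-- Field arithmetic and counting field elements

module FieldBasics (F : FiniteField) where
  open FiniteField F public renaming (_≟_ to infix 4 _≟_)
  open PG F public using (ofℕ) renaming (_==_ to infix 4 _==_)
  open FieldSolver F public
  open ≡-Reasoning

  infix 30 _⁻¹

  abstract
    -- Total, with the default value 0 at 0; opaque, so that goals show the inverse and not its case
    -- distinction.
    _⁻¹ : Carrier → Carrier
    x ⁻¹ with x ≟ 0#
    ... | yes _   = 0#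
    ... | no x≢0 = proj₁ (inverse x x≢0)

    ⁻¹-inverse : ∀ {x} → x ≢ 0# → x * x ⁻¹ ≡ 1#
    ⁻¹-inverse {x} x≢0 with x ≟ 0#
    ... | yes x≡0 = ⊥-elim (x≢0 x≡0)
    ... | no x≢0′ = proj₂ (inverse x x≢0′)

  cancel : ∀ {c x y} → c ≢ 0# → c * x ≡ c * y → x ≡ y
  cancel {c} {x} {y} c≢0 e =
    (lin 4 (λ x y c c′ → (x ⊜ y) , (y :- x ×[ c :* c′ ⊜ κ 1 ]) ∷ (c′ ×[ c :* x ⊜ c :* y ]) ∷ []) x y c (c ⁻¹)
      (⁻¹-inverse c≢0 , e , _))

  cancel-0 : ∀ {c x} → c ≢ 0# → c * x ≡ 0# → x ≡ 0#
  cancel-0 {c} c≢0 e = cancel c≢0 (trans e (sym (zeroʳ c)))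

  zero-product : ∀ {x y} → x * y ≡ 0# → x ≡ 0# ⊎ y ≡ 0#
  zero-product {x} e with x ≟ 0#
  ... | yes x≡0 = inj₁ x≡0
  ... | no x≢0  = inj₂ (cancel-0 x≢0 e)

  *-≢0 : ∀ {x y} → x ≢ 0# → y ≢ 0# → x * y ≢ 0#
  *-≢0 x≢0 y≢0 e = y≢0 (cancel-0 x≢0 e)

  ⁻¹-≢0 : ∀ {x} → x ≢ 0# → x ⁻¹ ≢ 0#
  ⁻¹-≢0 {x} x≢0 e = 0≢1 (trans (sym (trans (cong (x *_) e) (zeroʳ x))) (⁻¹-inverse x≢0))

  1≢0 : 1# ≢ 0#
  1≢0 = 0≢1 ∘ sym

  -‿≢0 : ∀ {x} → x ≢ 0# → - x ≢ 0#
  -‿≢0 {x} x≢0 e = x≢0 (lin 1 (λ x → (x ⊜ κ 0) , (:- (κ 1) ×[ :- x ⊜ κ 0 ]) ∷ []) x (e , _))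

  square-0 : ∀ {x} → x * x ≡ 0# → x ≡ 0#
  square-0 e = [ (λ z → z) , (λ z → z) ]′ (zero-product e)

  ==⁺ : ∀ {x y} → x ≡ y → T (x == y)
  ==⁺ = fromWitness

  ==⁻ : ∀ {x y} → T (x == y) → x ≡ y
  ==⁻ = toWitness

  pairs-unique : Unique (cartesianProduct elems elems)
  pairs-unique = Unique.cartesianProduct⁺ elems-unique elems-unique

  pairs-complete : ∀ p → p ∈ cartesianProduct elems elems
  pairs-complete (x , y) = ∈-cartesianProduct⁺ (elems-complete x) (elems-complete y)

  #_ : (Carrier → Bool) → ℕ
  # p = count p elems

  #-cong : ∀ {p r} → (∀ {x} → T (p x) → T (r x)) → (∀ {x} → T (r x) → T (p x)) → # p ≡ # r
  #-cong {p} {r} f g = count-cong {xs = elems} {p = p} {r = r} (λ _ _ → f , g)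

  #-bij : ∀ {p r} (g h : Carrier → Carrier) → (∀ x → h (g x) ≡ x) → (∀ y → g (h y) ≡ y) →
          (∀ {x} → T (p x) → T (r (g x))) → (∀ {x} → T (r (g x)) → T (p x)) → # p ≡ # r
  #-bij {p} {r} g h hg gh to from = count-bij {p = p} elems-unique elems-unique g
    (λ {x} {x′} _ _ _ _ e → trans (sym (hg x)) (trans (cong h e) (hg x′)))
    {r = r} (λ {x} _ px → elems-complete (g x) , to px)
    (λ {y} _ ry → h y , elems-complete (h y) , from (subst (T ∘ r) (sym (gh y)) ry) , gh y)

  #-enum : ∀ {p} zs → Unique zs → (∀ {x} → T (p x) → x ∈ zs) → (∀ {x} → x ∈ zs → T (p x)) → # p ≡ length zs
  #-enum {p} zs u f g = count-enum {p = p} elems-unique u (λ _ → f) (λ {x} x∈ → elems-complete x , g x∈)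

  #-none : ∀ {p} → (∀ {x} → ¬ T (p x)) → # p ≡ 0
  #-none {p} h = count-none {xs = elems} {p = p} (λ _ → h)

  #≡∑ : ∀ p → # p ≡ ∑ elems (ι ∘ p)
  #≡∑ p = count≡∑ {p = p} elems

  #≡0 : # (_== 0#) ≡ 1
  #≡0 = #-enum (0# ∷ []) ([] ∷ []) (λ t → here (==⁻ t)) (λ { (here refl) → ==⁺ refl })

-- The quadratic character and the values of binary quadratic forms

module Character (F : FiniteField) (2≢0 : PG.ofℕ F 2 ≢ FiniteField.0# F) where
  open FieldBasics F public
  open ≡-Reasoning

  ½ : Carrier
  ½ = ofℕ 2 ⁻¹

  ½-inverse : ofℕ 2 * ½ ≡ 1#
  ½-inverse = ⁻¹-inverse 2≢0

  x≡-x⇒x≡0 : ∀ {x} → x ≡ - x → x ≡ 0#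
  x≡-x⇒x≡0 {x} e = cancel-0 2≢0 (lin 1 (λ x → (κ 2 :* x ⊜ κ 0) , (κ 1 ×[ x ⊜ :- x ]) ∷ []) x (e , _))

  sqrt? : ∀ x → Dec (∃ λ r → r * r ≡ x)
  sqrt? x = map′ (λ a → let (r , _ , e) = find a in r , e) (λ (r , e) → lose (elems-complete r) e)
                 (Any.any? (λ r → r * r ≟ x) elems)

  abstract
    χ : Carrier → Class
    χ x with x ≟ 0# | sqrt? x
    ... | yes _ | _     = null
    ... | no _  | yes _ = square
    ... | no _  | no _  = nonsquare

    χ-null : ∀ {x} → x ≡ 0# → χ x ≡ null
    χ-null {x} x≡0 with x ≟ 0# | sqrt? x
    ... | yes _  | _ = refl
    ... | no x≢0 | _ = ⊥-elim (x≢0 x≡0)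

    χ-null⁻ : ∀ {x} → χ x ≡ null → x ≡ 0#
    χ-null⁻ {x} e with x ≟ 0# | sqrt? x
    ... | yes x≡0 | _ = x≡0
    χ-null⁻ () | no _ | yes _
    χ-null⁻ () | no _ | no _

    χ-square : ∀ {x r} → r ≢ 0# → r * r ≡ x → χ x ≡ square
    χ-square {x} {r} r≢0 e with x ≟ 0# | sqrt? x
    ... | yes x≡0 | _     = ⊥-elim (r≢0 (square-0 (trans e x≡0)))
    ... | no _    | yes _ = refl
    ... | no _    | no ¬r = ⊥-elim (¬r (r , e))

    χ-square⁻ : ∀ {x} → χ x ≡ square → ∃ λ r → r ≢ 0# × r * r ≡ x
    χ-square⁻ {x} e with x ≟ 0# | sqrt? x
    χ-square⁻ () | yes _ | _
    ... | no x≢0 | yes (r , rr≡x) = r , (λ r≡0 → x≢0 (trans (sym rr≡x) (trans (cong (_* r) r≡0) (zeroˡ r)))) , rr≡x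
    χ-square⁻ () | no _ | no _

    χ-nonsquare : ∀ {x} → ¬ (∃ λ r → r * r ≡ x) → χ x ≡ nonsquare
    χ-nonsquare {x} ¬r with x ≟ 0# | sqrt? x
    ... | yes x≡0 | _     = ⊥-elim (¬r (0# , trans (zeroˡ 0#) (sym x≡0)))
    ... | no _    | yes r = ⊥-elim (¬r r)
    ... | no _    | no _  = refl

    χ-nonsquare⁻ : ∀ {x} → χ x ≡ nonsquare → ¬ (∃ λ r → r * r ≡ x)
    χ-nonsquare⁻ {x} e with x ≟ 0# | sqrt? x
    χ-nonsquare⁻ () | yes _ | _
    χ-nonsquare⁻ () | no _ | yes _
    ... | no _ | no ¬r = ¬r

  χ≢null : ∀ {x} → x ≢ 0# → χ x ≢ null
  χ≢null x≢0 e = x≢0 (χ-null⁻ e)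

  χ≢null⁻ : ∀ {x} → χ x ≢ null → x ≢ 0#
  χ≢null⁻ h x≡0 = h (χ-null x≡0)

  is : Class → Carrier → Bool
  is c x = ⌊ χ x ≟ᶜ c ⌋

  is⁺ : ∀ {c x} → χ x ≡ c → T (is c x)
  is⁺ = fromWitness

  is⁻ : ∀ {c x} → T (is c x) → χ x ≡ c
  is⁻ = toWitness

  #sqrt : ∀ y → # (λ x → x * x == y) ≡ #roots (χ y)
  #sqrt y with χ y in e
  ... | null = #-enum (0# ∷ []) ([] ∷ [])
    (λ t → here (square-0 (trans (==⁻ t) (χ-null⁻ e))))
    (λ { (here refl) → ==⁺ (trans (zeroˡ 0#) (sym (χ-null⁻ e))) })
  ... | nonsquare = #-none (λ {x} t → χ-nonsquare⁻ e (x , ==⁻ t))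
  ... | square with χ-square⁻ e
  ... | r , r≢0 , rr≡y = #-enum (r ∷ - r ∷ []) (((λ r≡-r → r≢0 (x≡-x⇒x≡0 r≡-r)) ∷ []) ∷ [] ∷ [])
    (λ {x} t → [ (λ h → here (lin 2 (λ x r → (x ⊜ r) , (κ 1 ×[ x :- r ⊜ κ 0 ]) ∷ []) x r (h , _))) ,
                 (λ h → there (here (lin 2 (λ x r → (x ⊜ :- r) , (κ 1 ×[ x :+ r ⊜ κ 0 ]) ∷ []) x r (h , _)))) ]′
               (zero-product {x + - r} {x + r}
                 (lin 3 (λ x r y → ((x :- r) :* (x :+ r) ⊜ κ 0) , (κ 1 ×[ x :* x ⊜ y ]) ∷
                   (:- (κ 1) ×[ r :* r ⊜ y ]) ∷ []) x r y (==⁻ t , rr≡y , _))))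
    (λ { (here refl) → ==⁺ rr≡y
       ; (there (here refl)) → ==⁺ (lin 2 (λ r y → (:- r :* :- r ⊜ y) , (κ 1 ×[ r :* r ⊜ y ]) ∷ []) r y (rr≡y , _)) })

  -- Both sides count the points of the curve x² = f(t): above t lie one point, two or none,
  -- according to the class of f(t).
  ∑-#sqrt : ∀ (f : Carrier → Carrier) → ∑ elems (λ t → # (λ x → x * x == f t)) ≡
            # (λ t → is null (f t)) ℕ.+ 2 ℕ.* # (λ t → is square (f t))
  ∑-#sqrt f = begin
    ∑ elems (λ t → # (λ x → x * x == f t)) ≡⟨ ∑-cong elems (λ t _ → trans (#sqrt (f t)) (split (χ (f t)))) ⟩
    ∑ elems (λ t → ι (is null (f t)) ℕ.+ 2 ℕ.* ι (is square (f t)))                      ≡⟨ ∑-+ _ _ elems ⟩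
    ∑ elems (λ t → ι (is null (f t))) ℕ.+ ∑ elems (λ t → 2 ℕ.* ι (is square (f t))) ≡⟨ cong₂ ℕ._+_
      (sym (#≡∑ (λ t → is null (f t)))) (trans (∑-* 2 _ elems) (cong (2 ℕ.*_) (sym (#≡∑ (λ t → is square (f t)))))) ⟩
    # (λ t → is null (f t)) ℕ.+ 2 ℕ.* # (λ t → is square (f t))                          ∎
    where
    split : ∀ c → #roots c ≡ ι ⌊ c ≟ᶜ null ⌋ ℕ.+ 2 ℕ.* ι ⌊ c ≟ᶜ square ⌋
    split null      = refl
    split square    = refl
    split nonsquare = refl

  #-classes : ∀ (f : Carrier → Carrier) → # (λ t → is null (f t)) ℕ.+ # (λ t → is square (f t)) ℕ.+ #
    (λ t → is nonsquare (f t)) ≡ q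
  #-classes f = begin
    N null ℕ.+ N square ℕ.+ N nonsquare ≡⟨ cong₂ ℕ._+_ (cong₂ ℕ._+_ (#≡∑ (λ t → is null (f t)))
      (#≡∑ (λ t → is square (f t)))) (#≡∑ (λ t → is nonsquare (f t))) ⟩
    I null ℕ.+ I square ℕ.+ I nonsquare ≡⟨ cong (ℕ._+ I nonsquare) (∑-+ _ _ elems) ⟨
    ∑ elems (λ t → i null t ℕ.+ i square t) ℕ.+ I nonsquare                     ≡⟨ ∑-+ _ _ elems ⟨
    ∑ elems (λ t → i null t ℕ.+ i square t ℕ.+ i nonsquare t) ≡⟨ ∑-cong elems (λ t _ → one (χ (f t))) ⟩
    ∑ elems (λ _ → 1)                                                           ≡⟨ ∑-1 elems ⟩
    q                                                                           ∎
    where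
    i : Class → Carrier → ℕ
    i c t = ι (is c (f t))
    N I : Class → ℕ
    N c = # (λ t → is c (f t))
    I c = ∑ elems (i c)
    one : ∀ c → ι ⌊ c ≟ᶜ null ⌋ ℕ.+ ι ⌊ c ≟ᶜ square ⌋ ℕ.+ ι ⌊ c ≟ᶜ nonsquare ⌋ ≡ 1
    one null      = refl
    one square    = refl
    one nonsquare = refl

  #null≡1 : # (is null) ≡ 1
  #null≡1 = trans (#-cong (λ t → ==⁺ (χ-null⁻ (is⁻ t))) (λ t → is⁺ (χ-null (==⁻ t)))) #≡0

  1+2#square≡q : 1 ℕ.+ 2 ℕ.* # (is square) ≡ q
  1+2#square≡q = begin
    1 ℕ.+ 2 ℕ.* # (is square)                 ≡⟨ cong (ℕ._+ 2 ℕ.* # (is square)) #null≡1 ⟨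
    # (is null) ℕ.+ 2 ℕ.* # (is square)       ≡⟨ ∑-#sqrt (λ y → y) ⟨
    ∑ elems (λ y → # (λ x → x * x == y)) ≡⟨ ∑-fibres _≟_ elems-unique (λ x → x * x) elems (λ _ → elems-complete _) ⟩
    q                                         ∎

  #nonsquare≡#square : # (is nonsquare) ≡ # (is square)
  #nonsquare≡#square = squares≡nonsquares 1+2#square≡q
    (trans (cong (λ k → k ℕ.+ # (is square) ℕ.+ # (is nonsquare)) (sym #null≡1)) (#-classes (λ y → y)))

  χ-*-square : ∀ {x y} → χ x ≡ square → χ (x * y) ≡ χ y
  χ-*-square {x} {y} ex with χ-square⁻ ex | χ y in ey
  ... | r , r≢0 , rr | null = χ-null (trans (cong (x *_) (χ-null⁻ ey)) (zeroʳ x))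
  ... | r , r≢0 , rr | square with χ-square⁻ ey
  ... | s , s≢0 , ss = χ-square {r = r * s} (*-≢0 r≢0 s≢0)
    (lin 4 (λ r s x y → (r :* s :* (r :* s) ⊜ x :* y) , (s :* s ×[ r :* r ⊜ x ]) ∷ (x ×[ s :* s ⊜ y ]) ∷ []) r s x y
      (rr , ss , _))
  χ-*-square {x} {y} ex | r , r≢0 , rr | nonsquare = χ-nonsquare λ (s , ss) → χ-nonsquare⁻ ey
    (s * r ⁻¹ , (lin 5 (λ r s x y i → (s :* i :* (s :* i) ⊜ y) , (i :* i ×[ s :* s ⊜ x :* y ]) ∷
      (:- i :* i :* y ×[ r :* r ⊜ x ]) ∷ (y :* (r :* i :+ κ 1) ×[ r :* i ⊜ κ 1 ]) ∷ []) r s x y (r ⁻¹)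
      (ss , rr , ⁻¹-inverse r≢0 , _)))

  -- Multiplication by a nonsquare sends the squares into the nonsquares, hence onto them, there being equally many.
  nonsquare-quotient : ∀ {x y} → χ x ≡ nonsquare → χ y ≡ nonsquare → ∃ λ s → χ s ≡ square × x * s ≡ y
  nonsquare-quotient {x} {y} ex ey =
    let (s , _ , t , e) = count-inj-surj {p = is square} elems-unique elems-unique (x *_) (λ _ _ _ _ → cancel x≢0)
                            {r = is nonsquare} _≟_ to (ℕP.≤-reflexive #nonsquare≡#square) (elems-complete y) (is⁺ ey)
    in s , is⁻ t , e
    where
    x≢0 : x ≢ 0#
    x≢0 x≡0 with () ← trans (sym ex) (χ-null x≡0)

    to : ∀ {s} → s ∈ elems → T (is square s) → x * s ∈ elems × T (is nonsquare (x * s))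
    to {s} _ t = elems-complete _ , is⁺ (trans (cong χ (*-comm x s)) (trans (χ-*-square (is⁻ t)) ex))

  -- Writing y = xs with s = r² gives xy = (xr)².
  χ-nonsquare-* : ∀ {x y} → χ x ≡ nonsquare → χ y ≡ nonsquare → χ (x * y) ≡ square
  χ-nonsquare-* {x} ex ey =
    let (s , es , e) = nonsquare-quotient ex ey
        (r , r≢0 , rr) = χ-square⁻ es
    in χ-square {r = x * r} (*-≢0 (λ x≡0 → case trans (sym ex) (χ-null x≡0) of λ ()) r≢0)
         (trans (lin 3 (λ x r s → (x :* r :* (x :* r) ⊜ x :* (x :* s)) , (x :* x ×[ r :* r ⊜ s ]) ∷ []) x r s
           (rr , _)) (cong (x *_) e))

  χ-* : ∀ x y → χ (x * y) ≡ χ x · χ y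
  χ-* x y with χ x in ex
  ... | null = χ-null (trans (cong (_* y) (χ-null⁻ ex)) (zeroˡ y))
  ... | square = χ-*-square ex
  ... | nonsquare with χ y in ey
  ... | null = χ-null (trans (cong (x *_) (χ-null⁻ ey)) (zeroʳ x))
  ... | square = trans (cong χ (*-comm x y)) (trans (χ-*-square ey) ex)
  ... | nonsquare = χ-nonsquare-* ex ey

  is-*⁺ : ∀ {A c} → χ A ≡ c → ∀ d x → T (is d x) → T (is (c · d) (A * x))
  is-*⁺ {A} {c} e d x h = is⁺ (trans (χ-* A x) (cong₂ _·_ e (is⁻ h)))

  is-*⁻ : ∀ {A c} → χ A ≡ c → c ≢ null → ∀ d x → T (is (c · d) (A * x)) → T (is d x)
  is-*⁻ {A} {null} e c≢ d x h = ⊥-elim (c≢ refl)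
  is-*⁻ {A} {square} e c≢ d x h = is⁺ (trans (sym (χ-*-square e)) (is⁻ h))
  is-*⁻ {A} {nonsquare} e c≢ d x h = is⁺ (lemma (χ x) d (trans (sym (trans (χ-* A x) (cong (_· χ x) e))) (is⁻ h)))
    where
    lemma : ∀ y d → nonsquare · y ≡ nonsquare · d → y ≡ d
    lemma null      null      _ = refl
    lemma square    square    _ = refl
    lemma nonsquare nonsquare _ = refl

  -- t² − x² = d becomes u v = d under u = t − x, v = t + x.
  #hyperbola : ∀ {d} → d ≢ 0# → ∑ elems (λ t → # (λ x → x * x == t * t + - d)) ℕ.+ 1 ≡ q
  #hyperbola {d} d≢0 = begin
    ∑ elems (λ t → # (λ x → x * x == t * t + - d)) ℕ.+ 1 ≡⟨ cong (ℕ._+ 1)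
      (count-product (λ (t , x) → x * x == t * t + - d) elems elems) ⟨
    count (λ (t , x) → x * x == t * t + - d) pairs ℕ.+ 1                         ≡⟨ cong (ℕ._+ 1) change ⟩
    count (λ (u , v) → u * v == d) pairs ℕ.+ 1 ≡⟨ cong (ℕ._+ 1) (count-product (λ (u , v) → u * v == d) elems elems) ⟩
    ∑ elems (λ u → # (λ v → u * v == d)) ℕ.+ 1 ≡⟨ cong (ℕ._+ 1) (∑-cong elems (λ u _ → partners u)) ⟩
    ∑ elems (λ u → ι (not (u == 0#))) ℕ.+ 1 ≡⟨ cong₂ ℕ._+_ (sym (#≡∑ (λ u → not (u == 0#)))) (sym #≡0) ⟩
    # (λ u → not (u == 0#)) ℕ.+ # (_== 0#) ≡⟨ ℕP.+-comm (# (λ u → not (u == 0#))) _ ⟩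
    # (_== 0#) ℕ.+ # (λ u → not (u == 0#))                                      ≡⟨ count-not (_== 0#) elems ⟩
    q                                                                           ∎
    where
    pairs = cartesianProduct elems elems

    change : count (λ (t , x) → x * x == t * t + - d) pairs ≡ count (λ (u , v) → u * v == d) pairs
    change = count-bij {p = λ (t , x) → x * x == t * t + - d} pairs-unique pairs-unique (λ (t , x) → t + - x , t + x)
      (λ {(t , x)} {(t′ , x′)} _ _ _ _ e → let e₁ = cong proj₁ e; e₂ = cong proj₂ e in cong₂ _,_
        (cancel 2≢0 (lin 4 (λ t x t′ x′ → (κ 2 :* t ⊜ κ 2 :* t′) , (κ 1 ×[ t :- x ⊜ t′ :- x′ ]) ∷
          (κ 1 ×[ t :+ x ⊜ t′ :+ x′ ]) ∷ []) t x t′ x′ (e₁ , e₂ , _)))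
        (cancel 2≢0 (lin 4 (λ t x t′ x′ → (κ 2 :* x ⊜ κ 2 :* x′) , (:- (κ 1) ×[ t :- x ⊜ t′ :- x′ ]) ∷
          (κ 1 ×[ t :+ x ⊜ t′ :+ x′ ]) ∷ []) t x t′ x′ (e₁ , e₂ , _))))
      {r = λ (u , v) → u * v == d} (λ {(t , x)} _ h → pairs-complete _ , ==⁺
        (lin 3 (λ t x d → ((t :- x) :* (t :+ x) ⊜ d) , (:- (κ 1) ×[ x :* x ⊜ t :* t :- d ]) ∷ []) t x d (==⁻ h , _)))
      (λ {(u , v)} _ h → (½ * (u + v) , ½ * (v + - u)) , pairs-complete _ ,
        ==⁺ (lin 4 (λ u v d h → (h :* (v :- u) :* (h :* (v :- u)) ⊜ h :* (u :+ v) :* (h :* (u :+ v)) :- d) ,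
          (:- (u :* v) :* (κ 2 :* h :+ κ 1) ×[ κ 2 :* h ⊜ κ 1 ]) ∷ (:- (κ 1) ×[ u :* v ⊜ d ]) ∷ []) u v d ½
          (½-inverse , ==⁻ h , _)) ,
        cong₂ _,_ (lin 3 (λ u v h → (h :* (u :+ v) :- h :* (v :- u) ⊜ u) , (u ×[ κ 2 :* h ⊜ κ 1 ]) ∷ []) u v ½
          (½-inverse , _))
                  (lin 3 (λ u v h → (h :* (u :+ v) :+ h :* (v :- u) ⊜ v) , (v ×[ κ 2 :* h ⊜ κ 1 ]) ∷ []) u v ½
                    (½-inverse , _)))

    partners : ∀ u → # (λ v → u * v == d) ≡ ι (not (u == 0#))
    partners u with u ≟ 0#
    ... | yes refl = #-none (λ {v} h → d≢0 (trans (sym (==⁻ h)) (zeroˡ v)))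
    ... | no u≢0 = #-enum (u ⁻¹ * d ∷ []) ([] ∷ [])
      (λ {v} h → here (lin 4 (λ u v d i → (v ⊜ i :* d) , (i ×[ u :* v ⊜ d ]) ∷ (:- v ×[ u :* i ⊜ κ 1 ]) ∷ []) u v d
        (u ⁻¹) (==⁻ h , ⁻¹-inverse u≢0 , _)))
      (λ { (here refl) → ==⁺ (lin 3 (λ u d i → (u :* (i :* d) ⊜ d) , (d ×[ u :* i ⊜ κ 1 ]) ∷ []) u d (u ⁻¹)
        (⁻¹-inverse u≢0 , _)) })

  -- The expression t² - d is the norm of t + √d, whence the name.
  #norm : Carrier → Class → ℕ
  #norm d c = # (λ t → is c (t * t + - d))

  #norm-null : ∀ d → #norm d null ≡ #roots (χ d)
  #norm-null d = trans (#-cong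
      (λ {t} h → ==⁺ (lin 2 (λ t d → (t :* t ⊜ d) , (κ 1 ×[ t :* t :- d ⊜ κ 0 ]) ∷ []) t d (χ-null⁻ (is⁻ h) , _)))
      (λ {t} h → is⁺ (χ-null (lin 2 (λ t d → (t :* t :- d ⊜ κ 0) , (κ 1 ×[ t :* t ⊜ d ]) ∷ []) t d (==⁻ h , _)))))
    (#sqrt d)

  -- The hyperbola x² = t² - d has q - 1 affine points, here sorted by t.
  #norm-square : ∀ {d} → d ≢ 0# → #roots (χ d) ℕ.+ 2 ℕ.* #norm d square ℕ.+ 1 ≡ q
  #norm-square {d} d≢0 = begin
    #roots (χ d) ℕ.+ 2 ℕ.* #norm d square ℕ.+ 1 ≡⟨ cong (λ k → k ℕ.+ 2 ℕ.* #norm d square ℕ.+ 1) (#norm-null d) ⟨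
    #norm d null ℕ.+ 2 ℕ.* #norm d square ℕ.+ 1       ≡⟨ cong (ℕ._+ 1) (∑-#sqrt (λ t → t * t + - d)) ⟨
    ∑ elems (λ t → # (λ x → x * x == t * t + - d)) ℕ.+ 1 ≡⟨ #hyperbola d≢0 ⟩
    q                                                 ∎

  #norm-nonsquare : ∀ {d} → d ≢ 0# → #norm d nonsquare ≡ #norm d square ℕ.+ 1
  #norm-nonsquare {d} d≢0 = conic-nonsquares {z = #roots (χ d)} (#norm-square d≢0)
    (trans (cong (λ k → k ℕ.+ #norm d square ℕ.+ #norm d nonsquare) (sym (#norm-null d)))
      (#-classes (λ t → t * t + - d)))

  -- over the projective line: A is the value of the form at ∞
  #form : Carrier → Carrier → Carrier → Class → ℕ
  #form A B C c = ι (is c A) ℕ.+ # (λ t → is c (A * (t * t) + B * t + C))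

  module _ {A B C : Carrier} where
    private
      Δ = B * B + - (ofℕ 4 * (A * C))

      -- 4A·H(t) = (2At + B)² − Δ
      complete-square : A ≢ 0# → ∀ c c′ → (∀ x → T (is c x) → T (is c′ (A * x))) → (∀ x → T (is c′ (A * x)) → T
        (is c x)) →
                        # (λ t → is c (A * (t * t) + B * t + C)) ≡ #norm Δ c′
      complete-square A≢0 c c′ to from = #-bij (λ t → ofℕ 2 * (A * t) + B) (λ u → ½ * (A ⁻¹ * (u + - B)))
        (λ t → (lin 5 (λ t A B h i → (h :* (i :* (κ 2 :* (A :* t) :+ B :- B)) ⊜ t) ,
          (A :* i :* t ×[ κ 2 :* h ⊜ κ 1 ]) ∷ (t ×[ A :* i ⊜ κ 1 ]) ∷ []) t A B ½ (A ⁻¹)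
          (½-inverse , ⁻¹-inverse A≢0 , _)))
        (λ u → (lin 5 (λ u A B h i → (κ 2 :* (A :* (h :* (i :* (u :- B)))) :+ B ⊜ u) ,
          (A :* i :* (u :- B) ×[ κ 2 :* h ⊜ κ 1 ]) ∷ (u :- B ×[ A :* i ⊜ κ 1 ]) ∷ []) u A B ½ (A ⁻¹)
          (½-inverse , ⁻¹-inverse A≢0 , _)))
        (λ {t} h → is⁺ (trans (eq t) (is⁻ (to _ h))))
        (λ {t} h → from _ (is⁺ (trans (sym (eq t)) (is⁻ h))))
        where
        eq : ∀ t → χ ((ofℕ 2 * (A * t) + B) * (ofℕ 2 * (A * t) + B) + - Δ) ≡ χ (A * (A * (t * t) + B * t + C))
        eq t = trans (cong χ (ring 4 (λ t A B C → (κ 2 :* (A :* t) :+ B) :* (κ 2 :* (A :* t) :+ B) :-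
          (B :* B :- κ 4 :* (A :* C)) ⊜ κ 2 :* κ 2 :* (A :* (A :* (t :* t) :+ B :* t :+ C))) t A B C))
                     (χ-*-square (χ-square 2≢0 refl))

      A≢0⇐ : ∀ {c} → χ A ≡ c → c ≢ null → A ≢ 0#
      A≢0⇐ e h A≡0 = h (trans (sym e) (χ-null A≡0))

      #form≡ : ∀ {c} → χ A ≡ c → c ≢ null → ∀ d → #form A B C d ≡ ι (is d A) ℕ.+ #norm Δ (c · d)
      #form≡ {c} e c≢ d = cong (ι (is d A) ℕ.+_) (complete-square (A≢0⇐ e c≢) d (c · d) (is-*⁺ e d) (is-*⁻ e c≢ d))

      B≢0 : A ≡ 0# → Δ ≢ 0# → B ≢ 0#
      B≢0 A≡0 Δ≢0 B≡0 = Δ≢0 (lin 3 (λ A B C → (B :* B :- κ 4 :* (A :* C) ⊜ κ 0) , (:- (κ 4 :* C) ×[ A ⊜ κ 0 ]) ∷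
        (B ×[ B ⊜ κ 0 ]) ∷ []) A B C (A≡0 , B≡0 , _))

      χΔ : A ≡ 0# → Δ ≢ 0# → χ Δ ≡ square
      χΔ A≡0 Δ≢0 = χ-square (B≢0 A≡0 Δ≢0) (lin 3 (λ A B C → (B :* B ⊜ B :* B :- κ 4 :* (A :* C)) ,
        (κ 4 :* C ×[ A ⊜ κ 0 ]) ∷ []) A B C (A≡0 , _))

      -- With `A` zero the form vanishes at ∞, and elsewhere it is the bijection t ↦ Bt + C, since Δ
      -- = B² ≠ 0.
      #linear : A ≡ 0# → Δ ≢ 0# → ∀ c → c ≢ null → #form A B C c ≡ # (is c)
      #linear A≡0 Δ≢0 c c≢ = trans (cong (ℕ._+ # (λ t → is c (A * (t * t) + B * t + C))) ι≡0)
        (#-bij (λ t → A * (t * t) + B * t + C) (λ y → B ⁻¹ * (y + - C))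
          (λ t → (lin 5 (λ t A B C i → (i :* (A :* (t :* t) :+ B :* t :+ C :- C) ⊜ t) ,
            (i :* (t :* t) ×[ A ⊜ κ 0 ]) ∷ (t ×[ B :* i ⊜ κ 1 ]) ∷ []) t A B C (B ⁻¹)
            (A≡0 , ⁻¹-inverse (B≢0 A≡0 Δ≢0) , _)))
          (λ y → (lin 5 (λ y A B C i → (A :* (i :* (y :- C) :* (i :* (y :- C))) :+ B :* (i :* (y :- C)) :+ C ⊜ y) ,
            (i :* (y :- C) :* (i :* (y :- C)) ×[ A ⊜ κ 0 ]) ∷ (y :- C ×[ B :* i ⊜ κ 1 ]) ∷ []) y A B C (B ⁻¹)
            (A≡0 , ⁻¹-inverse (B≢0 A≡0 Δ≢0) , _)))
          (λ h → h) (λ h → h))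
        where
        ι≡0 : ι (is c A) ≡ 0
        ι≡0 = trans (cong (λ c′ → ι ⌊ c′ ≟ᶜ c ⌋) (χ-null A≡0)) (null≢ c c≢)
          where
          null≢ : ∀ c → c ≢ null → ι ⌊ null ≟ᶜ c ⌋ ≡ 0
          null≢ null      h = ⊥-elim (h refl)
          null≢ square    _ = refl
          null≢ nonsquare _ = refl

      #form-χ : ∀ {c} → χ A ≡ c → c ≢ null → ∀ d → #form A B C d ≡ ι ⌊ c ≟ᶜ d ⌋ ℕ.+ #norm Δ (c · d)
      #form-χ {c} e c≢ d = trans (#form≡ e c≢ d) (cong (λ c → ι ⌊ c ≟ᶜ d ⌋ ℕ.+ #norm Δ (_ · d)) e)

    -- For t² - Δ the nonsquare values outnumber the nonzero squares by one. Passing to the form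
    -- multiplies by the class of `A`, and the point at ∞, whose value is `A`, makes up the
    -- difference.
    #form-nonsquare : Δ ≢ 0# → #form A B C nonsquare ≡ #form A B C square
    #form-nonsquare Δ≢0 = by-class (χ A) refl
      where
      by-class : ∀ c → χ A ≡ c → #form A B C nonsquare ≡ #form A B C square
      by-class null e = trans (#linear (χ-null⁻ e) Δ≢0 nonsquare λ ())
        (trans #nonsquare≡#square (sym (#linear (χ-null⁻ e) Δ≢0 square λ ())))
      by-class square e = trans (#form-χ e (λ ()) nonsquare)
        (trans (#norm-nonsquare Δ≢0) (trans (ℕP.+-comm _ 1) (sym (#form-χ e (λ ()) square))))
      by-class nonsquare e = trans (#form-χ e (λ ()) nonsquare)
        (trans (ℕP.+-comm 1 _) (trans (sym (#norm-nonsquare Δ≢0)) (sym (#form-χ e (λ ()) square))))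

    -- Among the q + 1 points there are `#roots (χ Δ)` zeros, and the remaining points are shared
    -- equally by squares and nonsquares.
    #form-square : Δ ≢ 0# → 2 ℕ.* #form A B C square ℕ.+ #roots (χ Δ) ≡ q ℕ.+ 1
    #form-square Δ≢0 = by-class (χ A) refl
      where
      by-class : ∀ c → χ A ≡ c → 2 ℕ.* #form A B C square ℕ.+ #roots (χ Δ) ≡ q ℕ.+ 1
      by-class null e = trans
        (cong₂ (λ k l → 2 ℕ.* k ℕ.+ l) (#linear (χ-null⁻ e) Δ≢0 square λ ()) (cong #roots (χΔ (χ-null⁻ e) Δ≢0)))
        (line-squares {# (is square)} 1+2#square≡q)
      by-class square e = trans (cong (λ k → 2 ℕ.* k ℕ.+ #roots (χ Δ)) (trans (#form-χ e (λ ()) square)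
        (ℕP.+-comm 1 _)))
        (conic-squares {#roots (χ Δ)} {#norm Δ square} (#norm-square Δ≢0))
      by-class nonsquare e = trans
        (cong (λ k → 2 ℕ.* k ℕ.+ #roots (χ Δ)) (trans (#form-χ e (λ ()) square) (#norm-nonsquare Δ≢0)))
        (conic-squares {#roots (χ Δ)} {#norm Δ square} (#norm-square Δ≢0))

-- Excluding characteristics 2 and 3

module Characteristic (F : FiniteField) where
  open FieldBasics F

  -- Every fibre is empty or has `d` elements, and the fibres partition the field.
  fibres-∣ : ∀ d (g : Carrier → Carrier) → (∀ t → # (λ x → g x == g t) ≡ d) → d ℕD.∣ q
  fibres-∣ d g h = subst (d ℕD.∣_) (∑-fibres _≟_ elems-unique g elems (λ _ → elems-complete _))
                     (∑-∣ elems (λ y → fibre y (# (λ x → g x == y)) refl))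
    where
    ∑-∣ : ∀ ys {f : Carrier → ℕ} → (∀ y → d ℕD.∣ f y) → d ℕD.∣ ∑ ys f
    ∑-∣ []       h = d ℕD.∣0
    ∑-∣ (y ∷ ys) h = ℕD.∣m∣n⇒∣m+n (h y) (∑-∣ ys h)

    fibre : ∀ y k → # (λ x → g x == y) ≡ k → d ℕD.∣ # (λ x → g x == y)
    fibre y zero    e = subst (d ℕD.∣_) (sym e) (d ℕD.∣0)
    fibre y (suc k) e with count-suc⇒∃ {p = λ x → g x == y} elems (subst (1 ≤_) (sym e) (s≤s z≤n))
    ... | t , _ , gt with refl ← ==⁻ gt = subst (d ℕD.∣_) (sym (h t)) ℕD.∣-refl

  -- In characteristic 2 (resp. 3) the additive map t² + t (resp. t³ − t) has kernel the prime field.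
  2≡0⇒2∣q : ofℕ 2 ≡ 0# → 2 ℕD.∣ q
  2≡0⇒2∣q 2≡0 = fibres-∣ 2 (λ t → t * t + t) λ t → #-enum (t ∷ t + 1# ∷ [])
    (((λ e → 1≢0 (lin 1 (λ t → (κ 1 ⊜ κ 0) , (:- (κ 1) ×[ t ⊜ t :+ κ 1 ]) ∷ []) t (e , _))) ∷ []) ∷ [] ∷ [])
    (λ {x} h → [ (λ e → here (lin 2 (λ x t → (x ⊜ t) , (κ 1 ×[ x :- t ⊜ κ 0 ]) ∷ []) x t (e , _)))
               , (λ e → there (here (lin 2 (λ x t → (x ⊜ t :+ κ 1) , (κ 1 ×[ x :+ t :+ κ 1 ⊜ κ 0 ]) ∷
                 (:- (t :+ κ 1) ×[ κ 2 ⊜ κ 0 ]) ∷ []) x t (e , 2≡0 , _)))) ]′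
               (zero-product {x + - t} {x + t + 1#} (lin 2 (λ x t → ((x :- t) :* (x :+ t :+ κ 1) ⊜ κ 0) ,
                 (κ 1 ×[ x :* x :+ x ⊜ t :* t :+ t ]) ∷ []) x t (==⁻ h , _))))
    (λ { (here refl) → ==⁺ refl
       ; (there (here refl)) → ==⁺ (lin 1 (λ t → ((t :+ κ 1) :* (t :+ κ 1) :+ (t :+ κ 1) ⊜ t :* t :+ t) ,
         (t :+ κ 1 ×[ κ 2 ⊜ κ 0 ]) ∷ []) t (2≡0 , _)) })

  3≡0⇒3∣q : ofℕ 3 ≡ 0# → 3 ℕD.∣ q
  3≡0⇒3∣q 3≡0 = fibres-∣ 3 (λ t → t * t * t + - t) λ t → #-enum (t ∷ t + 1# ∷ t + - 1# ∷ [])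
    ( ((λ e → 1≢0 (lin 1 (λ t → (κ 1 ⊜ κ 0) , (:- (κ 1) ×[ t ⊜ t :+ κ 1 ]) ∷ []) t (e , _))) ∷
      (λ e → 1≢0 (lin 1 (λ t → (κ 1 ⊜ κ 0) , (κ 1 ×[ t ⊜ t :- κ 1 ]) ∷ []) t (e , _))) ∷ [])
    ∷ ((λ e → 1≢0 (lin 1 (λ t → (κ 1 ⊜ κ 0) , (:- (κ 1) ×[ t :+ κ 1 ⊜ t :- κ 1 ]) ∷ (κ 1 ×[ κ 3 ⊜ κ 0 ]) ∷ []) t
      (e , 3≡0 , _))) ∷ []) ∷ [] ∷ [])
    (λ {x} h → [ (λ e → here (lin 2 (λ x t → (x ⊜ t) , (κ 1 ×[ x :- t ⊜ κ 0 ]) ∷ []) x t (e , _)))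
               , (λ e → there ([ (λ e → here (lin 2 (λ x t → (x ⊜ t :+ κ 1) ,
                 (κ 1 ×[ x :- t :- κ 1 ⊜ κ 0 ]) ∷ []) x t (e , _)))
                               , (λ e → there (here (lin 2 (λ x t → (x ⊜ t :- κ 1) ,
                                 (κ 1 ×[ x :- t :+ κ 1 ⊜ κ 0 ]) ∷ []) x t (e , _)))) ]′ (zero-product e))) ]′
               (zero-product {x + - t} {(x + - t + - 1#) * (x + - t + 1#)}
                 (lin 2 (λ x t → ((x :- t) :* ((x :- t :- κ 1) :* (x :- t :+ κ 1)) ⊜ κ 0) ,
                   (κ 1 ×[ x :* x :* x :- x ⊜ t :* t :* t :- t ]) ∷
                   (:- (x :* t :* (x :- t)) ×[ κ 3 ⊜ κ 0 ]) ∷ []) x t (==⁻ h , 3≡0 , _))))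
    (λ { (here refl) → ==⁺ refl
       ; (there (here refl)) → ==⁺ (lin 1 (λ t → ((t :+ κ 1) :* (t :+ κ 1) :* (t :+ κ 1) :-
         (t :+ κ 1) ⊜ t :* t :* t :- t) , (t :* t :+ t ×[ κ 3 ⊜ κ 0 ]) ∷ []) t (3≡0 , _))
       ; (there (there (here refl))) → ==⁺
         (lin 1 (λ t → ((t :- κ 1) :* (t :- κ 1) :* (t :- κ 1) :- (t :- κ 1) ⊜ t :* t :* t :- t) ,
         (t :- t :* t ×[ κ 3 ⊜ κ 0 ]) ∷ []) t (3≡0 , _)) })

-- the possible numbers n of rational roots of a binary cubic without triple root whose discriminant has class c
data RootCount : Class → ℕ → Set where
  double : RootCount null 2
  zero   : RootCount square 0
  three  : RootCount square 3
  one    : RootCount nonsquare 1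

-- Roots of depressed cubics t³ + bt + c

module Depressed (F : FiniteField) (2≢0 : PG.ofℕ F 2 ≢ FiniteField.0# F) (3≢0 : PG.ofℕ F 3 ≢ FiniteField.0# F) where
  open Character F 2≢0 public
  open ≡-Reasoning

  ⅓ : Carrier
  ⅓ = ofℕ 3 ⁻¹

  ⅓-inverse : ofℕ 3 * ⅓ ≡ 1#
  ⅓-inverse = ⁻¹-inverse 3≢0

  disc : Carrier → Carrier → Carrier
  disc b c = - (ofℕ 4 * (b * b * b)) + - (ofℕ 27 * (c * c))

  ν : Carrier → Carrier → ℕ
  ν b c = # (λ t → t * t * t + b * t + c == 0#)

  -- the discriminant of the quotient of x³ + bx + c by x − t, for a root t
  quotient-disc : Carrier → Carrier → Carrier
  quotient-disc b t = - (ofℕ 3 * (t * t)) + - (ofℕ 4 * b)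

  private
    cubic : Carrier → Carrier → Carrier → Carrier
    cubic b c t = t * t * t + b * t + c

  -- If f = (x - t)g, then disc f = g(t)² disc g, and g(t) = f′(t) = 3t² + b.
  disc-root : ∀ b c t → cubic b c t ≡ 0# →
              disc b c ≡ ((ofℕ 3 * (t * t) + b) * (ofℕ 3 * (t * t) + b)) * quotient-disc b t
  disc-root b c t h = lin 3 (λ b c t → (:- (κ 4 :* (b :* b :* b)) :- κ 27 :* (c :* c) ⊜ (κ 3 :* (t :* t) :+ b) :*
    (κ 3 :* (t :* t) :+ b) :* (:- (κ 3 :* (t :* t)) :- κ 4 :* b)) ,
    (κ 27 :* (t :* t :* t :+ b :* t :- c) ×[ t :* t :* t :+ b :* t :+ c ⊜ κ 0 ]) ∷ []) b c t (h , _)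

  χ-disc-root : ∀ {b c t} → cubic b c t ≡ 0# → ofℕ 3 * (t * t) + b ≢ 0# → χ (disc b c) ≡ χ (quotient-disc b t)
  χ-disc-root {b} {c} {t} h 3t²+b≢0 = trans (cong χ (disc-root b c t h)) (χ-*-square (χ-square 3t²+b≢0 refl))

  -- A second root is a root of the quotient x² + tx + t² + b, and the equation completes its
  -- square.
  other-root : ∀ {b c t x} → cubic b c t ≡ 0# → cubic b c x ≡ 0# → x ≢ t →
               (ofℕ 2 * x + t) * (ofℕ 2 * x + t) ≡ quotient-disc b t
  other-root {b} {c} {t} {x} ht hx x≢t = cancel
    (λ e → x≢t (lin 2 (λ x t → (x ⊜ t) , (κ 1 ×[ x :- t ⊜ κ 0 ]) ∷ []) x t (e , _)))
    (lin 4 (λ b c t x → ((x :- t) :* ((κ 2 :* x :+ t) :* (κ 2 :* x :+ t)) ⊜ (x :- t) :*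
      (:- (κ 3 :* (t :* t)) :- κ 4 :* b)) , (κ 4 ×[ x :* x :* x :+ b :* x :+ c ⊜ κ 0 ]) ∷
      (:- (κ 4) ×[ t :* t :* t :+ b :* t :+ c ⊜ κ 0 ]) ∷ []) b c t x (hx , ht , _))

  -- t ↦ −(t³ + bt) maps the t with nonsquare quotient discriminant injectively, hence bijectively,
  -- to the c with nonsquare discriminant.
  nonsquare-disc⇒root : ∀ b c → χ (disc b c) ≡ nonsquare → ∃ λ t → cubic b c t ≡ 0# × χ (quotient-disc b t)
    ≡ nonsquare
  nonsquare-disc⇒root b c ec =
    let (t , _ , h , e) = count-inj-surj {p = p} elems-unique elems-unique g inj {r = r} _≟_ to (ℕP.≤-reflexive (sym equal))
                            (elems-complete c) (is⁺ ec)
    in t , (lin 3 (λ b c t → (t :* t :* t :+ b :* t :+ c ⊜ κ 0) ,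
      (:- (κ 1) ×[ :- (t :* t :* t :+ b :* t) ⊜ c ]) ∷ []) b c t (e , _)) , is⁻ h
    where
    p r : Carrier → Bool
    p t = is nonsquare (quotient-disc b t)
    r c = is nonsquare (disc b c)

    g : Carrier → Carrier
    g t = - (t * t * t + b * t)

    g-root : ∀ t → cubic b (g t) t ≡ 0#
    g-root t = ring 2 (λ b t → t :* t :* t :+ b :* t :+ :- (t :* t :* t :+ b :* t) ⊜ κ 0) b t

    inj : ∀ {t t′} → t ∈ elems → T (p t) → t′ ∈ elems → T (p t′) → g t ≡ g t′ → t ≡ t′
    inj {t} {t′} _ pt _ _ e with t ≟ t′
    ... | yes t≡t′ = t≡t′
    ... | no t≢t′  = ⊥-elim (χ-nonsquare⁻ (is⁻ pt) (_ , other-root {b} {g t} (g-root t)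
                       (trans (cong (t′ * t′ * t′ + b * t′ +_) e) (g-root t′)) (t≢t′ ∘ sym)))

    to : ∀ {t} → t ∈ elems → T (p t) → g t ∈ elems × T (r (g t))
    to {t} _ pt = elems-complete _ , is⁺ (trans (χ-disc-root {b} {g t} (g-root t) 3t²+b≢0) (is⁻ pt))
      where
      3t²+b≢0 : ofℕ 3 * (t * t) + b ≢ 0#
      3t²+b≢0 e = χ-nonsquare⁻ (is⁻ pt) (ofℕ 3 * t ,
        (lin 2 (λ b t → (κ 3 :* t :* (κ 3 :* t) ⊜ :- (κ 3 :* (t :* t)) :- κ 4 :* b) ,
          (κ 4 ×[ κ 3 :* (t :* t) :+ b ⊜ κ 0 ]) ∷ []) b t (e , _)))

    -- The two quantities differ by a linear substitution and a square factor: disc at c = bt/3 is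
    -- b² times the quotient discriminant at t, and for b = 0 the factor is 9 with c = t.
    equal : # p ≡ # r
    equal with b ≟ 0#
    ... | yes b≡0 = #-cong
      (λ {t} h → is⁺ (trans (cong χ (eq t)) (trans (χ-*-square (χ-square 3≢0 refl)) (is⁻ h))))
      (λ {t} h → is⁺ (trans (sym (trans (cong χ (eq t)) (χ-*-square (χ-square 3≢0 refl)))) (is⁻ h)))
      where
      eq : ∀ t → disc b t ≡ ofℕ 3 * ofℕ 3 * quotient-disc b t
      eq t = lin 2 (λ b t → (:- (κ 4 :* (b :* b :* b)) :- κ 27 :* (t :* t) ⊜ κ 3 :* κ 3 :*
        (:- (κ 3 :* (t :* t)) :- κ 4 :* b)) , (κ 36 :- κ 4 :* b :* b ×[ b ⊜ κ 0 ]) ∷ []) b t (b≡0 , _)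
    ... | no b≢0 = #-bij (λ t → b * (⅓ * t)) (λ c → ofℕ 3 * (b ⁻¹ * c))
      (λ t → (lin 4 (λ b t k i → (κ 3 :* (i :* (b :* (k :* t))) ⊜ t) , (i :* b :* t ×[ κ 3 :* k ⊜ κ 1 ]) ∷
        (t ×[ b :* i ⊜ κ 1 ]) ∷ []) b t ⅓ (b ⁻¹) (⅓-inverse , ⁻¹-inverse b≢0 , _)))
      (λ t → (lin 4 (λ b t k i → (b :* (k :* (κ 3 :* (i :* t))) ⊜ t) , (i :* b :* t ×[ κ 3 :* k ⊜ κ 1 ]) ∷
        (t ×[ b :* i ⊜ κ 1 ]) ∷ []) b t ⅓ (b ⁻¹) (⅓-inverse , ⁻¹-inverse b≢0 , _)))
      (λ {t} h → is⁺ (trans (cong χ (eq t)) (trans (χ-*-square (χ-square b≢0 refl)) (is⁻ h))))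
      (λ {t} h → is⁺ (trans (sym (trans (cong χ (eq t)) (χ-*-square (χ-square b≢0 refl)))) (is⁻ h)))
      where
      eq : ∀ t → disc b (b * (⅓ * t)) ≡ b * b * quotient-disc b t
      eq t = lin 3 (λ b t k → (:- (κ 4 :* (b :* b :* b)) :- κ 27 :* (b :* (k :* t) :* (b :* (k :* t))) ⊜ b :* b :*
        (:- (κ 3 :* (t :* t)) :- κ 4 :* b)) , (:- (κ 3 :* b :* b :* t :* t) :*
        (κ 3 :* k :+ κ 1) ×[ κ 3 :* k ⊜ κ 1 ]) ∷ []) b t ⅓ (⅓-inverse , _)

  rootCount-nonsquare : ∀ b c → χ (disc b c) ≡ nonsquare → ν b c ≡ 1
  rootCount-nonsquare b c ec = let (t , ht , et) = nonsquare-disc⇒root b c ec in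
    #-enum (t ∷ []) ([] ∷ [])
      (λ {x} hx → case x ≟ t of λ { (yes x≡t) → here x≡t ; (no x≢t) → ⊥-elim
        (χ-nonsquare⁻ et (_ , other-root {b} {c} ht (==⁻ hx) x≢t)) })
      (λ { (here refl) → ==⁺ ht })

  module _ {b c t s : Carrier} (s≢0 : s ≢ 0#) (s²≡ : s * s ≡ quotient-disc b t) (3t²+b≢0 : ofℕ 3 * (t * t) + b ≢ 0#)
    (ht : cubic b c t ≡ 0#) where
    private
      quadratic-root : Carrier → Carrier
      quadratic-root r = ½ * (r + - t)

      2x+t≡r : ∀ r → ofℕ 2 * quadratic-root r + t ≡ r
      2x+t≡r r = lin 3 (λ t r h → (κ 2 :* (h :* (r :- t)) :+ t ⊜ r) , (r :- t ×[ κ 2 :* h ⊜ κ 1 ]) ∷ []) t r ½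
        (½-inverse , _)

      distinct : ∀ {x r} → ofℕ 2 * x + t ≡ r → r * r ≡ quotient-disc b t → t ≢ x
      distinct {x} {r} e rr t≡x = 3t²+b≢0 (cancel-0 (*-≢0 2≢0 2≢0)
        (lin 4 (λ x t r b → (κ 2 :* κ 2 :* (κ 3 :* (t :* t) :+ b) ⊜ κ 0) ,
          (κ 1 ×[ r :* r ⊜ :- (κ 3 :* (t :* t)) :- κ 4 :* b ]) ∷ (κ 3 :* t :+ r ×[ κ 2 :* x :+ t ⊜ r ]) ∷
          (κ 2 :* (κ 3 :* t :+ r) ×[ t ⊜ x ]) ∷ []) x t r b (rr , e , t≡x , _)))

      root : ∀ {x r} → ofℕ 2 * x + t ≡ r → r * r ≡ quotient-disc b t → cubic b c x ≡ 0#
      root {x} {r} e rr = cancel-0 (*-≢0 2≢0 2≢0)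
        (lin 5 (λ x t r b c → (κ 2 :* κ 2 :* (x :* x :* x :+ b :* x :+ c) ⊜ κ 0) ,
        (κ 4 ×[ t :* t :* t :+ b :* t :+ c ⊜ κ 0 ]) ∷ (x :- t ×[ r :* r ⊜ :- (κ 3 :* (t :* t)) :- κ 4 :* b ]) ∷
        ((x :- t) :* (κ 2 :* x :+ t :+ r) ×[ κ 2 :* x :+ t ⊜ r ]) ∷ []) x t r b c (ht , rr , e , _))

      -s²≡ : - s * - s ≡ quotient-disc b t
      -s²≡ = lin 3 (λ t s b → (:- s :* :- s ⊜ :- (κ 3 :* (t :* t)) :- κ 4 :* b) ,
        (κ 1 ×[ s :* s ⊜ :- (κ 3 :* (t :* t)) :- κ 4 :* b ]) ∷ []) t s b (s²≡ , _)

      solve-quadratic : ∀ x → (ofℕ 2 * x + t) * (ofℕ 2 * x + t) ≡ quotient-disc b t →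
                        x ∈ quadratic-root s ∷ quadratic-root (- s) ∷ []
      solve-quadratic x e = [ (λ h → here
        (lin 4 (λ x t s h → (x ⊜ h :* (s :- t)) , (h ×[ κ 2 :* x :+ t :- s ⊜ κ 0 ]) ∷
        (:- x ×[ κ 2 :* h ⊜ κ 1 ]) ∷ []) x t s ½ (h , ½-inverse , _)))
                            , (λ h → there (here (lin 4 (λ x t s h → (x ⊜ h :* (:- s :- t)) ,
                              (h ×[ κ 2 :* x :+ t :+ s ⊜ κ 0 ]) ∷ (:- x ×[ κ 2 :* h ⊜ κ 1 ]) ∷ []) x t s ½
                              (h , ½-inverse , _)))) ]′
        (zero-product {ofℕ 2 * x + t + - s} {ofℕ 2 * x + t + s}
          (lin 4 (λ x t s d → ((κ 2 :* x :+ t :- s) :* (κ 2 :* x :+ t :+ s) ⊜ κ 0) , (κ 1 ×[ (κ 2 :* x :+ t) :*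
            (κ 2 :* x :+ t) ⊜ d ]) ∷ (:- (κ 1) ×[ s :* s ⊜ d ]) ∷ []) x t s (quotient-disc b t) (e , s²≡ , _)))

    three-roots : ν b c ≡ 3
    three-roots = #-enum (t ∷ quadratic-root s ∷ quadratic-root (- s) ∷ [])
      ( (distinct (2x+t≡r s) s²≡ ∷ distinct (2x+t≡r (- s)) -s²≡ ∷ [])
      ∷ ((λ e → s≢0 (lin 3 (λ t s h → (s ⊜ κ 0) , (κ 1 ×[ h :* (s :- t) ⊜ h :* (:- s :- t) ]) ∷
        (:- s ×[ κ 2 :* h ⊜ κ 1 ]) ∷ []) t s ½ (e , ½-inverse , _))) ∷ [])
      ∷ [] ∷ [])
      (λ {x} hx → case x ≟ t of λ { (yes x≡t) → here x≡t ; (no x≢t) → there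
        (solve-quadratic x (other-root {b} {c} ht (==⁻ hx) x≢t)) })
      (λ { (here refl) → ==⁺ ht
         ; (there (here refl)) → ==⁺ (root (2x+t≡r s) s²≡)
         ; (there (there (here refl))) → ==⁺ (root (2x+t≡r (- s)) -s²≡) })

  rootCount-square : ∀ b c t → χ (disc b c) ≡ square → cubic b c t ≡ 0# → ν b c ≡ 3
  rootCount-square b c t ec ht =
    let (s , s≢0 , s²≡) = χ-square⁻ (trans (sym (χ-disc-root ht 3t²+b≢0)) ec)
    in three-roots s≢0 s²≡ 3t²+b≢0 ht
    where
    3t²+b≢0 : ofℕ 3 * (t * t) + b ≢ 0#
    3t²+b≢0 e = case trans (sym ec) (χ-null disc≡0) of λ ()
      where
      disc≡0 : disc b c ≡ 0#
      disc≡0 = trans (disc-root b c t ht)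
        (lin 3 (λ b t d → ((κ 3 :* (t :* t) :+ b) :* (κ 3 :* (t :* t) :+ b) :* d ⊜ κ 0) ,
          ((κ 3 :* (t :* t) :+ b) :* d ×[ κ 3 :* (t :* t) :+ b ⊜ κ 0 ]) ∷ []) b t (quotient-disc b t) (e , _))

  -- Here t³ + bt + c = (t + u)²(t - 2u), and the two roots differ because 3u ≠ 0.
  two-roots : ∀ {b c u} → u ≢ 0# → b ≡ - (ofℕ 3 * (u * u)) → c ≡ - (ofℕ 2 * (u * u * u)) → ν b c ≡ 2
  two-roots {b} {c} {u} u≢0 b≡ c≡ = #-enum (- u ∷ ofℕ 2 * u ∷ [])
    (((λ e → *-≢0 3≢0 u≢0 (lin 1 (λ u → (κ 3 :* u ⊜ κ 0) , (:- (κ 1) ×[ :- u ⊜ κ 2 :* u ]) ∷ []) u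
      (e , _))) ∷ []) ∷ [] ∷ [])
    (λ {x} h → [ (λ e → here (lin 2 (λ x u → (x ⊜ :- u) , (κ 1 ×[ x :+ u ⊜ κ 0 ]) ∷ []) x u (square-0 e , _)))
               , (λ e → there (here (lin 2 (λ x u → (x ⊜ κ 2 :* u) , (κ 1 ×[ x :- κ 2 :* u ⊜ κ 0 ]) ∷ []) x u
                 (e , _)))) ]′
      (zero-product {(x + u) * (x + u)} {x + - (ofℕ 2 * u)}
        (lin 4 (λ x u b c → ((x :+ u) :* (x :+ u) :* (x :- κ 2 :* u) ⊜ κ 0) ,
          (κ 1 ×[ x :* x :* x :+ b :* x :+ c ⊜ κ 0 ]) ∷ (:- x ×[ b ⊜ :- (κ 3 :* (u :* u)) ]) ∷
          (:- (κ 1) ×[ c ⊜ :- (κ 2 :* (u :* u :* u)) ]) ∷ []) x u b c (==⁻ h , b≡ , c≡ , _))))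
    (λ { (here refl) → ==⁺ (lin 3 (λ u b c → (:- u :* :- u :* :- u :+ b :* :- u :+ c ⊜ κ 0) ,
      (:- u ×[ b ⊜ :- (κ 3 :* (u :* u)) ]) ∷ (κ 1 ×[ c ⊜ :- (κ 2 :* (u :* u :* u)) ]) ∷ []) u b c (b≡ , c≡ , _))
       ; (there (here refl)) → ==⁺ (lin 3 (λ u b c → (κ 2 :* u :* (κ 2 :* u) :* (κ 2 :* u) :+ b :*
         (κ 2 :* u) :+ c ⊜ κ 0) , (κ 2 :* u ×[ b ⊜ :- (κ 3 :* (u :* u)) ]) ∷
         (κ 1 ×[ c ⊜ :- (κ 2 :* (u :* u :* u)) ]) ∷ []) u b c (b≡ , c≡ , _)) })

  double-root : ∀ {b c} → b ≢ 0# → disc b c ≡ 0# → ∃ λ u → u ≢ 0# × b ≡ - (ofℕ 3 * (u * u)) × c ≡ -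
    (ofℕ 2 * (u * u * u))
  double-root {b} {c} b≢0 ec = u , u≢0 , b≡ , c≡
    where
    u : Carrier
    -- A double root of f is also a zero of 3f - tf′ = 2bt + 3c; this zero is -u.
    u = ofℕ 3 * c * (½ * b ⁻¹)

    2bu≡3c : ofℕ 2 * (b * u) ≡ ofℕ 3 * c
    2bu≡3c = lin 4 (λ b c h i → (κ 2 :* (b :* (κ 3 :* c :* (h :* i))) ⊜ κ 3 :* c) ,
      (κ 3 :* b :* c :* i ×[ κ 2 :* h ⊜ κ 1 ]) ∷ (κ 3 :* c ×[ b :* i ⊜ κ 1 ]) ∷ []) b c ½ (b ⁻¹)
      (½-inverse , ⁻¹-inverse b≢0 , _)

    b≡ : b ≡ - (ofℕ 3 * (u * u))
    b≡ = cancel (*-≢0 (*-≢0 2≢0 2≢0) (*-≢0 b≢0 b≢0))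
      (lin 3 (λ b c u → (κ 2 :* κ 2 :* (b :* b) :* b ⊜ κ 2 :* κ 2 :* (b :* b) :* :- (κ 3 :* (u :* u))) ,
        (:- (κ 1) ×[ :- (κ 4 :* (b :* b :* b)) :- κ 27 :* (c :* c) ⊜ κ 0 ]) ∷
        (κ 3 :* (κ 2 :* (b :* u) :+ κ 3 :* c) ×[ κ 2 :* (b :* u) ⊜ κ 3 :* c ]) ∷ []) b c u (ec , 2bu≡3c , _))

    c≡ : c ≡ - (ofℕ 2 * (u * u * u))
    c≡ = cancel 3≢0 (lin 3 (λ b c u → (κ 3 :* c ⊜ κ 3 :* :- (κ 2 :* (u :* u :* u))) ,
      (:- (κ 1) ×[ κ 2 :* (b :* u) ⊜ κ 3 :* c ]) ∷ (κ 2 :* u ×[ b ⊜ :- (κ 3 :* (u :* u)) ]) ∷ []) b c u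
      (2bu≡3c , b≡ , _))

    u≢0 : u ≢ 0#
    u≢0 e = b≢0 (trans b≡ (lin 1 (λ u → (:- (κ 3 :* (u :* u)) ⊜ κ 0) , (:- (κ 3 :* u) ×[ u ⊜ κ 0 ]) ∷ []) u (e , _)))

  rootCount-null : ∀ b c → b ≢ 0# → disc b c ≡ 0# → ν b c ≡ 2
  rootCount-null b c b≢0 ec = let (u , u≢0 , b≡ , c≡) = double-root b≢0 ec in two-roots u≢0 b≡ c≡

  disc-null⇒b≢0 : ∀ {b c} → ¬ (b ≡ 0# × c ≡ 0#) → disc b c ≡ 0# → b ≢ 0#
  disc-null⇒b≢0 {b} {c} h e b≡0 = h (b≡0 , square-0 (cancel-0 (*-≢0 3≢0 (*-≢0 3≢0 3≢0))
    (lin 2 (λ b c → (κ 3 :* (κ 3 :* κ 3) :* (c :* c) ⊜ κ 0) , (:- (κ 1) ×[ :- (κ 4 :* (b :* b :* b)) :- κ 27 :*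
      (c :* c) ⊜ κ 0 ]) ∷ (:- (κ 4 :* b :* b) ×[ b ⊜ κ 0 ]) ∷ []) b c (e , b≡0 , _))))

  -- For a square discriminant one root suffices for three: the quotient then has nonzero square
  -- discriminant, and f′ does not vanish at the root. So the only alternative to three roots is
  -- none.
  rootCount : ∀ b c → ¬ (b ≡ 0# × c ≡ 0#) → RootCount (χ (disc b c)) (ν b c)
  rootCount b c h = by-class (χ (disc b c)) (ν b c) refl refl
    where
    by-class : ∀ k n → χ (disc b c) ≡ k → ν b c ≡ n → RootCount k n
    by-class nonsquare n e e′ = subst (RootCount nonsquare) (trans (sym (rootCount-nonsquare b c e)) e′) one
    by-class square zero e e′ = zero
    by-class square (suc n) e e′ =
      let (t , _ , ht) = count-suc⇒∃ {p = λ t → cubic b c t == 0#} elems (subst (1 ≤_) (sym e′) (s≤s z≤n))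
      in subst (RootCount square) (trans (sym (rootCount-square b c t e (==⁻ ht))) e′) three
    by-class null n e e′ = subst (RootCount null)
      (trans (sym (rootCount-null b c (disc-null⇒b≢0 h (χ-null⁻ e)) (χ-null⁻ e))) e′) double

-- Planes as binary cubic forms, and their Hessians

module CubicForms (F : FiniteField) (2≢0 : PG.ofℕ F 2 ≢ FiniteField.0# F) (3≢0 : PG.ofℕ F 3 ≢ FiniteField.0# F) where
  open Depressed F 2≢0 3≢0 public
  open PG F public hiding (ofℕ; _==_)
  open ≡-Reasoning

  vec4 : ∀ {a b c d a′ b′ c′ d′ : Carrier} → a ≡ a′ → b ≡ b′ → c ≡ c′ → d ≡ d′ →
         _≡_ {A = Vec4} (a ∷ b ∷ c ∷ d ∷ []) (a′ ∷ b′ ∷ c′ ∷ d′ ∷ [])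
  vec4 refl refl refl refl = refl

  proportional⁻ : ∀ {u v} → T (proportional u v) → ∃ λ a → a ≢ 0# × u ≡ scale a v
  proportional⁻ t = let (a , _ , h) = any-T elems t; (a≢0 , e) = T-∧⁻ h
                    in a , (λ a≡0 → T-not⁻ a≢0 (==⁺ a≡0)) , toWitness e

  proportional⁺ : ∀ {u v} a → a ≢ 0# → u ≡ scale a v → T (proportional u v)
  proportional⁺ a a≢0 e = T-any (elems-complete a) (T-∧⁺ (T-not⁺ (a≢0 ∘ ==⁻)) (fromWitness e))

  isΓ⁻ : ∀ {π} → T (isΓPlane π) → (∃ λ a → a ≢ 0# × π ≡ scale a osc∞) ⊎ (∃ λ τ → ∃ λ a → a ≢ 0# × π ≡ scale a (osc τ))
  isΓ⁻ t with any-T (osc∞ ∷ map osc elems) t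
  ... | _ , here refl , h = inj₁ (proportional⁻ h)
  ... | _ , there o∈ , h = let (τ , _ , e) = ∈-map⁻ osc o∈ in inj₂
    (τ , proportional⁻ (subst (T ∘ proportional _) e h))

  isΓ∞⁺ : ∀ {π} a → a ≢ 0# → π ≡ scale a osc∞ → T (isΓPlane π)
  isΓ∞⁺ a a≢0 e = T-any {xs = osc∞ ∷ map osc elems} (here refl) (proportional⁺ a a≢0 e)

  isΓ⁺ : ∀ {π} τ a → a ≢ 0# → π ≡ scale a (osc τ) → T (isΓPlane π)
  isΓ⁺ τ a a≢0 e = T-any {xs = osc∞ ∷ map osc elems} (there (∈-map⁺ osc (elems-complete τ))) (proportional⁺ a a≢0 e)

  -- The plane π(c₀, c₁, c₂, c₃) meets the twisted cubic in the roots of c₀t³ + c₁t² + c₂t + c₃.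
  cub : Plane → Carrier → Carrier
  cub (c₀ ∷ c₁ ∷ c₂ ∷ c₃ ∷ []) t = c₀ * (t * t * t) + c₁ * (t * t) + c₂ * t + c₃

  lead : Plane → Carrier
  lead (c₀ ∷ _) = c₀

  HA HB HC Δ : Plane → Carrier
  HA (c₀ ∷ c₁ ∷ c₂ ∷ c₃ ∷ []) = c₁ * c₁ + - (ofℕ 3 * (c₀ * c₂))
  HB (c₀ ∷ c₁ ∷ c₂ ∷ c₃ ∷ []) = c₁ * c₂ + - (ofℕ 9 * (c₀ * c₃))
  HC (c₀ ∷ c₁ ∷ c₂ ∷ c₃ ∷ []) = c₂ * c₂ + - (ofℕ 3 * (c₁ * c₃))
  Δ π = HB π * HB π + - (ofℕ 4 * (HA π * HC π))

  -- the Hessian covariant; HA is its value at ∞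
  H : Plane → Carrier → Carrier
  H π t = HA π * (t * t) + HB π * t + HC π

  #roots-plane : Plane → ℕ
  #roots-plane π = ι (lead π == 0#) ℕ.+ # (λ t → cub π t == 0#)

  dot-P : ∀ π t → dot π (P t) ≡ cub π t
  dot-P (c₀ ∷ c₁ ∷ c₂ ∷ c₃ ∷ []) t =
    (ring 5 (λ c₀ c₁ c₂ c₃ t → c₀ :* (t :* t :* t) :+ (c₁ :* (t :* t) :+ (c₂ :* t :+ (c₃ :* κ 1 :+ κ 0))) ⊜ c₀ :*
      (t :* t :* t) :+ c₁ :* (t :* t) :+ c₂ :* t :+ c₃) c₀ c₁ c₂ c₃ t)

  dot-P∞ : ∀ π → dot π P∞ ≡ lead π
  dot-P∞ (c₀ ∷ c₁ ∷ c₂ ∷ c₃ ∷ []) = ring 4 (λ c₀ c₁ c₂ c₃ → c₀ :* κ 1 :+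
    (c₁ :* κ 0 :+ (c₂ :* κ 0 :+ (c₃ :* κ 0 :+ κ 0))) ⊜ c₀) c₀ c₁ c₂ c₃

  nCurvePoints≡ : ∀ π → nCurvePoints π ≡ #roots-plane π
  nCurvePoints≡ π = trans (count-∷ {p = incident π} P∞ (map P elems))
    (cong₂ ℕ._+_ (cong (λ x → ι (x == 0#)) (dot-P∞ π))
      (trans (count-map {p = incident π} P elems)
        (#-cong (λ {t} h → ==⁺ (trans (sym (dot-P π t)) (==⁻ h))) (λ {t} h → ==⁺ (trans (dot-P π t) (==⁻ h))))))

  -- The multiples of `osc τ` are the cubics a(t - τ)³, and those of `osc∞` are the forms with a
  -- triple root at ∞.
  record NoTripleRoot (π : Plane) : Set where
    constructor noTripleRoot
    field
      not∞ : ∀ a → a ≢ 0# → π ≢ scale a osc∞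
      notτ : ∀ τ a → a ≢ 0# → π ≢ scale a (osc τ)

  ¬Γ⇒NoTripleRoot : ∀ {π} → ¬ T (isΓPlane π) → NoTripleRoot π
  ¬Γ⇒NoTripleRoot h = noTripleRoot (λ a a≢0 e → h (isΓ∞⁺ a a≢0 e)) (λ τ a a≢0 e → h (isΓ⁺ τ a a≢0 e))

  ι-yes : ∀ {x} → x ≡ 0# → ι (x == 0#) ≡ 1
  ι-yes {x} e with x ≟ 0#
  ... | yes _ = refl
  ... | no h  = ⊥-elim (h e)

  ι-no : ∀ {x} → x ≢ 0# → ι (x == 0#) ≡ 0
  ι-no {x} h with x ≟ 0#
  ... | yes e = ⊥-elim (h e)
  ... | no _  = refl

  cube-root : ∀ {a τ x} → a ≢ 0# → cub (scale a (osc τ)) x ≡ 0# → x ≡ τ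
  cube-root {a} {τ} {x} a≢0 h = lin 2 (λ x τ → (x ⊜ τ) , (κ 1 ×[ x :- τ ⊜ κ 0 ]) ∷ []) x τ (x-τ≡0 , _)
    where
    x-τ≡0 : x + - τ ≡ 0#
    x-τ≡0 = [ square-0 , (λ e → e) ]′
      (zero-product (cancel-0 a≢0 (lin 3 (λ a τ x → (a :* ((x :- τ) :* (x :- τ) :* (x :- τ)) ⊜ κ 0) ,
      (κ 1 ×[ a :* κ 1 :* (x :* x :* x) :+ a :* :- (κ 3 :* τ) :* (x :* x) :+ a :* (κ 3 :* (τ :* τ)) :* x :+ a :* :-
      (τ :* τ :* τ) ⊜ κ 0 ]) ∷ []) a τ x (h , _))))

  Γ⇒1 : ∀ {π} → T (isΓPlane π) → nCurvePoints π ≡ 1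
  Γ⇒1 {π} t = trans (nCurvePoints≡ π) (case isΓ⁻ t of λ
    { (inj₁ (a , a≢0 , refl)) → cong₂ ℕ._+_ (ι-yes (zeroʳ a))
        (#-none λ {x} h → a≢0 (lin 2 (λ a x → (a ⊜ κ 0) , (κ 1 ×[ a :* κ 0 :* (x :* x :* x) :+ a :* κ 0 :*
          (x :* x) :+ a :* κ 0 :* x :+ a :* κ 1 ⊜ κ 0 ]) ∷ []) a x (==⁻ h , _)))
    ; (inj₂ (τ , a , a≢0 , refl)) → cong₂ ℕ._+_ (ι-no (*-≢0 a≢0 1≢0)) (#-enum (τ ∷ []) ([] ∷ [])
        (λ {x} h → here (cube-root a≢0 (==⁻ h)))
        (λ { (here refl) → ==⁺ (ring 2 (λ a τ → a :* κ 1 :* (τ :* τ :* τ) :+ a :* :- (κ 3 :* τ) :* (τ :* τ) :+ a :*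
          (κ 3 :* (τ :* τ)) :* τ :+ a :* :- (τ :* τ :* τ) ⊜ κ 0) a τ) })) })

  -- -3Δ is the discriminant of the cubic up to a square factor. When it vanishes, the Hessian is
  -- the square of a linear form whose zero is the double root, so it is a nonzero square wherever
  -- the cubic does not vanish.
  record Shape (π : Plane) : Set where
    field
      count-roots : RootCount (χ (- ofℕ 3 * Δ π)) (#roots-plane π)
      null-∞      : Δ π ≡ 0# → lead π ≢ 0# → χ (HA π) ≡ square
      null-τ      : Δ π ≡ 0# → ∀ t → cub π t ≢ 0# → χ (H π t) ≡ square

  private
    χ-scaled : ∀ {x y} s → s ≢ 0# → x ≡ s * s * y → χ x ≡ χ y
    χ-scaled s s≢0 e = trans (cong χ e) (χ-*-square (χ-square s≢0 refl))

    χΔ-null : ∀ {x y} s → s ≢ 0# → - ofℕ 3 * x ≡ s * s * y → x ≡ 0# → y ≡ 0#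
    χΔ-null {x} s s≢0 e refl = cancel-0 (*-≢0 s≢0 s≢0) (trans (sym e) (zeroʳ _))

  -- The coefficients are written so that the substitution of t - k for t depresses the cubic
  -- without division; `b′` and `c′` are the resulting coefficients.
  shape-affine : ∀ a k b d → a ≢ 0# → NoTripleRoot (a ∷ a * (ofℕ 3 * k) ∷ a * b ∷ a * d ∷ []) →
                 Shape (a ∷ a * (ofℕ 3 * k) ∷ a * b ∷ a * d ∷ [])
  shape-affine a k b d a≢0 (noTripleRoot _ h) = record
    { count-roots = subst₂ RootCount (sym (χ-scaled s s≢0 eqΔ)) (sym roots) (rootCount b′ c′ ¬0)
    ; null-∞ = λ e _ → let (u , u≢0 , b≡ , c≡) = double-root (b′≢0 e) (disc≡0 e) in χ-square (*-≢0 (*-≢0 3≢0 a≢0) u≢0)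
        (lin 5 (λ a k b d u → (κ 3 :* a :* u :* (κ 3 :* a :* u) ⊜ a :* (κ 3 :* k) :* (a :* (κ 3 :* k)) :- κ 3 :*
          (a :* (a :* b))) , (:- (κ 3 :* a :* a) :* :- (κ 1) ×[ b :- κ 3 :* (k :* k) ⊜ :-
          (κ 3 :* (u :* u)) ]) ∷ []) a k b d u (b≡ , _))
    ; null-τ = λ e t ft≢0 → let (u , u≢0 , b≡ , c≡) = double-root (b′≢0 e) (disc≡0 e) in
        χ-square (*-≢0 (*-≢0 (*-≢0 3≢0 a≢0) u≢0) (t+k+u≢0 t u ft≢0 b≡ c≡)) (eqH t u b≡ c≡) }
    where
    π = a ∷ a * (ofℕ 3 * k) ∷ a * b ∷ a * d ∷ []
    b′ = b + - (ofℕ 3 * (k * k))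
    c′ = d + - (k * b) + ofℕ 2 * (k * k * k)
    s = ofℕ 3 * (a * a)

    s≢0 : s ≢ 0#
    s≢0 = *-≢0 3≢0 (*-≢0 a≢0 a≢0)

    eqΔ : - ofℕ 3 * Δ π ≡ s * s * disc b′ c′
    eqΔ = ring 4 (λ a k b d → :- (κ 3) :* ((a :* (κ 3 :* k) :* (a :* b) :- κ 9 :* (a :* (a :* d))) :*
      (a :* (κ 3 :* k) :* (a :* b) :- κ 9 :* (a :* (a :* d))) :- κ 4 :*
      ((a :* (κ 3 :* k) :* (a :* (κ 3 :* k)) :- κ 3 :* (a :* (a :* b))) :* (a :* b :* (a :* b) :- κ 3 :*
      (a :* (κ 3 :* k) :* (a :* d))))) ⊜ κ 3 :* (a :* a) :* (κ 3 :* (a :* a)) :*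
      (:- (κ 4 :* ((b :- κ 3 :* (k :* k)) :* (b :- κ 3 :* (k :* k)) :* (b :- κ 3 :* (k :* k)))) :- κ 27 :*
      ((d :- k :* b :+ κ 2 :* (k :* k :* k)) :* (d :- k :* b :+ κ 2 :* (k :* k :* k))))) a k b d

    disc≡0 : Δ π ≡ 0# → disc b′ c′ ≡ 0#
    disc≡0 = χΔ-null s s≢0 eqΔ

    shift : ∀ t → cub π t ≡ a * ((t + k) * (t + k) * (t + k) + b′ * (t + k) + c′)
    shift t = ring 5 (λ a k b d t → a :* (t :* t :* t) :+ a :* (κ 3 :* k) :* (t :* t) :+ a :* b :* t :+ a :* d ⊜ a :*
      ((t :+ k) :* (t :+ k) :* (t :+ k) :+ (b :- κ 3 :* (k :* k)) :* (t :+ k) :+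
      (d :- k :* b :+ κ 2 :* (k :* k :* k)))) a k b d t

    roots : #roots-plane π ≡ ν b′ c′
    roots = trans (cong (ℕ._+ # (λ t → cub π t == 0#)) (ι-no a≢0))
      (#-bij (_+ k) (_+ - k) (λ t → (ring 2 (λ t k → t :+ k :- k ⊜ t) t k))
        (λ t → (ring 2 (λ t k → t :- k :+ k ⊜ t) t k))
        (λ {t} h → ==⁺ (cancel-0 a≢0 (trans (sym (shift t)) (==⁻ h))))
        (λ {t} h → ==⁺ (trans (shift t) (trans (cong (a *_) (==⁻ h)) (zeroʳ a)))))

    ¬0 : ¬ (b′ ≡ 0# × c′ ≡ 0#)
    ¬0 (b≡ , c≡) = h (- k) a a≢0 (vec4
      (ring 1 (λ a → a ⊜ a :* κ 1) a) (ring 2 (λ a k → a :* (κ 3 :* k) ⊜ a :* :- (κ 3 :* :- k)) a k)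
      (lin 3 (λ a k b → (a :* b ⊜ a :* (κ 3 :* (:- k :* :- k))) , (a ×[ b :- κ 3 :* (k :* k) ⊜ κ 0 ]) ∷ []) a k b
        (b≡ , _))
      (lin 4 (λ a k b d → (a :* d ⊜ a :* :- (:- k :* :- k :* :- k)) , (a :* k ×[ b :- κ 3 :* (k :* k) ⊜ κ 0 ]) ∷
        (a ×[ d :- k :* b :+ κ 2 :* (k :* k :* k) ⊜ κ 0 ]) ∷ []) a k b d (b≡ , c≡ , _)))

    b′≢0 : Δ π ≡ 0# → b′ ≢ 0#
    b′≢0 e = disc-null⇒b≢0 ¬0 (disc≡0 e)

    t+k+u≢0 : ∀ t u → cub π t ≢ 0# → b′ ≡ - (ofℕ 3 * (u * u)) → c′ ≡ - (ofℕ 2 * (u * u * u)) → t + k + u ≢ 0#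
    t+k+u≢0 t u ft≢0 b≡ c≡ e = ft≢0
      (trans (shift t) (lin 6 (λ a t k u b c →
      (a :* ((t :+ k) :* (t :+ k) :* (t :+ k) :+ b :* (t :+ k) :+ c) ⊜ κ 0) ,
      (a :* (t :+ k) ×[ b ⊜ :- (κ 3 :* (u :* u)) ]) ∷ (a ×[ c ⊜ :- (κ 2 :* (u :* u :* u)) ]) ∷
      (a :* (t :+ k :+ u) :* (t :+ k :- κ 2 :* u) ×[ t :+ k :+ u ⊜ κ 0 ]) ∷ []) a t k u b′ c′ (b≡ , c≡ , e , _)))

    eqH : ∀ t u → b′ ≡ - (ofℕ 3 * (u * u)) → c′ ≡ - (ofℕ 2 * (u * u * u)) →
          (ofℕ 3 * a * u * (t + k + u)) * (ofℕ 3 * a * u * (t + k + u)) ≡ H π t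
    eqH t u b≡ c≡ = trans
      (lin 6 (λ a t k u b c → (κ 3 :* a :* u :* (t :+ k :+ u) :* (κ 3 :* a :* u :* (t :+ k :+ u)) ⊜ a :* a :*
        (:- (κ 3) :* b :* ((t :+ k) :* (t :+ k)) :- κ 9 :* c :* (t :+ k) :+ b :* b)) ,
        (a :* a :* (κ 3 :* (t :+ k) :* (t :+ k) :+ κ 3 :* u :* u :- b) ×[ b ⊜ :- (κ 3 :* (u :* u)) ]) ∷
        (κ 9 :* a :* a :* (t :+ k) ×[ c ⊜ :- (κ 2 :* (u :* u :* u)) ]) ∷ []) a t k u b′ c′ (b≡ , c≡ , _))
      (ring 5 (λ a t k b d → a :* a :* (:- (κ 3) :* (b :- κ 3 :* (k :* k)) :* ((t :+ k) :* (t :+ k)) :- κ 9 :*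
        (d :- k :* b :+ κ 2 :* (k :* k :* k)) :* (t :+ k) :+ (b :- κ 3 :* (k :* k)) :* (b :- κ 3 :* (k :* k))) ⊜
        (a :* (κ 3 :* k) :* (a :* (κ 3 :* k)) :- κ 3 :* (a :* (a :* b))) :* (t :* t) :+
        (a :* (κ 3 :* k) :* (a :* b) :- κ 9 :* (a :* (a :* d))) :* t :+ (a :* b :* (a :* b) :- κ 3 :*
        (a :* (κ 3 :* k) :* (a :* d)))) a t k b d)

  -- ∞ is a simple root, and the finite roots are those of a quadratic with discriminant `e`; hence
  -- one more root than e has square roots.
  shape-conic : ∀ c₁ c₂ c₃ → c₁ ≢ 0# → Shape (0# ∷ c₁ ∷ c₂ ∷ c₃ ∷ [])
  shape-conic c₁ c₂ c₃ c₁≢0 = record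
    { count-roots = subst₂ RootCount (sym (χ-scaled s s≢0 eqΔ)) (sym roots) (quadratic (χ e))
    ; null-∞ = λ _ 0≢0 → ⊥-elim (0≢0 refl)
    ; null-τ = λ Δ≡0 t ft≢0 → trans (sym (χ-*-square (χ-square 2≢0 refl)))
        (χ-square {r = ofℕ 2 * c₁ * t + c₂} (λ h → ft≢0 (cancel-0 (*-≢0 (*-≢0 2≢0 2≢0) c₁≢0)
            (lin 4 (λ c₁ c₂ c₃ t → (κ 2 :* κ 2 :* c₁ :* (κ 0 :* (t :* t :* t) :+ c₁ :*
              (t :* t) :+ c₂ :* t :+ c₃) ⊜ κ 0) , (κ 2 :* c₁ :* t :+ c₂ ×[ κ 2 :* c₁ :* t :+ c₂ ⊜ κ 0 ]) ∷
              (:- (κ 1) ×[ c₂ :* c₂ :- κ 4 :* (c₁ :* c₃) ⊜ κ 0 ]) ∷ []) c₁ c₂ c₃ t (h , e≡0 Δ≡0 , _))))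
          (lin 4 (λ c₁ c₂ c₃ t → ((κ 2 :* c₁ :* t :+ c₂) :* (κ 2 :* c₁ :* t :+ c₂) ⊜ κ 2 :* κ 2 :*
            ((c₁ :* c₁ :- κ 3 :* (κ 0 :* c₂)) :* (t :* t) :+ (c₁ :* c₂ :- κ 9 :* (κ 0 :* c₃)) :* t :+
            (c₂ :* c₂ :- κ 3 :* (c₁ :* c₃)))) , (:- (κ 3) ×[ c₂ :* c₂ :- κ 4 :* (c₁ :* c₃) ⊜ κ 0 ]) ∷ []) c₁ c₂ c₃ t
            (e≡0 Δ≡0 , _))) }
    where
    π = 0# ∷ c₁ ∷ c₂ ∷ c₃ ∷ []
    e = c₂ * c₂ + - (ofℕ 4 * (c₁ * c₃))
    s = ofℕ 3 * c₁

    s≢0 : s ≢ 0#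
    s≢0 = *-≢0 3≢0 c₁≢0

    eqΔ : - ofℕ 3 * Δ π ≡ s * s * e
    eqΔ = ring 3 (λ c₁ c₂ c₃ → :- (κ 3) :* ((c₁ :* c₂ :- κ 9 :* (κ 0 :* c₃)) :*
      (c₁ :* c₂ :- κ 9 :* (κ 0 :* c₃)) :- κ 4 :* ((c₁ :* c₁ :- κ 3 :* (κ 0 :* c₂)) :*
      (c₂ :* c₂ :- κ 3 :* (c₁ :* c₃)))) ⊜ κ 3 :* c₁ :* (κ 3 :* c₁) :* (c₂ :* c₂ :- κ 4 :* (c₁ :* c₃))) c₁ c₂ c₃

    e≡0 : Δ π ≡ 0# → e ≡ 0#
    e≡0 = χΔ-null s s≢0 eqΔ

    complete : ∀ t → ofℕ 2 * ofℕ 2 * c₁ * cub π t ≡ (ofℕ 2 * c₁ * t + c₂) * (ofℕ 2 * c₁ * t + c₂) + - e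
    complete t = ring 4 (λ c₁ c₂ c₃ t → κ 2 :* κ 2 :* c₁ :* (κ 0 :* (t :* t :* t) :+ c₁ :*
      (t :* t) :+ c₂ :* t :+ c₃) ⊜ (κ 2 :* c₁ :* t :+ c₂) :* (κ 2 :* c₁ :* t :+ c₂) :-
      (c₂ :* c₂ :- κ 4 :* (c₁ :* c₃))) c₁ c₂ c₃ t

    roots : #roots-plane π ≡ 1 ℕ.+ #roots (χ e)
    roots = cong₂ ℕ._+_ (ι-yes refl) (trans
      (#-bij (λ t → ofℕ 2 * c₁ * t + c₂) (λ x → ½ * c₁ ⁻¹ * (x + - c₂))
        (λ t → (lin 5 (λ t c₁ c₂ h i → (h :* i :* (κ 2 :* c₁ :* t :+ c₂ :- c₂) ⊜ t) ,
          (c₁ :* i :* t ×[ κ 2 :* h ⊜ κ 1 ]) ∷ (t ×[ c₁ :* i ⊜ κ 1 ]) ∷ []) t c₁ c₂ ½ (c₁ ⁻¹)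
          (½-inverse , ⁻¹-inverse c₁≢0 , _)))
        (λ t → (lin 5 (λ t c₁ c₂ h i → (κ 2 :* c₁ :* (h :* i :* (t :- c₂)) :+ c₂ ⊜ t) ,
          (c₁ :* i :* (t :- c₂) ×[ κ 2 :* h ⊜ κ 1 ]) ∷ (t :- c₂ ×[ c₁ :* i ⊜ κ 1 ]) ∷ []) t c₁ c₂ ½ (c₁ ⁻¹)
          (½-inverse , ⁻¹-inverse c₁≢0 , _)))
        (λ {t} h → ==⁺ ((lin 3 (λ x e f → (x :* x ⊜ e) , (κ 1 ×[ f ⊜ κ 0 ]) ∷ (:- (κ 1) ×[ f ⊜ x :* x :- e ]) ∷ [])
          ((ofℕ 2 * c₁ * t + c₂)) e (ofℕ 2 * ofℕ 2 * c₁ * cub π t) (trans (cong (ofℕ 2 * ofℕ 2 * c₁ *_) (==⁻ h))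
          (zeroʳ _) , complete t , _))))
        (λ {t} h → ==⁺ (cancel-0 (*-≢0 (*-≢0 2≢0 2≢0) c₁≢0) (trans (complete t) (trans (cong (_+ - e) (==⁻ h))
          (-‿inverseʳ e))))))
      (#sqrt e))

    quadratic : ∀ c → RootCount c (1 ℕ.+ #roots c)
    quadratic null      = double
    quadratic square    = three
    quadratic nonsquare = one

  -- ∞ is a double root and there is one finite root; the Hessian is the constant c₂².
  shape-line : ∀ c₂ c₃ → c₂ ≢ 0# → Shape (0# ∷ 0# ∷ c₂ ∷ c₃ ∷ [])
  shape-line c₂ c₃ c₂≢0 = record
    { count-roots = subst₂ RootCount (sym (χ-null eqΔ)) (sym roots) double
    ; null-∞ = λ _ 0≢0 → ⊥-elim (0≢0 refl)
    ; null-τ = λ _ t _ → χ-square c₂≢0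
        (ring 3 (λ c₂ c₃ t → c₂ :* c₂ ⊜ (κ 0 :* κ 0 :- κ 3 :* (κ 0 :* c₂)) :* (t :* t) :+
          (κ 0 :* c₂ :- κ 9 :* (κ 0 :* c₃)) :* t :+ (c₂ :* c₂ :- κ 3 :* (κ 0 :* c₃))) c₂ c₃ t) }
    where
    π = 0# ∷ 0# ∷ c₂ ∷ c₃ ∷ []

    eqΔ : - ofℕ 3 * Δ π ≡ 0#
    eqΔ = ring 2 (λ c₂ c₃ → :- (κ 3) :* ((κ 0 :* c₂ :- κ 9 :* (κ 0 :* c₃)) :*
      (κ 0 :* c₂ :- κ 9 :* (κ 0 :* c₃)) :- κ 4 :* ((κ 0 :* κ 0 :- κ 3 :* (κ 0 :* c₂)) :*
      (c₂ :* c₂ :- κ 3 :* (κ 0 :* c₃)))) ⊜ κ 0) c₂ c₃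

    roots : #roots-plane π ≡ 2
    roots = cong₂ ℕ._+_ (ι-yes refl) (#-enum (- c₃ * c₂ ⁻¹ ∷ []) ([] ∷ [])
      (λ {x} h → here (lin 4 (λ x c₂ c₃ i → (x ⊜ :- c₃ :* i) , (i ×[ κ 0 :* (x :* x :* x) :+ κ 0 :*
        (x :* x) :+ c₂ :* x :+ c₃ ⊜ κ 0 ]) ∷ (:- x ×[ c₂ :* i ⊜ κ 1 ]) ∷ []) x c₂ c₃ (c₂ ⁻¹)
        (==⁻ h , ⁻¹-inverse c₂≢0 , _)))
      (λ { (here refl) → ==⁺ (lin 3 (λ c₂ c₃ i → (κ 0 :* (:- c₃ :* i :* (:- c₃ :* i) :* (:- c₃ :* i)) :+ κ 0 :*
        (:- c₃ :* i :* (:- c₃ :* i)) :+ c₂ :* (:- c₃ :* i) :+ c₃ ⊜ κ 0) , (:- c₃ ×[ c₂ :* i ⊜ κ 1 ]) ∷ []) c₂ c₃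
        (c₂ ⁻¹) (⁻¹-inverse c₂≢0 , _)) }))

  zeroᵛ : Vec4
  zeroᵛ = 0# ∷ 0# ∷ 0# ∷ 0# ∷ []

  shape : ∀ π → π ≢ zeroᵛ → NoTripleRoot π → Shape π
  shape (c₀ ∷ c₁ ∷ c₂ ∷ c₃ ∷ []) π≢0 h = case c₀ ≟ 0# of λ
    { (no c₀≢0) → let k = ⅓ * (c₀ ⁻¹ * c₁)
                      e : (c₀ ∷ c₀ * (ofℕ 3 * k) ∷ c₀ * (c₀ ⁻¹ * c₂) ∷ c₀ * (c₀ ⁻¹ * c₃) ∷ []) ≡
                        (c₀ ∷ c₁ ∷ c₂ ∷ c₃ ∷ [])
                      e = vec4 refl (lin 4 (λ a i h c₁ → (a :* (κ 3 :* (h :* (i :* c₁))) ⊜ c₁) ,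
                        (a :* i :* c₁ ×[ κ 3 :* h ⊜ κ 1 ]) ∷ (c₁ ×[ a :* i ⊜ κ 1 ]) ∷ []) c₀ (c₀ ⁻¹) ⅓ c₁
                        (⅓-inverse , ⁻¹-inverse c₀≢0 , _))
                            (undo c₀≢0 c₂) (undo c₀≢0 c₃)
                  in subst Shape e (shape-affine c₀ k (c₀ ⁻¹ * c₂) (c₀ ⁻¹ * c₃) c₀≢0 (subst NoTripleRoot (sym e) h))
    ; (yes refl) → case c₁ ≟ 0# of λ
        { (no c₁≢0) → shape-conic c₁ c₂ c₃ c₁≢0
        ; (yes refl) → shape-line c₂ c₃ λ { refl → NoTripleRoot.not∞ h c₃ (λ { refl → π≢0 refl })
            (vec4 (sym (zeroʳ c₃)) (sym (zeroʳ c₃)) (sym (zeroʳ c₃)) (ring 1 (λ c → c ⊜ c :* κ 1) c₃)) } } }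
    where
    undo : ∀ {a} → a ≢ 0# → ∀ x → a * (a ⁻¹ * x) ≡ x
    undo {a} a≢0 x = lin 3 (λ a i x → (a :* (i :* x) ⊜ x) , (x ×[ a :* i ⊜ κ 1 ]) ∷ []) a (a ⁻¹) x
      (⁻¹-inverse a≢0 , _)

-- Square and nonsquare values of the Hessian off the roots

module HessianCounts (F : FiniteField) (2≢0 : PG.ofℕ F 2 ≢ FiniteField.0# F)
  (3≢0 : PG.ofℕ F 3 ≢ FiniteField.0# F) where
  open CubicForms F 2≢0 3≢0 public
  open ≡-Reasoning

  ε : Class
  ε = χ (- ofℕ 3)

  ε≢null : ε ≢ null
  ε≢null = χ≢null (-‿≢0 3≢0)

  -- The points of the projective line where the cubic does not vanish and the Hessian has class
  -- `c`. For a plane that is not osculating this turns out to be its number of lines in the orbit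
  -- of class `c`.
  #outside : Class → Plane → ℕ
  #outside c π = ι (not (lead π == 0#) ∧ is c (HA π)) ℕ.+ # (λ t → not (cub π t == 0#) ∧ is c (H π t))

  private
    ι-split : ∀ r p → (T r → T p) → ι p ≡ ι (not r ∧ p) ℕ.+ ι r
    ι-split true  true  h = refl
    ι-split true  false h = ⊥-elim (h _)
    ι-split false true  h = refl
    ι-split false false h = refl

    ι-cong : ∀ {a b} → (T a → T b) → (T b → T a) → ι a ≡ ι b
    ι-cong {true}  {true}  f g = refl
    ι-cong {true}  {false} f g = ⊥-elim (f _)
    ι-cong {false} {true}  f g = ⊥-elim (g _)
    ι-cong {false} {false} f g = refl

    #-split : ∀ (r p : Carrier → Bool) → (∀ t → T (r t) → T (p t)) → # p ≡ # (λ t → not (r t) ∧ p t) ℕ.+ # r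
    #-split r p h = begin
      # p                                                                ≡⟨ #≡∑ p ⟩
      ∑ elems (ι ∘ p) ≡⟨ ∑-cong elems (λ t _ → ι-split (r t) (p t) (h t)) ⟩
      ∑ elems (λ t → ι (not (r t) ∧ p t) ℕ.+ ι (r t))                    ≡⟨ ∑-+ _ _ elems ⟩
      ∑ elems (λ t → ι (not (r t) ∧ p t)) ℕ.+ ∑ elems (λ t → ι (r t)) ≡⟨ cong₂ ℕ._+_ (#≡∑ (λ t → not (r t) ∧ p t))
        (#≡∑ r) ⟨
      # (λ t → not (r t) ∧ p t) ℕ.+ # r                                  ∎

    interchange : ∀ a b c d → (a ℕ.+ b) ℕ.+ (c ℕ.+ d) ≡ (a ℕ.+ c) ℕ.+ (b ℕ.+ d)
    interchange = +-interchange
      where open import Algebra.Properties.CommutativeSemigroup ℕP.+-commutativeSemigroup using () renaming (interchange to +-interchange)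

    -- The predicate `a`, `p` agrees with the class condition off the roots and holds at every root.
    -- It is the class condition itself when Δ ≠ 0, and constantly true when Δ = 0, where the
    -- Hessian vanishes at the double root.
    outside+roots : ∀ c π (a : Bool) (p : Carrier → Bool) →
      (T (lead π == 0#) → T a) → (∀ t → T (cub π t == 0#) → T (p t)) →
      (ι (not (lead π == 0#) ∧ a) ≡ ι (not (lead π == 0#) ∧ is c (HA π))) →
      # (λ t → not (cub π t == 0#) ∧ p t) ≡ # (λ t → not (cub π t == 0#) ∧ is c (H π t)) →
      #outside c π ℕ.+ #roots-plane π ≡ ι a ℕ.+ # p
    outside+roots c π a p h∞ h e∞ e = begin
      #outside c π ℕ.+ #roots-plane π                 ≡⟨ cong (ℕ._+ #roots-plane π) (cong₂ ℕ._+_ e∞ e) ⟨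
      (ι (not (lead π == 0#) ∧ a) ℕ.+ # (λ t → not (cub π t == 0#) ∧ p t)) ℕ.+ #roots-plane π ≡⟨ interchange
        (ι (not (lead π == 0#) ∧ a)) _ _ _ ⟩
      (ι (not (lead π == 0#) ∧ a) ℕ.+ ι (lead π == 0#)) ℕ.+ (# (λ t → not (cub π t == 0#) ∧ p t) ℕ.+ #
        (λ t → cub π t == 0#))
                                                      ≡⟨ cong₂ ℕ._+_ (ι-split (lead π == 0#) a h∞)
                                                        (#-split (λ t → cub π t == 0#) p h) ⟨
      ι a ℕ.+ # p                                     ∎

  -- H = f′² - 3fg with g = f″/2, so H = f′² at a root; and f = f′ = 0 would make Δ vanish.
  root-square : ∀ π t → Δ π ≢ 0# → cub π t ≡ 0# → χ (H π t) ≡ square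
  root-square (c₀ ∷ c₁ ∷ c₂ ∷ c₃ ∷ []) t Δ≢0 ft = χ-square {r = f′}
    (λ e → Δ≢0 (trans Δ≡ (lin 5 (λ f d g A c₀ → ((d :* g :- κ 9 :* (c₀ :* f)) :*
      (d :* g :- κ 9 :* (c₀ :* f)) :- κ 4 :* (A :* (d :* d :- κ 3 :* (f :* g))) ⊜ κ 0) ,
      (κ 81 :* c₀ :* c₀ :* f :+ κ 12 :* A :* g ×[ f ⊜ κ 0 ]) ∷
      (d :* g :* g :- κ 18 :* c₀ :* f :* g :- κ 4 :* A :* d ×[ d ⊜ κ 0 ]) ∷ []) f f′ g (HA π) c₀ (ft , e , _))))
    (trans (lin 3 (λ f d g → (d :* d ⊜ d :* d :- κ 3 :* (f :* g)) , (κ 3 :* g ×[ f ⊜ κ 0 ]) ∷ []) f f′ g (ft , _))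
      (sym H≡))
    where
    π = c₀ ∷ c₁ ∷ c₂ ∷ c₃ ∷ []
    f = cub π t
    f′ = ofℕ 3 * (c₀ * (t * t)) + ofℕ 2 * (c₁ * t) + c₂
    g = ofℕ 3 * (c₀ * t) + c₁

    H≡ : H π t ≡ f′ * f′ + - (ofℕ 3 * (f * g))
    H≡ = ring 5 (λ c₀ c₁ c₂ c₃ t → (c₁ :* c₁ :- κ 3 :* (c₀ :* c₂)) :* (t :* t) :+
      (c₁ :* c₂ :- κ 9 :* (c₀ :* c₃)) :* t :+ (c₂ :* c₂ :- κ 3 :* (c₁ :* c₃)) ⊜ (κ 3 :* (c₀ :* (t :* t)) :+ κ 2 :*
      (c₁ :* t) :+ c₂) :* (κ 3 :* (c₀ :* (t :* t)) :+ κ 2 :* (c₁ :* t) :+ c₂) :- κ 3 :*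
      ((c₀ :* (t :* t :* t) :+ c₁ :* (t :* t) :+ c₂ :* t :+ c₃) :* (κ 3 :* (c₀ :* t) :+ c₁))) c₀ c₁ c₂ c₃ t

    -- The discriminant of the Hessian, expanded at t instead of 0: the square of H′(t) minus
    -- 4·HA·H(t), where H′(t) = f′g - 9c₀f.
    Δ≡ : Δ π ≡ (f′ * g + - (ofℕ 9 * (c₀ * f))) * (f′ * g + - (ofℕ 9 * (c₀ * f))) + -
      (ofℕ 4 * (HA π * (f′ * f′ + - (ofℕ 3 * (f * g)))))
    Δ≡ = trans (ring 4 (λ A B C t → B :* B :- κ 4 :* (A :* C) ⊜ (κ 2 :* (A :* t) :+ B) :*
      (κ 2 :* (A :* t) :+ B) :- κ 4 :* (A :* (A :* (t :* t) :+ B :* t :+ C))) (HA π) (HB π) (HC π) t)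
      (cong₂ (λ x y → x * x + - (ofℕ 4 * (HA π * y)))
        (ring 5 (λ c₀ c₁ c₂ c₃ t → κ 2 :* ((c₁ :* c₁ :- κ 3 :* (c₀ :* c₂)) :* t) :+ (c₁ :* c₂ :- κ 9 :* (c₀ :* c₃)) ⊜
          (κ 3 :* (c₀ :* (t :* t)) :+ κ 2 :* (c₁ :* t) :+ c₂) :* (κ 3 :* (c₀ :* t) :+ c₁) :- κ 9 :*
          (c₀ :* (c₀ :* (t :* t :* t) :+ c₁ :* (t :* t) :+ c₂ :* t :+ c₃))) c₀ c₁ c₂ c₃ t)
        H≡)

  root-square-∞ : ∀ π → Δ π ≢ 0# → lead π ≡ 0# → χ (HA π) ≡ square
  root-square-∞ (c₀ ∷ c₁ ∷ c₂ ∷ c₃ ∷ []) Δ≢0 refl = χ-square {r = c₁}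
    (λ e → Δ≢0 (lin 3 (λ c₁ c₂ c₃ → ((c₁ :* c₂ :- κ 9 :* (κ 0 :* c₃)) :* (c₁ :* c₂ :- κ 9 :* (κ 0 :* c₃)) :- κ 4 :*
      ((c₁ :* c₁ :- κ 3 :* (κ 0 :* c₂)) :* (c₂ :* c₂ :- κ 3 :* (c₁ :* c₃))) ⊜ κ 0) , (c₁ :* c₂ :* c₂ :- κ 4 :* c₁ :*
      (c₂ :* c₂ :- κ 3 :* (c₁ :* c₃)) ×[ c₁ ⊜ κ 0 ]) ∷ []) c₁ c₂ c₃ (e , _)))
    (ring 2 (λ c₁ c₂ → c₁ :* c₁ ⊜ c₁ :* c₁ :- κ 3 :* (κ 0 :* c₂)) c₁ c₂)

  module _ (π : Plane) (Δ≢0 : Δ π ≢ 0#) where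
    outside-square : #outside square π ℕ.+ #roots-plane π ≡ #form (HA π) (HB π) (HC π) square
    outside-square = outside+roots square π (is square (HA π)) (λ t → is square (H π t))
      (λ h → is⁺ (root-square-∞ π Δ≢0 (==⁻ h))) (λ t h → is⁺ (root-square π t Δ≢0 (==⁻ h))) refl refl

    outside-nonsquare : #outside nonsquare π ≡ #form (HA π) (HB π) (HC π) nonsquare
    outside-nonsquare = cong₂ ℕ._+_
      (ι-cong {not (lead π == 0#) ∧ is nonsquare (HA π)} (proj₂ ∘ T-∧⁻)
        (λ h → T-∧⁺ (T-not⁺ λ r → case trans (sym (root-square-∞ π Δ≢0 (==⁻ r))) (is⁻ h) of λ ()) h))
      (#-cong (λ h → proj₂ (T-∧⁻ h)) (λ {t} h → T-∧⁺ (T-not⁺ λ r → case trans (sym (root-square π t Δ≢0 (==⁻ r)))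
        (is⁻ h) of λ ()) h))

  module _ {π : Plane} (sh : Shape π) (Δ≡0 : Δ π ≡ 0#) where
    open Shape sh

    outside-square-null : #outside square π ℕ.+ #roots-plane π ≡ 1 ℕ.+ q
    outside-square-null = trans (outside+roots square π true (λ _ → true) _ _
      (ι-cong (λ h → let h = proj₁ (T-∧⁻ {not (lead π == 0#)} h) in T-∧⁺ h (is⁺ (null-∞ Δ≡0 (T-not⁻ h ∘ ==⁺))))
        (λ h → T-∧⁺ (proj₁ (T-∧⁻ {not (lead π == 0#)} h)) _))
      (#-cong (λ {t} h → let h = proj₁ (T-∧⁻ {not (cub π t == 0#)} h) in T-∧⁺ h
        (is⁺ (null-τ Δ≡0 t (T-not⁻ h ∘ ==⁺)))) (λ {t} h → T-∧⁺ (proj₁ (T-∧⁻ {not (cub π t == 0#)} h)) _)))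
      (cong suc (trans (#≡∑ (λ _ → true)) (∑-1 elems)))

    outside-nonsquare-null : #outside nonsquare π ≡ 0
    outside-nonsquare-null = cong₂ ℕ._+_
      (ι-cong {b = false} (λ h → let (a , b) = T-∧⁻ h in case trans (sym (null-∞ Δ≡0 (T-not⁻ a ∘ ==⁺))) (is⁻ b) of λ
        ()) λ ())
      (#-none (λ {t} h → let (a , b) = T-∧⁻ h in case trans (sym (null-τ Δ≡0 t (T-not⁻ a ∘ ==⁺))) (is⁻ b) of λ ()))

  private
    χ-3Δ : ∀ π → χ (- ofℕ 3 * Δ π) ≡ ε · χ (Δ π)
    χ-3Δ π = χ-* _ _

    ·-self-inverse : ∀ {e} c → e ≢ null → e · (e · c) ≡ c
    ·-self-inverse {null}      c         h = ⊥-elim (h refl)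
    ·-self-inverse {square}    c         h = refl
    ·-self-inverse {nonsquare} null      h = refl
    ·-self-inverse {nonsquare} square    h = refl
    ·-self-inverse {nonsquare} nonsquare h = refl

    χΔ : ∀ {c} π → χ (- ofℕ 3 * Δ π) ≡ c → χ (Δ π) ≡ ε · c
    χΔ {c} π e = trans (sym (·-self-inverse (χ (Δ π)) ε≢null)) (cong (ε ·_) (trans (sym (χ-3Δ π)) e))

    ·-≢null : ∀ {a b} → a ≢ null → b ≢ null → a · b ≢ null
    ·-≢null {null}                h _  = h
    ·-≢null {square}              _ h  = h
    ·-≢null {nonsquare} {null}    _ h  = h
    ·-≢null {nonsquare} {square}      _ _ ()
    ·-≢null {nonsquare} {nonsquare}   _ _ ()

  -- Since `c` is the class of the discriminant of the cubic, Δ has class `ε · c`. All roots are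
  -- points where the Hessian is a square, so they are taken off the square count only.
  outside-counts : ∀ {π c n} → χ (- ofℕ 3 * Δ π) ≡ c → #roots-plane π ≡ n → c ≢ null →
                   pos 2 ℤ.* pos (#outside nonsquare π) ≡ pos q ℤ.- sign (ε · c) ×
                   pos 2 ℤ.* pos (#outside square π) ≡ pos q ℤ.- sign (ε · c) ℤ.- pos 2 ℤ.* pos n
  outside-counts {π} {c} {n} e refl c≢ =
    trans (axes-through (ε · c) {m = #outside nonsquare π} {n = 0} εc≢ (trans (ℕP.+-identityʳ _)
      (trans (outside-nonsquare π Δ≢0) (#form-nonsquare {HA π} {HB π} {HC π} Δ≢0))) total) (drop-0 _) ,
    axes-through (ε · c) {m = #outside square π} {n = #roots-plane π} εc≢ (outside-square π Δ≢0) total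
    where
    εc≢ : ε · c ≢ null
    εc≢ = ·-≢null ε≢null c≢

    χΔ≡ : χ (Δ π) ≡ ε · c
    χΔ≡ = χΔ π e

    Δ≢0 : Δ π ≢ 0#
    Δ≢0 = χ≢null⁻ (εc≢ ∘ trans (sym χΔ≡))

    total : 2 ℕ.* #form (HA π) (HB π) (HC π) square ℕ.+ #roots (ε · c) ≡ q ℕ.+ 1
    total = subst (λ c → 2 ℕ.* #form (HA π) (HB π) (HC π) square ℕ.+ #roots c ≡ q ℕ.+ 1) χΔ≡
      (#form-square {HA π} {HB π} {HC π} Δ≢0)

    drop-0 : ∀ x → x ℤ.- pos 2 ℤ.* pos 0 ≡ x
    drop-0 x = ℤP.+-identityʳ x
      where import Data.Integer.Properties as ℤP

  Δ-null : ∀ {π} → χ (- ofℕ 3 * Δ π) ≡ null → Δ π ≡ 0#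
  Δ-null e = cancel-0 (-‿≢0 3≢0) (χ-null⁻ e)

  -- The pencil of cubics t³ + bt + c with b fixed

  module Pencil {b : Carrier} (b≢0 : b ≢ 0#) where
    #ν : ℕ → ℕ
    #ν k = # (λ c → ν b c ≡ᵇ k)

    private
      rc : ∀ c → RootCount (χ (disc b c)) (ν b c)
      rc c = rootCount b c (b≢0 ∘ proj₁)

      #disc : Class → ℕ
      #disc k = # (λ c → is k (disc b c))

      -- -4b/3, chosen so that the discriminant at c = bt/3 becomes -3b²(t² - d).
      d : Carrier
      d = - (ofℕ 4 * (b * ⅓))

      d≢0 : d ≢ 0#
      d≢0 = -‿≢0 (*-≢0 (λ e → *-≢0 2≢0 2≢0 (trans (ring 1 (λ b → κ 2 :* κ 2 ⊜ κ 4) b) e)) (*-≢0 b≢0 (⁻¹-≢0 3≢0)))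

    -- The class of `d`, which is -3b times the square of 2/3; so `#roots η` is the number of
    -- members of the pencil with a double root.
    η : Class
    η = χ (- ofℕ 3 * b)

    private
      χd≡η : χ d ≡ η
      χd≡η = trans (sym (χ-*-square (χ-square 3≢0 refl))) (trans (cong χ
        (lin 2 (λ b t → (κ 3 :* κ 3 :* :- (κ 4 :* (b :* t)) ⊜ κ 2 :* κ 2 :* (:- (κ 3) :* b)) ,
          (:- (κ 12) :* b ×[ κ 3 :* t ⊜ κ 1 ]) ∷ []) b ⅓ (⅓-inverse , _))) (χ-*-square (χ-square 2≢0 refl)))

      disc≡ : ∀ t → disc b (b * (⅓ * t)) ≡ b * b * (- ofℕ 3 * (t * t + - d))
      disc≡ t = lin 3 (λ b t h → (:- (κ 4 :* (b :* b :* b)) :- κ 27 :* (b :* (h :* t) :* (b :* (h :* t))) ⊜ b :* b :*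
        (:- (κ 3) :* (t :* t :- :- (κ 4 :* (b :* h))))) , (κ 4 :* b :* b :* b :- κ 3 :* b :* b :* t :* t :*
        (κ 3 :* h :+ κ 1) ×[ κ 3 :* h ⊜ κ 1 ]) ∷ []) b t ⅓ (⅓-inverse , _)

      #norm≡#disc : ∀ k → #norm d k ≡ #disc (ε · k)
      #norm≡#disc k = #-bij (λ t → b * (⅓ * t)) (λ c → ofℕ 3 * (b ⁻¹ * c))
        (λ t → (lin 4 (λ b t k i → (κ 3 :* (i :* (b :* (k :* t))) ⊜ t) , (i :* b :* t ×[ κ 3 :* k ⊜ κ 1 ]) ∷
          (t ×[ b :* i ⊜ κ 1 ]) ∷ []) b t ⅓ (b ⁻¹) (⅓-inverse , ⁻¹-inverse b≢0 , _)))
        (λ t → (lin 4 (λ b t k i → (b :* (k :* (κ 3 :* (i :* t))) ⊜ t) , (i :* b :* t ×[ κ 3 :* k ⊜ κ 1 ]) ∷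
          (t ×[ b :* i ⊜ κ 1 ]) ∷ []) b t ⅓ (b ⁻¹) (⅓-inverse , ⁻¹-inverse b≢0 , _)))
        (λ {t} h → is⁺ (trans (χ≡ t) (is⁻ (is-*⁺ {A = - ofℕ 3} refl k (t * t + - d) h))))
        (λ {t} h → is-*⁻ {A = - ofℕ 3} refl ε≢null k _ (is⁺ (trans (sym (χ≡ t)) (is⁻ h))))
        where
        χ≡ : ∀ t → χ (disc b (b * (⅓ * t))) ≡ χ (- ofℕ 3 * (t * t + - d))
        χ≡ t = trans (cong χ (disc≡ t)) (χ-*-square (χ-square b≢0 refl))

      #norm-sq : #roots η ℕ.+ 2 ℕ.* #norm d square ℕ.+ 1 ≡ q
      #norm-sq = subst (λ c → #roots c ℕ.+ 2 ℕ.* #norm d square ℕ.+ 1 ≡ q) χd≡η (#norm-square d≢0)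

      #ν1≡ : #ν 1 ≡ #disc nonsquare
      #ν1≡ = #-cong (λ {c} h → is⁺ (f (rc c) h)) (λ {c} h → g (rc c) (is⁻ h))
        where
        f : ∀ {k n} → RootCount k n → T (n ≡ᵇ 1) → k ≡ nonsquare
        f one _ = refl
        g : ∀ {k n} → RootCount k n → k ≡ nonsquare → T (n ≡ᵇ 1)
        g one _ = _

      #ν2≡ : #ν 2 ≡ #disc null
      #ν2≡ = #-cong (λ {c} h → is⁺ (f (rc c) h)) (λ {c} h → g (rc c) (is⁻ h))
        where
        f : ∀ {k n} → RootCount k n → T (n ≡ᵇ 2) → k ≡ null
        f double _ = refl
        g : ∀ {k n} → RootCount k n → k ≡ null → T (n ≡ᵇ 2)
        g double _ = _

      ∑-combine : ∀ (f g h : Carrier → ℕ) → ∑ elems (λ c → f c ℕ.+ g c ℕ.+ h c)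
        ≡ ∑ elems f ℕ.+ ∑ elems g ℕ.+ ∑ elems h
      ∑-combine f g h = trans (∑-+ _ _ elems) (cong (ℕ._+ ∑ elems h) (∑-+ _ _ elems))

      i : ℕ → Carrier → ℕ
      i k c = ι (ν b c ≡ᵇ k)

      #ν≡∑ : ∀ k → #ν k ≡ ∑ elems (i k)
      #ν≡∑ k = #≡∑ (λ c → ν b c ≡ᵇ k)

    #ν-total : #ν 0 ℕ.+ #ν 1 ℕ.+ #ν 2 ℕ.+ #ν 3 ≡ q
    #ν-total = begin
      #ν 0 ℕ.+ #ν 1 ℕ.+ #ν 2 ℕ.+ #ν 3 ≡⟨ cong₂ ℕ._+_ (cong₂ ℕ._+_ (cong₂ ℕ._+_ (#ν≡∑ 0) (#ν≡∑ 1)) (#ν≡∑ 2)) (#ν≡∑ 3) ⟩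
      ∑ elems (i 0) ℕ.+ ∑ elems (i 1) ℕ.+ ∑ elems (i 2) ℕ.+ ∑ elems (i 3) ≡⟨ cong (ℕ._+ ∑ elems (i 3))
        (∑-combine (i 0) (i 1) (i 2)) ⟨
      ∑ elems (λ c → i 0 c ℕ.+ i 1 c ℕ.+ i 2 c) ℕ.+ ∑ elems (i 3)                      ≡⟨ ∑-+ _ _ elems ⟨
      ∑ elems (λ c → i 0 c ℕ.+ i 1 c ℕ.+ i 2 c ℕ.+ i 3 c) ≡⟨ ∑-cong elems (λ c _ → f (rc c)) ⟩
      ∑ elems (λ _ → 1)                                                                ≡⟨ ∑-1 elems ⟩
      q                                                                                ∎
      where
      f : ∀ {k n} → RootCount k n → ι (n ≡ᵇ 0) ℕ.+ ι (n ≡ᵇ 1) ℕ.+ ι (n ≡ᵇ 2) ℕ.+ ι (n ≡ᵇ 3) ≡ 1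
      f double = refl
      f zero   = refl
      f three  = refl
      f one    = refl

    -- Each t is a root of exactly one member of the pencil, the one with c = -(t³ + bt).
    #ν-weighted : #ν 1 ℕ.+ 2 ℕ.* #ν 2 ℕ.+ 3 ℕ.* #ν 3 ≡ q
    #ν-weighted = begin
      #ν 1 ℕ.+ 2 ℕ.* #ν 2 ℕ.+ 3 ℕ.* #ν 3 ≡⟨ cong₂ ℕ._+_ (cong₂ ℕ._+_ (#ν≡∑ 1) (cong (2 ℕ.*_) (#ν≡∑ 2)))
        (cong (3 ℕ.*_) (#ν≡∑ 3)) ⟩
      ∑ elems (i 1) ℕ.+ 2 ℕ.* ∑ elems (i 2) ℕ.+ 3 ℕ.* ∑ elems (i 3) ≡⟨ cong₂ (λ x y → ∑ elems (i 1) ℕ.+ x ℕ.+ y)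
        (∑-* 2 (i 2) elems) (∑-* 3 (i 3) elems) ⟨
      ∑ elems (i 1) ℕ.+ ∑ elems (λ c → 2 ℕ.* i 2 c) ℕ.+ ∑ elems (λ c → 3 ℕ.* i 3 c) ≡⟨ ∑-combine (i 1)
        (λ c → 2 ℕ.* i 2 c) (λ c → 3 ℕ.* i 3 c) ⟨
      ∑ elems (λ c → i 1 c ℕ.+ 2 ℕ.* i 2 c ℕ.+ 3 ℕ.* i 3 c) ≡⟨ ∑-cong elems (λ c _ → trans (ν≡fibre c) (f (rc c))) ⟨
      ∑ elems (λ c → # (λ t → g t == c)) ≡⟨ ∑-fibres _≟_ elems-unique g elems (λ _ → elems-complete _) ⟩
      q                                                                                        ∎
      where
      g : Carrier → Carrier
      g t = - (t * t * t + b * t)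

      ν≡fibre : ∀ c → # (λ t → g t == c) ≡ ν b c
      ν≡fibre c = #-cong
        (λ {t} h → ==⁺ (lin 3 (λ b c t → (t :* t :* t :+ b :* t :+ c ⊜ κ 0) ,
          (:- (κ 1) ×[ :- (t :* t :* t :+ b :* t) ⊜ c ]) ∷ []) b c t (==⁻ h , _)))
        (λ {t} h → ==⁺ (lin 3 (λ b c t → (:- (t :* t :* t :+ b :* t) ⊜ c) ,
          (:- (κ 1) ×[ t :* t :* t :+ b :* t :+ c ⊜ κ 0 ]) ∷ []) b c t (==⁻ h , _)))

      f : ∀ {k n} → RootCount k n → n ≡ ι (n ≡ᵇ 1) ℕ.+ 2 ℕ.* ι (n ≡ᵇ 2) ℕ.+ 3 ℕ.* ι (n ≡ᵇ 3)
      f double = refl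
      f zero   = refl
      f three  = refl
      f one    = refl

    #ν2 : #ν 2 ≡ #roots η
    #ν2 = trans #ν2≡ (trans (cong #disc (sym (ε·null ε))) (trans (sym (#norm≡#disc null))
      (trans (#norm-null d) (cong #roots χd≡η))))
      where
      ε·null : ∀ e → e · null ≡ null
      ε·null null      = refl
      ε·null square    = refl
      ε·null nonsquare = refl

    #ν1 : pos 2 ℤ.* pos (#ν 1) ≡ pos q ℤ.+ sign ε ℤ.- pos (#roots η)
    #ν1 = by-class ε refl
      where
      by-class : ∀ e → ε ≡ e → pos 2 ℤ.* pos (#ν 1) ≡ pos q ℤ.+ sign e ℤ.- pos (#roots η)
      by-class null e = ⊥-elim (ε≢null e)
      by-class square e = simple-roots-square {r = #roots η} {s = #norm d square} #norm-sq
        (trans #ν1≡ (trans (cong (λ e → #disc (e · nonsquare)) (sym e)) (trans (sym (#norm≡#disc nonsquare))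
          (#norm-nonsquare d≢0))))
      by-class nonsquare e = simple-roots-nonsquare {r = #roots η} {s = #norm d square} #norm-sq
        (trans #ν1≡ (trans (cong (λ e → #disc (e · square)) (sym e)) (sym (#norm≡#disc square))))

    #ν3 : pos 6 ℤ.* pos (#ν 3) ≡ pos q ℤ.- sign ε ℤ.- pos 3 ℤ.* pos (#roots η)
    #ν3 = triple-roots {e = sign ε} {n₁ = #ν 1} {n₂ = #ν 2} {n₃ = #ν 3} #ν-weighted #ν2 #ν1

    #ν0 : pos 3 ℤ.* pos (#ν 0) ≡ pos q ℤ.- sign ε
    #ν0 = no-roots {e = sign ε} {n₀ = #ν 0} {n₁ = #ν 1} {n₂ = #ν 2} {n₃ = #ν 3} #ν-total #ν-weighted #ν2 #ν1

-- Normalised points, spans and lines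

module ProjectiveLines (F : FiniteField) (2≢0 : PG.ofℕ F 2 ≢ FiniteField.0# F)
  (3≢0 : PG.ofℕ F 3 ≢ FiniteField.0# F) where
  open HessianCounts F 2≢0 3≢0 public
  open ≡-Reasoning

  𝟎 : ∀ {n} → Vec Carrier n
  𝟎 = V.replicate _ 0#

  private variable
    n : ℕ

  comb : Carrier → Vec Carrier n → Carrier → Vec Carrier n → Vec Carrier n
  comb a u b v = scale a u ⊕ scale b v

  scale-comb : ∀ k a (u : Vec Carrier n) b v → scale k (comb a u b v) ≡ comb (k * a) u (k * b) v
  scale-comb k a []      b []      = refl
  scale-comb k a (x ∷ u) b (y ∷ v) = cong₂ _∷_
    (ring 5 (λ k a b x y → k :* (a :* x :+ b :* y) ⊜ k :* a :* x :+ k :* b :* y) k a b x y) (scale-comb k a u b v)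

  comb-comb : ∀ a b a₁ b₁ a₂ b₂ (u v : Vec Carrier n) →
              comb a (comb a₁ u b₁ v) b (comb a₂ u b₂ v) ≡ comb (a * a₁ + b * a₂) u (a * b₁ + b * b₂) v
  comb-comb a b a₁ b₁ a₂ b₂ []      []      = refl
  comb-comb a b a₁ b₁ a₂ b₂ (x ∷ u) (y ∷ v) = cong₂ _∷_
    (ring 8 (λ a b a₁ b₁ a₂ b₂ x y → a :* (a₁ :* x :+ b₁ :* y) :+ b :* (a₂ :* x :+ b₂ :* y) ⊜
      (a :* a₁ :+ b :* a₂) :* x :+ (a :* b₁ :+ b :* b₂) :* y) a b a₁ b₁ a₂ b₂ x y)
    (comb-comb a b a₁ b₁ a₂ b₂ u v)

  comb-0ʳ : ∀ a (u v : Vec Carrier n) → comb a u 0# v ≡ scale a u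
  comb-0ʳ a []      []      = refl
  comb-0ʳ a (x ∷ u) (y ∷ v) = cong₂ _∷_ (ring 3 (λ a x y → a :* x :+ κ 0 :* y ⊜ a :* x) a x y) (comb-0ʳ a u v)

  comb-0ˡ : ∀ b (u v : Vec Carrier n) → comb 0# u b v ≡ scale b v
  comb-0ˡ b []      []      = refl
  comb-0ˡ b (x ∷ u) (y ∷ v) = cong₂ _∷_ (ring 3 (λ b x y → κ 0 :* x :+ b :* y ⊜ b :* y) b x y) (comb-0ˡ b u v)

  scale-scale : ∀ a b (u : Vec Carrier n) → scale a (scale b u) ≡ scale (a * b) u
  scale-scale a b []      = refl
  scale-scale a b (x ∷ u) = cong₂ _∷_ (sym (*-assoc a b x)) (scale-scale a b u)

  scale-1 : ∀ (u : Vec Carrier n) → scale 1# u ≡ u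
  scale-1 []      = refl
  scale-1 (x ∷ u) = cong₂ _∷_ (*-identityˡ x) (scale-1 u)

  scale-𝟎 : ∀ a → scale {n} a 𝟎 ≡ 𝟎
  scale-𝟎 {zero}  a = refl
  scale-𝟎 {suc n} a = cong₂ _∷_ (zeroʳ a) (scale-𝟎 a)

  0-scale : ∀ (u : Vec Carrier n) → scale 0# u ≡ 𝟎
  0-scale []      = refl
  0-scale (x ∷ u) = cong₂ _∷_ (zeroˡ x) (0-scale u)

  scale-≢𝟎 : ∀ {a} {u : Vec Carrier n} → a ≢ 0# → u ≢ 𝟎 → scale a u ≢ 𝟎
  scale-≢𝟎 {a = a} {u} a≢0 u≢0 e = u≢0 (begin
    u                       ≡⟨ scale-1 u ⟨
    scale 1# u              ≡⟨ cong (λ c → scale c u) (trans (*-comm _ a) (⁻¹-inverse a≢0)) ⟨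
    scale (a ⁻¹ * a) u      ≡⟨ scale-scale _ a u ⟨
    scale (a ⁻¹) (scale a u) ≡⟨ cong (scale (a ⁻¹)) e ⟩
    scale (a ⁻¹) 𝟎          ≡⟨ scale-𝟎 _ ⟩
    𝟎                       ∎)

  unscale : ∀ {a} {u v : Vec Carrier n} → a ≢ 0# → u ≡ scale a v → v ≡ scale (a ⁻¹) u
  unscale {a = a} {u} {v} a≢0 e = begin
    v                        ≡⟨ scale-1 v ⟨
    scale 1# v               ≡⟨ cong (λ c → scale c v) (trans (*-comm _ a) (⁻¹-inverse a≢0)) ⟨
    scale (a ⁻¹ * a) v       ≡⟨ scale-scale _ a v ⟨
    scale (a ⁻¹) (scale a v) ≡⟨ cong (scale (a ⁻¹)) e ⟨
    scale (a ⁻¹) u           ∎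

  dot-comb : ∀ (π : Vec Carrier n) a u b v → dot π (comb a u b v) ≡ a * dot π u + b * dot π v
  dot-comb []      a []      b []      = ring 2 (λ a b → κ 0 ⊜ a :* κ 0 :+ b :* κ 0) a b
  dot-comb (c ∷ π) a (x ∷ u) b (y ∷ v) = trans (cong (c * (a * x + b * y) +_) (dot-comb π a u b v))
    (ring 7 (λ c a x b y p r → c :* (a :* x :+ b :* y) :+ (a :* p :+ b :* r) ⊜ a :* (c :* x :+ p) :+ b :*
      (c :* y :+ r)) c a x b y (dot π u) (dot π v))

  dot-scale : ∀ (π : Vec Carrier n) a u → dot π (scale a u) ≡ a * dot π u
  dot-scale π a u = trans (cong (dot π) (sym (comb-0ʳ a u u)))
    (trans (dot-comb π a u 0# u) (ring 2 (λ a p → a :* p :+ κ 0 :* p ⊜ a :* p) a (dot π u)))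

  scale-dot : ∀ a (π u : Vec Carrier n) → dot (scale a π) u ≡ a * dot π u
  scale-dot a []      []      = sym (zeroʳ a)
  scale-dot a (c ∷ π) (x ∷ u) = trans (cong (a * c * x +_) (scale-dot a π u))
    (ring 4 (λ a c x p → a :* c :* x :+ a :* p ⊜ a :* (c :* x :+ p)) a c x (dot π u))

  normalised≢𝟎 : ∀ {u : Vec Carrier n} → T (normalised u) → u ≢ 𝟎
  normalised≢𝟎 {u = x ∷ u} t e with x ≟ 0#
  ... | yes _  = normalised≢𝟎 t (VP.∷-injectiveʳ e)
  ... | no x≢0 = x≢0 (VP.∷-injectiveˡ e)

  normalised-unique : ∀ {u v : Vec Carrier n} {a} → T (normalised u) → T (normalised v) → u ≡ scale a v → u ≡ v
  normalised-unique {u = x ∷ u} {y ∷ v} {a} tu tv e with x ≟ 0# | y ≟ 0#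
  ... | yes x≡0 | yes y≡0 = cong₂ _∷_ (trans x≡0 (sym y≡0)) (normalised-unique tu tv (VP.∷-injectiveʳ e))
  ... | yes refl | no _   = ⊥-elim (normalised≢𝟎 tu (trans (VP.∷-injectiveʳ e)
      (trans (cong (λ c → scale c v) (trans (sym (*-identityʳ a)) (trans (cong (a *_) (sym (==⁻ tv)))
        (sym (VP.∷-injectiveˡ e))))) (0-scale v))))
  ... | no x≢0  | yes refl = ⊥-elim (x≢0 (trans (VP.∷-injectiveˡ e) (zeroʳ a)))
  ... | no _    | no _   = trans e (trans (cong (λ c → scale c (y ∷ v)) a≡1) (scale-1 _))
    where
    a≡1 : a ≡ 1#
    a≡1 = trans (sym (*-identityʳ a)) (trans (cong (a *_) (sym (==⁻ tv))) (trans (sym (VP.∷-injectiveˡ e)) (==⁻ tu)))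

  normalise : ∀ (u : Vec Carrier n) → u ≢ 𝟎 → ∃ λ a → a ≢ 0# × T (normalised (scale a u))
  normalise []      u≢0 = ⊥-elim (u≢0 refl)
  normalise (x ∷ u) u≢0 = case x ≟ 0# of λ
    { (yes refl) → let (a , a≢0 , t) = normalise u (λ { refl → u≢0 refl }) in a , a≢0 , skip a t
    ; (no x≢0)   → x ⁻¹ , ⁻¹-≢0 x≢0 , stop x≢0 }
    where
    skip : ∀ a → T (normalised (scale a u)) → T (normalised (a * 0# ∷ scale a u))
    skip a t with a * 0# ≟ 0#
    ... | yes _ = t
    ... | no h  = ⊥-elim (h (zeroʳ a))

    stop : x ≢ 0# → T (normalised (x ⁻¹ * x ∷ scale (x ⁻¹) u))
    stop x≢0 with x ⁻¹ * x ≟ 0#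
    ... | yes e = ⊥-elim (*-≢0 (⁻¹-≢0 x≢0) x≢0 e)
    ... | no _  = ==⁺ (trans (*-comm _ x) (⁻¹-inverse x≢0))

  _≟ᵛ_ : DecidableEquality Vec4
  _≟ᵛ_ = VP.≡-dec _≟_

  allVec4-complete : ∀ v → v ∈ allVec4
  allVec4-complete = allVecs-complete elems-complete

  points-unique : Unique points
  points-unique = filterᵇ-unique (allVecs-unique elems-unique 4)

  ∈-points : ∀ {v} → T (normalised v) → v ∈ points
  ∈-points {v} = ∈-filterᵇ⁺ (allVec4-complete v)

  points-normalised : ∀ {v} → v ∈ points → T (normalised v)
  points-normalised = proj₂ ∘ ∈-filterᵇ⁻ allVec4

  record Representative (u : Vec4) : Set where
    constructor representative
    field
      {factor}   : Carrier
      factor≢0   : factor ≢ 0#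
      normalisedʳ : T (normalised (scale factor u))

    vector : Vec4
    vector = scale factor u

  rep : ∀ {u} → u ≢ 𝟎 → Representative u
  rep {u} u≢0 = let (_ , a≢0 , t) = normalise u u≢0 in representative a≢0 t

  InSpan : Vec4 → Vec4 → Vec4 → Set
  InSpan u v w = ∃ λ a → ∃ λ b → w ≡ comb a u b v

  span-comb : ∀ {u v w₁ w₂} a b → InSpan u v w₁ → InSpan u v w₂ → InSpan u v (comb a w₁ b w₂)
  span-comb a b (a₁ , b₁ , refl) (a₂ , b₂ , refl) = _ , _ , comb-comb a b a₁ b₁ a₂ b₂ _ _

  span-trans : ∀ {u v u′ v′ w} → InSpan u v u′ → InSpan u v v′ → InSpan u′ v′ w → InSpan u v w
  span-trans s₁ s₂ (a , b , refl) = span-comb a b s₁ s₂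

  span-scale : ∀ {u v w} k → InSpan u v w → InSpan u v (scale k w)
  span-scale k (a , b , refl) = _ , _ , scale-comb k a _ b _

  span-left : ∀ u v → InSpan u v u
  span-left u v = 1# , 0# , sym (trans (comb-0ʳ 1# u v) (scale-1 u))

  span-right : ∀ u v → InSpan u v v
  span-right u v = 0# , 1# , sym (trans (comb-0ˡ 1# u v) (scale-1 v))

  span-unscale : ∀ {u v k} → k ≢ 0# → ∀ {w} → InSpan u v (scale k w) → InSpan u v w
  span-unscale k≢0 {w} s = subst (InSpan _ _) (sym (unscale k≢0 refl)) (span-scale _ s)

  onSpan⁻ : ∀ {u v w} → T (onSpan u v w) → InSpan u v w
  onSpan⁻ {u} {v} t =
    let (a , _ , t₁) = any-T elems t
        (b , _ , t₂) = any-T elems t₁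
        (k , _ , e)  = proportional⁻ t₂
    in k * a , k * b , trans e (scale-comb k a u b v)

  onSpan⁺ : ∀ {u v w} → InSpan u v w → T (onSpan u v w)
  onSpan⁺ {u} {v} {w} (a , b , e) = T-any {p = λ a → any (λ b → proportional w (comb a u b v)) elems}
    (elems-complete a)
    (T-any {p = λ b → proportional w (comb a u b v)} (elems-complete b)
      (proportional⁺ 1# 1≢0 (trans e (sym (scale-1 _)))))

  ∈-line⁺ : ∀ {u v w} → w ∈ points → InSpan u v w → w ∈ lineThrough u v
  ∈-line⁺ w∈ s = ∈-filterᵇ⁺ w∈ (onSpan⁺ s)

  ∈-line⁻ : ∀ {u v w} → w ∈ lineThrough u v → w ∈ points × InSpan u v w
  ∈-line⁻ w∈ = let (w∈p , t) = ∈-filterᵇ⁻ points w∈ in w∈p , onSpan⁻ t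

  -- A line is the sublist of the fixed list `points` cut out by membership in a span, so equal
  -- spans give equal lists, in the same order.
  line-cong : ∀ {u v u′ v′} → InSpan u′ v′ u → InSpan u′ v′ v → InSpan u v u′ → InSpan u v v′ →
              lineThrough u v ≡ lineThrough u′ v′
  line-cong {u} {v} {u′} {v′} s₁ s₂ s₃ s₄ = filterᵇ-cong {xs = points} {p = onSpan u v} {r = onSpan u′ v′}
    (λ w _ → (λ t → onSpan⁺ (span-trans s₁ s₂ (onSpan⁻ t))) , (λ t → onSpan⁺ (span-trans s₃ s₄ (onSpan⁻ t))))

  line-scale : ∀ {a b} u v → a ≢ 0# → b ≢ 0# → lineThrough (scale a u) (scale b v) ≡ lineThrough u v
  line-scale u v a≢0 b≢0 = line-cong (span-scale _ (span-left u v)) (span-scale _ (span-right u v))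
    (span-unscale a≢0 (span-left _ _)) (span-unscale b≢0 (span-right _ _))

  line-≡⇒span : ∀ {u v u′ v′ w} → lineThrough u v ≡ lineThrough u′ v′ → InSpan u v w → InSpan u′ v′ w
  line-≡⇒span {u} {v} {u′} {v′} {w} e s = case w ≟ᵛ 𝟎 of λ
    { (yes refl) → 0# , 0# , sym (trans (comb-0ˡ 0# u′ v′) (0-scale v′))
    ; (no w≢0)   → let open Representative (rep w≢0) in
                   span-unscale factor≢0 (proj₂ (∈-line⁻ (subst (vector ∈_) e (∈-line⁺ (∈-points normalisedʳ)
                     (span-scale factor s))))) }

  Independent : Vec4 → Vec4 → Set
  Independent u v = ∀ a b → comb a u b v ≡ 𝟎 → a ≡ 0# × b ≡ 0#

  independent-left : ∀ {u v} → Independent u v → u ≢ 𝟎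
  independent-left {u} {v} ind refl = 1≢0 (proj₁ (ind 1# 0# (trans (comb-0ʳ 1# u v) (scale-𝟎 1#))))

  independent-right : ∀ {u v} → Independent u v → v ≢ 𝟎
  independent-right {u} {v} ind refl = 1≢0 (proj₂ (ind 0# 1# (trans (comb-0ˡ 1# u v) (scale-𝟎 1#))))

  comb-𝟎⇒ : ∀ {a b} (u v : Vec Carrier n) → comb a u b v ≡ 𝟎 → scale a u ≡ scale (- b) v
  comb-𝟎⇒ []      []      e = refl
  comb-𝟎⇒ {a = a} {b} (x ∷ u) (y ∷ v) e = cong₂ _∷_
    (lin 4 (λ a b x y → (a :* x ⊜ :- b :* y) , (κ 1 ×[ a :* x :+ b :* y ⊜ κ 0 ]) ∷ []) a b x y
      (VP.∷-injectiveˡ e , _)) (comb-𝟎⇒ u v (VP.∷-injectiveʳ e))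

  points-independent : ∀ {u v} → u ∈ points → v ∈ points → u ≢ v → Independent u v
  points-independent {u} {v} u∈ v∈ u≢v a b e = case a ≟ 0# of λ
    { (no a≢0) → ⊥-elim (u≢v (normalised-unique (points-normalised u∈) (points-normalised v∈)
        (trans (unscale a≢0 (sym (comb-𝟎⇒ u v e))) (scale-scale _ _ v))))
    ; (yes refl) → refl , (case b ≟ 0# of λ
        { (yes b≡0) → b≡0
        ; (no b≢0) → ⊥-elim (scale-≢𝟎 b≢0 (normalised≢𝟎 (points-normalised v∈)) (trans (sym (comb-0ˡ b u v)) e)) }) }

  _≟ˡ_ : DecidableEquality Line
  _≟ˡ_ = LP.≡-dec (VP.≡-dec _≟_)

  lines-unique : Unique lines
  lines-unique = DecUnique.deduplicate-! _≟ˡ_ _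

  private
    linesFrom : Point → List Line
    linesFrom P = map (lineThrough P) (filterᵇ (λ Q → not (P =v Q)) points)

  -- Normalising the two vectors does not change the line, and independence makes their
  -- representatives distinct points, as `lines` requires.
  ∈-lines⁺ : ∀ {u v} → Independent u v → lineThrough u v ∈ lines
  ∈-lines⁺ {u} {v} ind = ∈-deduplicate⁺ _≟ˡ_ (∈-concatMap⁺ linesFrom (lose (∈-points U′.normalisedʳ)
    (subst (_∈ linesFrom U′.vector) (line-scale u v U′.factor≢0 V′.factor≢0)
      (∈-map⁺ (lineThrough U′.vector) (∈-filterᵇ⁺ {p = λ Q → not (U′.vector =v Q)} (∈-points V′.normalisedʳ)
        (T-not⁺ (U≢V ∘ toWitness)))))))
    where
    module U′ = Representative (rep (independent-left ind))
    module V′ = Representative (rep (independent-right ind))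
    U≢V : U′.vector ≢ V′.vector
    U≢V e = U′.factor≢0 (proj₁ (ind U′.factor (- V′.factor) (cancels (sym e))))
      where
      cancels : ∀ {n} {u v : Vec Carrier n} {a b} → scale b v ≡ scale a u → comb a u (- b) v ≡ 𝟎
      cancels {u = []}    {[]}    e = refl
      cancels {u = x ∷ u} {y ∷ v} {a} {b} e = cong₂ _∷_
        (lin 4 (λ a b x y → (a :* x :+ :- b :* y ⊜ κ 0) , (:- (κ 1) ×[ b :* y ⊜ a :* x ]) ∷ []) a b x y
          (VP.∷-injectiveˡ e , _)) (cancels (VP.∷-injectiveʳ e))

  ∈-lines⁻ : ∀ {ℓ} → ℓ ∈ lines → ∃ λ u → ∃ λ v → Independent u v × ℓ ≡ lineThrough u v
  ∈-lines⁻ ℓ∈ =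
    let (u , u∈ , ℓ∈u) = find (∈-concatMap⁻ linesFrom (∈-deduplicate⁻ _≟ˡ_ _ ℓ∈))
        (v , v∈ , e)   = ∈-map⁻ (lineThrough u) ℓ∈u
        (v∈p , u≢v)    = ∈-filterᵇ⁻ {p = λ Q → not (u =v Q)} points v∈
    in u , v , points-independent u∈ v∈p (λ u≡v → T-not⁻ u≢v (fromWitness u≡v)) , e

  containsLine⁺ : ∀ {π u v} → dot π u ≡ 0# → dot π v ≡ 0# → T (containsLine π (lineThrough u v))
  containsLine⁺ {π} {u} {v} eu ev = T-all {p = incident π} (λ w w∈ → on (proj₂ (∈-line⁻ w∈)))
    where
    on : ∀ {w} → InSpan u v w → T (incident π w)
    on (a , b , refl) = ==⁺ (trans (dot-comb π a u b v)
      (lin 4 (λ a b p r → (a :* p :+ b :* r ⊜ κ 0) , (a ×[ p ⊜ κ 0 ]) ∷ (b ×[ r ⊜ κ 0 ]) ∷ []) a b (dot π u)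
        (dot π v) (eu , ev , _)))

  containsLine⁻ : ∀ {π u v w} → T (containsLine π (lineThrough u v)) → InSpan u v w → dot π w ≡ 0#
  containsLine⁻ {π} {u} {v} {w} t s = case w ≟ᵛ 𝟎 of λ
    { (yes refl) → trans (cong (dot π) (sym (0-scale 𝟎))) (trans (dot-scale π 0# 𝟎) (zeroˡ _))
    ; (no w≢0) → let open Representative (rep w≢0) in
        cancel-0 factor≢0 (trans (sym (dot-scale π factor w))
          (==⁻ (all-T {p = incident π} (lineThrough u v) t (∈-line⁺ (∈-points normalisedʳ) (span-scale factor s))))) }

  record Linear (f : Vec4 → Vec4) : Set where
    field
      f-comb : ∀ a u b v → f (comb a u b v) ≡ comb a (f u) b (f v)

    f-scale : ∀ a u → f (scale a u) ≡ scale a (f u)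
    f-scale a u = trans (cong f (sym (comb-0ʳ a u u))) (trans (f-comb a u 0# u) (comb-0ʳ a (f u) (f u)))

    f-𝟎 : f 𝟎 ≡ 𝟎
    f-𝟎 = trans (cong f (sym (0-scale 𝟎))) (trans (f-scale 0# 𝟎) (0-scale (f 𝟎)))

    f-span : ∀ {u v w} → InSpan u v w → InSpan (f u) (f v) (f w)
    f-span (a , b , refl) = a , b , f-comb a _ b _

    f-line-cong : ∀ {u v u′ v′} → InSpan u′ v′ u → InSpan u′ v′ v → InSpan u v u′ → InSpan u v v′ →
                  lineThrough (f u) (f v) ≡ lineThrough (f u′) (f v′)
    f-line-cong s₁ s₂ s₃ s₄ = line-cong (f-span s₁) (f-span s₂) (f-span s₃) (f-span s₄)

  apply-comb : ∀ {m} (M : Vec Vec4 m) a u b v →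
               V.map (λ row → dot row (comb a u b v)) M ≡ comb a (V.map (λ row → dot row u) M) b
                 (V.map (λ row → dot row v) M)
  apply-comb []        a u b v = refl
  apply-comb (row ∷ M) a u b v = cong₂ _∷_ (dot-comb row a u b v) (apply-comb M a u b v)

  apply-linear : ∀ M → Linear (apply M)
  apply-linear M = record { f-comb = apply-comb M }

  imageLine-span : ∀ M u v → imageLine M (lineThrough u v) ≡ lineThrough (apply M u) (apply M v)
  imageLine-span M u v = filterᵇ-cong {xs = points} {p = λ R → any (λ X → proportional R (apply M X))
    (lineThrough u v)}
    {r = onSpan (apply M u) (apply M v)} (λ w w∈ → to w , from w w∈)
    where
    open Linear (apply-linear M)

    to : ∀ w → T (any (λ X → proportional w (apply M X)) (lineThrough u v)) → T (onSpan (apply M u) (apply M v) w)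
    to w t = let (X , X∈ , p) = any-T {p = λ X → proportional w (apply M X)} (lineThrough u v) t
                 (k , _ , e) = proportional⁻ p
             in onSpan⁺ (subst (InSpan _ _) (sym e) (span-scale k (f-span (proj₂ (∈-line⁻ X∈)))))

    from : ∀ w → w ∈ points → T (onSpan (apply M u) (apply M v) w) → T (any (λ X → proportional w (apply M X))
      (lineThrough u v))
    from w w∈ t = let (a , b , e) = onSpan⁻ {apply M u} {apply M v} t in preimage a b (trans e (sym (f-comb a u b v)))
      where
      preimage : ∀ a b → w ≡ apply M (comb a u b v) →
                 T (any (λ X → proportional w (apply M X)) (lineThrough u v))
      preimage a b e = T-any {p = λ X → proportional w (apply M X)} (∈-line⁺ (∈-points X.normalisedʳ)
        (span-scale X.factor (a , b , refl)))
        (proportional⁺ (X.factor ⁻¹) (⁻¹-≢0 X.factor≢0)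
          (unscale X.factor≢0 (trans (f-scale X.factor Y) (cong (scale X.factor) (sym e)))))
        where
        Y = comb a u b v
        Y≢0 : Y ≢ 𝟎
        Y≢0 Y≡0 = normalised≢𝟎 (points-normalised w∈) (trans e (trans (cong (apply M) Y≡0) f-𝟎))
        module X = Representative (rep Y≢0)

-- Möbius maps acting on the twisted cubic

module CubicGroup (F : FiniteField) (2≢0 : PG.ofℕ F 2 ≢ FiniteField.0# F) (3≢0 : PG.ofℕ F 3 ≢ FiniteField.0# F) where
  open ProjectiveLines F 2≢0 3≢0 public
  open ≡-Reasoning

  -- The projective line of parameters, with `nothing` for ∞.
  PG₁ : Set
  PG₁ = Maybe Carrier

  PG₁-elems : List PG₁
  PG₁-elems = nothing ∷ map just elems

  PG₁-complete : ∀ τ → τ ∈ PG₁-elems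
  PG₁-complete nothing  = here refl
  PG₁-complete (just t) = there (∈-map⁺ just (elems-complete t))

  PG₁-unique : Unique PG₁-elems
  PG₁-unique = ¬Any⇒All¬ _ (λ h → case ∈-map⁻ just h of λ { (_ , _ , ()) }) ∷ Unique.map⁺ just-injective elems-unique

  pt : PG₁ → Point
  pt nothing  = P∞
  pt (just t) = P t

  oscₚ : PG₁ → Plane
  oscₚ nothing  = osc∞
  oscₚ (just t) = osc t

  curve≡ : curve ≡ map pt PG₁-elems
  curve≡ = cong (P∞ ∷_) (LP.map-∘ elems)

  ∈-curve⁻ : ∀ {X} → X ∈ curve → ∃ λ τ → X ≡ pt τ
  ∈-curve⁻ {X} X∈ = let (τ , _ , e) = ∈-map⁻ pt {xs = PG₁-elems} (subst (X ∈_) curve≡ X∈) in τ , e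

  ∈-curve⁺ : ∀ τ → pt τ ∈ curve
  ∈-curve⁺ τ = subst (pt τ ∈_) (sym curve≡) (∈-map⁺ pt (PG₁-complete τ))

  _∝_ : ∀ {n} → Vec Carrier n → Vec Carrier n → Set
  u ∝ v = ∃ λ a → a ≢ 0# × u ≡ scale a v

  ∝-refl : ∀ {n} {u : Vec Carrier n} → u ∝ u
  ∝-refl = 1# , 1≢0 , sym (scale-1 _)

  ∝-sym : ∀ {n} {u v : Vec Carrier n} → u ∝ v → v ∝ u
  ∝-sym (a , a≢0 , e) = a ⁻¹ , ⁻¹-≢0 a≢0 , unscale a≢0 e

  ∝-trans : ∀ {n} {u v w : Vec Carrier n} → u ∝ v → v ∝ w → u ∝ w
  ∝-trans (a , a≢0 , refl) (b , b≢0 , refl) = a * b , *-≢0 a≢0 b≢0 , scale-scale a b _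

  onCurve⁻ : ∀ {X} → T (onCurve X) → ∃ λ τ → X ∝ pt τ
  onCurve⁻ {X} t = let (Y , Y∈ , p) = any-T {p = proportional X} curve t
                       (τ , Y≡) = ∈-curve⁻ Y∈
                   in τ , subst (X ∝_) Y≡ (proportional⁻ p)

  onCurve⁺ : ∀ {X} τ → X ∝ pt τ → T (onCurve X)
  onCurve⁺ {X} τ (a , a≢0 , e) = T-any {p = proportional X} (∈-curve⁺ τ) (proportional⁺ a a≢0 e)

  isΓ-osc⁻ : ∀ {π} → T (isΓPlane π) → ∃ λ τ → π ∝ oscₚ τ
  isΓ-osc⁻ t = case isΓ⁻ t of λ { (inj₁ p) → nothing , p ; (inj₂ (τ , p)) → just τ , p }

  isΓ-osc⁺ : ∀ {π} τ → π ∝ oscₚ τ → T (isΓPlane π)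
  isΓ-osc⁺ nothing  (a , a≢0 , e) = isΓ∞⁺ a a≢0 e
  isΓ-osc⁺ (just t) (a , a≢0 , e) = isΓ⁺ t a a≢0 e

  -- A linear automorphism together with its action on the parameters, both of points of the cubic
  -- and of osculating planes. The actions are checked for the generators only and pass to
  -- composites and inverses.
  record Aut : Set where
    field
      to from     : Vec4 → Vec4
      to-linear   : Linear to
      from-linear : Linear from
      to-from     : ∀ v → to (from v) ≡ v
      from-to     : ∀ v → from (to v) ≡ v
      σ σ⁻¹       : PG₁ → PG₁
      σ-σ⁻¹       : ∀ τ → σ (σ⁻¹ τ) ≡ τ
      σ⁻¹-σ       : ∀ τ → σ⁻¹ (σ τ) ≡ τ
      pt-to       : ∀ τ → to (pt τ) ∝ pt (σ τ)
      osc-to      : ∀ τ → ∃ λ a → a ≢ 0# × (∀ X → dot (oscₚ (σ τ)) (to X) ≡ a * dot (oscₚ τ) X)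

    pt-from : ∀ τ → from (pt τ) ∝ pt (σ⁻¹ τ)
    pt-from τ = let (a , a≢0 , e) = pt-to (σ⁻¹ τ) in
      ∝-sym (a , a≢0 , trans (sym (from-to _)) (trans (cong from e) (trans (Linear.f-scale from-linear a _)
        (cong (scale a ∘ from ∘ pt) (σ-σ⁻¹ τ)))))

  inverseᴬ : Aut → Aut
  inverseᴬ A = record
    { to = from ; from = to ; to-linear = from-linear ; from-linear = to-linear ; to-from = from-to ; from-to =
      to-from
    ; σ = σ⁻¹ ; σ⁻¹ = σ ; σ-σ⁻¹ = σ⁻¹-σ ; σ⁻¹-σ = σ-σ⁻¹ ; pt-to = pt-from
    ; osc-to = λ τ → let (a , a≢0 , e) = osc-to (σ⁻¹ τ) in a ⁻¹ , ⁻¹-≢0 a≢0 , λ X → cancel a≢0 (begin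
        a * dot (oscₚ (σ⁻¹ τ)) (from X)            ≡⟨ e (from X) ⟨
        dot (oscₚ (σ (σ⁻¹ τ))) (to (from X))       ≡⟨ cong₂ (λ τ X → dot (oscₚ τ) X) (σ-σ⁻¹ τ) (to-from X) ⟩
        dot (oscₚ τ) X ≡⟨ (lin 3 (λ a i x → (x ⊜ a :* (i :* x)) , (:- x ×[ a :* i ⊜ κ 1 ]) ∷ []) a (a ⁻¹)
          (dot (oscₚ τ) X) (⁻¹-inverse a≢0 , _)) ⟩
        a * (a ⁻¹ * dot (oscₚ τ) X)                ∎) }
    where open Aut A

  infixr 9 _∘ᴬ_
  _∘ᴬ_ : Aut → Aut → Aut
  A ∘ᴬ B = record
    { to = A.to ∘ B.to ; from = B.from ∘ A.from
    ; to-linear = record { f-comb = λ a u b v → trans (cong A.to (Linear.f-comb B.to-linear a u b v))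
      (Linear.f-comb A.to-linear a _ b _) }
    ; from-linear = record { f-comb = λ a u b v → trans (cong B.from (Linear.f-comb A.from-linear a u b v))
      (Linear.f-comb B.from-linear a _ b _) }
    ; to-from = λ v → trans (cong A.to (B.to-from _)) (A.to-from v)
    ; from-to = λ v → trans (cong B.from (A.from-to _)) (B.from-to v)
    ; σ = A.σ ∘ B.σ ; σ⁻¹ = B.σ⁻¹ ∘ A.σ⁻¹
    ; σ-σ⁻¹ = λ τ → trans (cong A.σ (B.σ-σ⁻¹ _)) (A.σ-σ⁻¹ τ)
    ; σ⁻¹-σ = λ τ → trans (cong B.σ⁻¹ (A.σ⁻¹-σ _)) (B.σ⁻¹-σ τ)
    ; pt-to = λ τ → let (a , a≢0 , e) = B.pt-to τ in
        ∝-trans (a , a≢0 , trans (cong A.to e) (Linear.f-scale A.to-linear a _)) (A.pt-to (B.σ τ))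
    ; osc-to = λ τ → let (a , a≢0 , e) = B.osc-to τ ; (b , b≢0 , e′) = A.osc-to (B.σ τ) in
        b * a , *-≢0 b≢0 a≢0 , λ X → trans (e′ (B.to X)) (trans (cong (b *_) (e X)) (sym (*-assoc b a _))) }
    where
    module A = Aut A
    module B = Aut B

  idᴬ : Aut
  idᴬ = record
    { to = λ v → v ; from = λ v → v ; to-linear = record { f-comb = λ _ _ _ _ → refl } ; from-linear = record
      { f-comb = λ _ _ _ _ → refl }
    ; to-from = λ _ → refl ; from-to = λ _ → refl ; σ = λ τ → τ ; σ⁻¹ = λ τ → τ ; σ-σ⁻¹ = λ _ → refl ; σ⁻¹-σ = λ _ →
      refl
    ; pt-to = λ _ → ∝-refl ; osc-to = λ τ → 1# , 1≢0 , λ X → sym (*-identityˡ _) }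

  -- The third symmetric power of t ↦ t + k: the rows expand (t + k)³, (t + k)² and t + k in powers
  -- of t.
  translate : Carrier → Vec4 → Vec4
  translate k (x ∷ y ∷ z ∷ w ∷ []) =
    (x + ofℕ 3 * k * y + ofℕ 3 * (k * k) * z + k * k * k * w) ∷ (y + ofℕ 2 * k * z + k * k * w) ∷ (z + k * w) ∷ w ∷ []

  translate-linear : ∀ k → Linear (translate k)
  translate-linear k = record { f-comb = λ { a (x ∷ y ∷ z ∷ w ∷ []) b (x′ ∷ y′ ∷ z′ ∷ w′ ∷ []) → vec4
    (ring 11 (λ k a b x y z w x′ y′ z′ w′ → a :* x :+ b :* x′ :+ κ 3 :* k :* (a :* y :+ b :* y′) :+ κ 3 :*
      (k :* k) :* (a :* z :+ b :* z′) :+ k :* k :* k :* (a :* w :+ b :* w′) ⊜ a :* (x :+ κ 3 :* k :* y :+ κ 3 :*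
      (k :* k) :* z :+ k :* k :* k :* w) :+ b :* (x′ :+ κ 3 :* k :* y′ :+ κ 3 :*
      (k :* k) :* z′ :+ k :* k :* k :* w′)) k a b x y z w x′ y′ z′ w′)
    (ring 9 (λ k a b y z w y′ z′ w′ → a :* y :+ b :* y′ :+ κ 2 :* k :* (a :* z :+ b :* z′) :+ k :* k :*
      (a :* w :+ b :* w′) ⊜ a :* (y :+ κ 2 :* k :* z :+ k :* k :* w) :+ b :*
      (y′ :+ κ 2 :* k :* z′ :+ k :* k :* w′)) k a b y z w y′ z′ w′)
    (ring 7 (λ k a b z w z′ w′ → a :* z :+ b :* z′ :+ k :* (a :* w :+ b :* w′) ⊜ a :* (z :+ k :* w) :+ b :*
      (z′ :+ k :* w′)) k a b z w z′ w′)
    refl } }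

  translate-inverse : ∀ k l → l ≡ - k → ∀ v → translate k (translate l v) ≡ v
  translate-inverse k l e (x ∷ y ∷ z ∷ w ∷ []) = vec4
    (lin 6 (λ k l x y z w → (x :+ κ 3 :* l :* y :+ κ 3 :* (l :* l) :* z :+ l :* l :* l :* w :+ κ 3 :* k :*
      (y :+ κ 2 :* l :* z :+ l :* l :* w) :+ κ 3 :* (k :* k) :* (z :+ l :* w) :+ k :* k :* k :* w ⊜ x) ,
      (κ 3 :* y :+ κ 3 :* (l :+ k) :* z :+ (l :+ k) :* (l :+ k) :* w ×[ l ⊜ :- k ]) ∷ []) k l x y z w (e , _))
    (lin 5 (λ k l y z w → (y :+ κ 2 :* l :* z :+ l :* l :* w :+ κ 2 :* k :* (z :+ l :* w) :+ k :* k :* w ⊜ y) ,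
      (κ 2 :* z :+ (l :+ k) :* w ×[ l ⊜ :- k ]) ∷ []) k l y z w (e , _))
    (lin 4 (λ k l z w → (z :+ l :* w :+ k :* w ⊜ z) , (w ×[ l ⊜ :- k ]) ∷ []) k l z w (e , _))
    refl

  Tᴬ : Carrier → Aut
  Tᴬ k = record
    { to = translate k ; from = translate (- k)
    ; to-linear = translate-linear k ; from-linear = translate-linear (- k)
    ; to-from = translate-inverse k (- k) refl ; from-to = translate-inverse (- k) k (ring 1 (λ k → k ⊜ :- (:- k)) k)
    ; σ = shift k ; σ⁻¹ = shift (- k)
    ; σ-σ⁻¹ = λ { nothing → refl ; (just t) → cong just (ring 2 (λ k t → t :- k :+ k ⊜ t) k t) }
    ; σ⁻¹-σ = λ { nothing → refl ; (just t) → cong just (ring 2 (λ k t → t :+ k :- k ⊜ t) k t) }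
    ; pt-to = λ { nothing → 1# , 1≢0 , vec4
                    (ring 1 (λ k → κ 1 :+ κ 3 :* k :* κ 0 :+ κ 3 :*
                      (k :* k) :* κ 0 :+ k :* k :* k :* κ 0 ⊜ κ 1 :* κ 1) k)
                      (ring 1 (λ k → κ 0 :+ κ 2 :* k :* κ 0 :+ k :* k :* κ 0 ⊜ κ 1 :* κ 0) k)
                      (ring 1 (λ k → κ 0 :+ k :* κ 0 ⊜ κ 1 :* κ 0) k) (ring 1 (λ k → κ 0 ⊜ κ 1 :* κ 0) k)
                ; (just t) → 1# , 1≢0 , vec4
                    (ring 2 (λ k t → t :* t :* t :+ κ 3 :* k :* (t :* t) :+ κ 3 :*
                      (k :* k) :* t :+ k :* k :* k :* κ 1 ⊜ κ 1 :* ((t :+ k) :* (t :+ k) :* (t :+ k))) k t)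
                    (ring 2 (λ k t → t :* t :+ κ 2 :* k :* t :+ k :* k :* κ 1 ⊜ κ 1 :* ((t :+ k) :* (t :+ k))) k t)
                      (ring 2 (λ k t → t :+ k :* κ 1 ⊜ κ 1 :* (t :+ k)) k t) (ring 1 (λ k → κ 1 ⊜ κ 1 :* κ 1) k) }
    ; osc-to = λ { nothing → 1# , 1≢0 , λ { (x ∷ y ∷ z ∷ w ∷ []) →
                      (ring 5 (λ k x y z w → κ 0 :* (x :+ κ 3 :* k :* y :+ κ 3 :*
                        (k :* k) :* z :+ k :* k :* k :* w) :+ (κ 0 :* (y :+ κ 2 :* k :* z :+ k :* k :* w) :+
                        (κ 0 :* (z :+ k :* w) :+ (κ 1 :* w :+ κ 0))) ⊜ κ 1 :*
                        (κ 0 :* x :+ (κ 0 :* y :+ (κ 0 :* z :+ (κ 1 :* w :+ κ 0))))) k x y z w) }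
                 ; (just t) → 1# , 1≢0 , λ { (x ∷ y ∷ z ∷ w ∷ []) →
                      (ring 6 (λ k t x y z w → κ 1 :* (x :+ κ 3 :* k :* y :+ κ 3 :*
                        (k :* k) :* z :+ k :* k :* k :* w) :+
                        (:- (κ 3 :* (t :+ k)) :* (y :+ κ 2 :* k :* z :+ k :* k :* w) :+
                        (κ 3 :* ((t :+ k) :* (t :+ k)) :* (z :+ k :* w) :+
                        (:- ((t :+ k) :* (t :+ k) :* (t :+ k)) :* w :+ κ 0))) ⊜ κ 1 :*
                        (κ 1 :* x :+ (:- (κ 3 :* t) :* y :+
                        (κ 3 :* (t :* t) :* z :+ (:- (t :* t :* t) :* w :+ κ 0))))) k t x y z w) } } }
    where
    shift : Carrier → PG₁ → PG₁
    shift k nothing  = nothing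
    shift k (just t) = just (t + k)

  -- The map induced by t ↦ κt.
  dilate : Carrier → Vec4 → Vec4
  dilate κ (x ∷ y ∷ z ∷ w ∷ []) = (κ * κ * κ * x) ∷ (κ * κ * y) ∷ (κ * z) ∷ w ∷ []

  dilate-linear : ∀ κ → Linear (dilate κ)
  dilate-linear k = record { f-comb = λ { a (x ∷ y ∷ z ∷ w ∷ []) b (x′ ∷ y′ ∷ z′ ∷ w′ ∷ []) → vec4
    (ring 5 (λ k a b x x′ → k :* k :* k :* (a :* x :+ b :* x′) ⊜ a :* (k :* k :* k :* x) :+ b :*
      (k :* k :* k :* x′)) k a b x x′)
    (ring 5 (λ k a b x x′ → k :* k :* (a :* x :+ b :* x′) ⊜ a :* (k :* k :* x) :+ b :* (k :* k :* x′)) k a b y y′)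
    (ring 5 (λ k a b x x′ → k :* (a :* x :+ b :* x′) ⊜ a :* (k :* x) :+ b :* (k :* x′)) k a b z z′)
    refl } }

  dilate-inverse : ∀ k l → k * l ≡ 1# → ∀ v → dilate k (dilate l v) ≡ v
  dilate-inverse k l e (x ∷ y ∷ z ∷ w ∷ []) = vec4
    (lin 3 (λ k l x → (k :* k :* k :* (l :* l :* l :* x) ⊜ x) ,
      (x :* (k :* k :* l :* l :+ k :* l :+ κ 1) ×[ k :* l ⊜ κ 1 ]) ∷ []) k l x (e , _))
    (lin 3 (λ k l y → (k :* k :* (l :* l :* y) ⊜ y) , (y :* (k :* l :+ κ 1) ×[ k :* l ⊜ κ 1 ]) ∷ []) k l y (e , _))
    (lin 3 (λ k l z → (k :* (l :* z) ⊜ z) , (z ×[ k :* l ⊜ κ 1 ]) ∷ []) k l z (e , _))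
    refl

  Dᴬ : ∀ {κ} → κ ≢ 0# → Aut
  Dᴬ {k} k≢0 = record
    { to = dilate k ; from = dilate (k ⁻¹)
    ; to-linear = dilate-linear k ; from-linear = dilate-linear (k ⁻¹)
    ; to-from = dilate-inverse k (k ⁻¹) kk⁻¹ ; from-to = dilate-inverse (k ⁻¹) k (trans (*-comm _ k) kk⁻¹)
    ; σ = mul k ; σ⁻¹ = mul (k ⁻¹)
    ; σ-σ⁻¹ = λ { nothing → refl ; (just t) → cong just
      (lin 3 (λ k i t → (k :* (i :* t) ⊜ t) , (t ×[ k :* i ⊜ κ 1 ]) ∷ []) k (k ⁻¹) t (kk⁻¹ , _)) }
    ; σ⁻¹-σ = λ { nothing → refl ; (just t) → cong just
      (lin 3 (λ k i t → (i :* (k :* t) ⊜ t) , (t ×[ k :* i ⊜ κ 1 ]) ∷ []) k (k ⁻¹) t (kk⁻¹ , _)) }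
    ; pt-to = λ { nothing → k * k * k , k³≢0 , vec4 refl (ring 1 (λ k → k :* k :* κ 0 ⊜ k :* k :* k :* κ 0) k)
      (ring 1 (λ k → k :* κ 0 ⊜ k :* k :* k :* κ 0) k) (ring 1 (λ k → κ 0 ⊜ k :* k :* k :* κ 0) k)
                ; (just t) → 1# , 1≢0 , vec4 (ring 2 (λ k t → k :* k :* k :* (t :* t :* t) ⊜ κ 1 :*
                  (k :* t :* (k :* t) :* (k :* t))) k t)
                    (ring 2 (λ k t → k :* k :* (t :* t) ⊜ κ 1 :* (k :* t :* (k :* t))) k t)
                      (ring 2 (λ k t → k :* t ⊜ κ 1 :* (k :* t)) k t) (ring 1 (λ k → κ 1 ⊜ κ 1 :* κ 1) k) }
    ; osc-to = λ { nothing → 1# , 1≢0 , λ { (x ∷ y ∷ z ∷ w ∷ []) →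
                      (ring 5 (λ k x y z w → κ 0 :* (k :* k :* k :* x) :+
                        (κ 0 :* (k :* k :* y) :+ (κ 0 :* (k :* z) :+ (κ 1 :* w :+ κ 0))) ⊜ κ 1 :*
                        (κ 0 :* x :+ (κ 0 :* y :+ (κ 0 :* z :+ (κ 1 :* w :+ κ 0))))) k x y z w) }
                 ; (just t) → k * k * k , k³≢0 , λ { (x ∷ y ∷ z ∷ w ∷ []) →
                      (ring 6 (λ k t x y z w → κ 1 :* (k :* k :* k :* x) :+ (:- (κ 3 :* (k :* t)) :* (k :* k :* y) :+
                        (κ 3 :* (k :* t :* (k :* t)) :* (k :* z) :+
                        (:- (k :* t :* (k :* t) :* (k :* t)) :* w :+ κ 0))) ⊜ k :* k :* k :*
                        (κ 1 :* x :+ (:- (κ 3 :* t) :* y :+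
                        (κ 3 :* (t :* t) :* z :+ (:- (t :* t :* t) :* w :+ κ 0))))) k t x y z w) } } }
    where
    kk⁻¹ = ⁻¹-inverse k≢0
    k³≢0 = *-≢0 (*-≢0 k≢0 k≢0) k≢0
    mul : Carrier → PG₁ → PG₁
    mul k nothing  = nothing
    mul k (just t) = just (k * t)

  -- The map induced by t ↦ 1/t, which exchanges 0 and ∞.
  reversal : Vec4 → Vec4
  reversal (x ∷ y ∷ z ∷ w ∷ []) = w ∷ z ∷ y ∷ x ∷ []

  Jᴬ : Aut
  Jᴬ = record
    { to = reversal ; from = reversal ; to-linear = linear ; from-linear = linear ; to-from = involutive ; from-to =
      involutive
    ; σ = inv ; σ⁻¹ = inv ; σ-σ⁻¹ = inv-inv ; σ⁻¹-σ = inv-inv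
    ; pt-to = λ { nothing → 1# , 1≢0 , vec4 (ring 0 (κ 0 ⊜ κ 1 :* (κ 0 :* κ 0 :* κ 0)))
      (ring 0 (κ 0 ⊜ κ 1 :* (κ 0 :* κ 0))) (ring 0 (κ 0 ⊜ κ 1 :* κ 0)) (ring 0 (κ 1 ⊜ κ 1 :* κ 1))
                ; (just t) → pt-inv t (t ≟ 0#) }
    ; osc-to = λ { nothing → 1# , 1≢0 , λ { (x ∷ y ∷ z ∷ w ∷ []) →
                      (ring 4 (λ x y z w → κ 1 :* w :+ (:- (κ 3 :* κ 0) :* z :+ (κ 3 :* (κ 0 :* κ 0) :* y :+
                        (:- (κ 0 :* κ 0 :* κ 0) :* x :+ κ 0))) ⊜ κ 1 :*
                        (κ 0 :* x :+ (κ 0 :* y :+ (κ 0 :* z :+ (κ 1 :* w :+ κ 0))))) x y z w) }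
                 ; (just t) → osc-inv t (t ≟ 0#) } }
    where
    linear : Linear reversal
    linear = record { f-comb = λ { a (x ∷ y ∷ z ∷ w ∷ []) b (x′ ∷ y′ ∷ z′ ∷ w′ ∷ []) → refl } }

    involutive : ∀ v → reversal (reversal v) ≡ v
    involutive (x ∷ y ∷ z ∷ w ∷ []) = refl

    -- The decision is an argument, so that the facts about inversion can be proved by cases on it.
    inv′ : ∀ t → Dec (t ≡ 0#) → PG₁
    inv′ t (yes _) = nothing
    inv′ t (no _)  = just (t ⁻¹)

    inv : PG₁ → PG₁
    inv nothing  = just 0#
    inv (just t) = inv′ t (t ≟ 0#)

    inv-inv : ∀ τ → inv (inv τ) ≡ τ
    inv-inv nothing with 0# ≟ 0#
    ... | yes _ = refl
    ... | no h  = ⊥-elim (h refl)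
    inv-inv (just t) = inv′-inv′ (t ≟ 0#)
      where
      inv′-inv′ : ∀ d → inv (inv′ t d) ≡ just t
      inv′-inv′ (yes t≡0) = cong just (sym t≡0)
      inv′-inv′ (no t≢0) = second (t ⁻¹ ≟ 0#)
        where
        second : ∀ d → inv′ (t ⁻¹) d ≡ just t
        second (yes e) = ⊥-elim (⁻¹-≢0 t≢0 e)
        second (no h) = cong just (lin 3 (λ t i j → (j ⊜ t) , (t ×[ i :* j ⊜ κ 1 ]) ∷
          (:- j ×[ t :* i ⊜ κ 1 ]) ∷ []) t (t ⁻¹) ((t ⁻¹) ⁻¹) (⁻¹-inverse h , ⁻¹-inverse t≢0 , _))

    pt-inv : ∀ t d → reversal (P t) ∝ pt (inv′ t d)
    pt-inv t (yes refl) = 1# , 1≢0 , vec4 (ring 0 (κ 1 ⊜ κ 1 :* κ 1)) (ring 0 (κ 0 ⊜ κ 1 :* κ 0))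
      (ring 0 (κ 0 :* κ 0 ⊜ κ 1 :* κ 0)) (ring 0 (κ 0 :* κ 0 :* κ 0 ⊜ κ 1 :* κ 0))
    pt-inv t (no t≢0) = let e = ⁻¹-inverse t≢0 in t * t * t , *-≢0 (*-≢0 t≢0 t≢0) t≢0 , vec4
      (lin 2 (λ t i → (κ 1 ⊜ t :* t :* t :* (i :* i :* i)) ,
        (:- (t :* t :* i :* i :+ t :* i :+ κ 1) ×[ t :* i ⊜ κ 1 ]) ∷ []) t (t ⁻¹) (e , _))
      (lin 2 (λ t i → (t ⊜ t :* t :* t :* (i :* i)) , (:- t :* (t :* i :+ κ 1) ×[ t :* i ⊜ κ 1 ]) ∷ []) t (t ⁻¹)
        (e , _))
      (lin 2 (λ t i → (t :* t ⊜ t :* t :* t :* i) , (:- (t :* t) ×[ t :* i ⊜ κ 1 ]) ∷ []) t (t ⁻¹) (e , _))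
      (ring 1 (λ t → t :* t :* t ⊜ t :* t :* t :* κ 1) t)

    osc-inv : ∀ t d → ∃ λ a → a ≢ 0# × (∀ X → dot (oscₚ (inv′ t d)) (reversal X) ≡ a * dot (osc t) X)
    osc-inv t (yes refl) = 1# , 1≢0 , λ { (x ∷ y ∷ z ∷ w ∷ []) →
      (ring 4 (λ x y z w → κ 0 :* w :+ (κ 0 :* z :+ (κ 0 :* y :+ (κ 1 :* x :+ κ 0))) ⊜ κ 1 :*
        (κ 1 :* x :+ (:- (κ 3 :* κ 0) :* y :+ (κ 3 :* (κ 0 :* κ 0) :* z :+ (:- (κ 0 :* κ 0 :* κ 0) :* w :+ κ 0))))) x
        y z w) }
    osc-inv t (no t≢0) = - (i * i * i) , -‿≢0 (*-≢0 (*-≢0 i≢0 i≢0) i≢0) , λ { (x ∷ y ∷ z ∷ w ∷ []) →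
      (lin 6 (λ t i x y z w → (κ 1 :* w :+
        (:- (κ 3 :* i) :* z :+ (κ 3 :* (i :* i) :* y :+ (:- (i :* i :* i) :* x :+ κ 0))) ⊜ :- (i :* i :* i) :*
        (κ 1 :* x :+ (:- (κ 3 :* t) :* y :+ (κ 3 :* (t :* t) :* z :+ (:- (t :* t :* t) :* w :+ κ 0))))) ,
        (:- (i :* i :* κ 3 :* y) :+ κ 3 :* i :* z :* (t :* i :+ κ 1) :-
        (t :* t :* i :* i :+ t :* i :+ κ 1) :* w ×[ t :* i ⊜ κ 1 ]) ∷ []) t (t ⁻¹) x y z w (e , _)) }
      where
      e = ⁻¹-inverse t≢0
      i = t ⁻¹
      i≢0 = ⁻¹-≢0 t≢0

  -- s ↦ σ + 1/s, sending ∞ to σ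
  Fᴬ : PG₁ → Aut
  Fᴬ nothing  = idᴬ
  Fᴬ (just s) = Tᴬ s ∘ᴬ Jᴬ

  F-∞ : ∀ τ → Aut.σ (Fᴬ τ) nothing ≡ τ
  F-∞ nothing  = refl
  F-∞ (just s) = cong just (+-identityˡ s)

-- Lines of osculating planes and the real axes among them

module AxisLines (F : FiniteField) (2≢0 : PG.ofℕ F 2 ≢ FiniteField.0# F) (3≢0 : PG.ofℕ F 3 ≢ FiniteField.0# F) where
  open CubicGroup F 2≢0 3≢0 public
  open ≡-Reasoning

  e₀ e₁ e₂ e₃ : Vec4
  e₀ = 1# ∷ 0# ∷ 0# ∷ 0# ∷ []
  e₁ = 0# ∷ 1# ∷ 0# ∷ 0# ∷ []
  e₂ = 0# ∷ 0# ∷ 1# ∷ 0# ∷ []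
  e₃ = 0# ∷ 0# ∷ 0# ∷ 1# ∷ []

  basis : ∀ x y z w → (x ∷ y ∷ z ∷ w ∷ []) ≡ comb 1# (comb x e₀ y e₁) 1# (comb z e₂ w e₃)
  basis x y z w = vec4
    (ring 4 (λ x y z w → x ⊜ κ 1 :* (x :* κ 1 :+ y :* κ 0) :+ κ 1 :* (z :* κ 0 :+ w :* κ 0)) x y z w)
      (ring 4 (λ x y z w → y ⊜ κ 1 :* (x :* κ 0 :+ y :* κ 1) :+ κ 1 :* (z :* κ 0 :+ w :* κ 0)) x y z w)
    (ring 4 (λ x y z w → z ⊜ κ 1 :* (x :* κ 0 :+ y :* κ 0) :+ κ 1 :* (z :* κ 1 :+ w :* κ 0)) x y z w)
      (ring 4 (λ x y z w → w ⊜ κ 1 :* (x :* κ 0 :+ y :* κ 0) :+ κ 1 :* (z :* κ 0 :+ w :* κ 1)) x y z w)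

  linear-basis : ∀ {f} → Linear f → ∀ x y z w →
                 f (x ∷ y ∷ z ∷ w ∷ []) ≡ comb 1# (comb x (f e₀) y (f e₁)) 1# (comb z (f e₂) w (f e₃))
  linear-basis {f} lin x y z w = trans (cong f (basis x y z w)) (trans (f-comb 1# _ 1# _)
    (cong₂ (λ u v → comb 1# u 1# v) (f-comb x e₀ y e₁) (f-comb z e₂ w e₃)))
    where open Linear lin

  dual-ext : ∀ {π π′ : Plane} → (∀ X → dot π X ≡ dot π′ X) → π ≡ π′
  dual-ext {a ∷ b ∷ c ∷ d ∷ []} {a′ ∷ b′ ∷ c′ ∷ d′ ∷ []} h = vec4
    (trans (ring 4 (λ a b c d → a ⊜ a :* κ 1 :+ (b :* κ 0 :+ (c :* κ 0 :+ (d :* κ 0 :+ κ 0)))) a b c d)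
      (trans (h e₀) (ring 4 (λ a b c d → a :* κ 1 :+ (b :* κ 0 :+ (c :* κ 0 :+ (d :* κ 0 :+ κ 0))) ⊜ a) a′ b′ c′ d′)))
    (trans (ring 4 (λ a b c d → b ⊜ a :* κ 0 :+ (b :* κ 1 :+ (c :* κ 0 :+ (d :* κ 0 :+ κ 0)))) a b c d)
      (trans (h e₁) (ring 4 (λ a b c d → a :* κ 0 :+ (b :* κ 1 :+ (c :* κ 0 :+ (d :* κ 0 :+ κ 0))) ⊜ b) a′ b′ c′ d′)))
    (trans (ring 4 (λ a b c d → c ⊜ a :* κ 0 :+ (b :* κ 0 :+ (c :* κ 1 :+ (d :* κ 0 :+ κ 0)))) a b c d)
      (trans (h e₂) (ring 4 (λ a b c d → a :* κ 0 :+ (b :* κ 0 :+ (c :* κ 1 :+ (d :* κ 0 :+ κ 0))) ⊜ c) a′ b′ c′ d′)))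
    (trans (ring 4 (λ a b c d → d ⊜ a :* κ 0 :+ (b :* κ 0 :+ (c :* κ 0 :+ (d :* κ 1 :+ κ 0)))) a b c d)
      (trans (h e₃) (ring 4 (λ a b c d → a :* κ 0 :+ (b :* κ 0 :+ (c :* κ 0 :+ (d :* κ 1 :+ κ 0))) ⊜ d) a′ b′ c′ d′)))

  -- The transpose action: the plane as a linear form composed with the map, given by its values on
  -- the basis.
  pull : Aut → Plane → Plane
  pull A π = dot π (to e₀) ∷ dot π (to e₁) ∷ dot π (to e₂) ∷ dot π (to e₃) ∷ []
    where open Aut A

  dot-pull : ∀ A π X → dot (pull A π) X ≡ dot π (Aut.to A X)
  dot-pull A π (x ∷ y ∷ z ∷ w ∷ []) = sym (begin
    dot π (to (x ∷ y ∷ z ∷ w ∷ [])) ≡⟨ cong (dot π) (linear-basis to-linear x y z w) ⟩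
    dot π (comb 1# (comb x (to e₀) y (to e₁)) 1# (comb z (to e₂) w (to e₃)))         ≡⟨ dot-comb π 1# _ 1# _ ⟩
    1# * dot π (comb x (to e₀) y (to e₁)) + 1# * dot π (comb z (to e₂) w (to e₃)) ≡⟨ cong₂ (λ p r → 1# * p + 1# * r)
      (dot-comb π x _ y _) (dot-comb π z _ w _) ⟩
    1# * (x * dot π (to e₀) + y * dot π (to e₁)) + 1# * (z * dot π (to e₂) + w * dot π (to e₃))
      ≡⟨ (ring 8 (λ x y z w a b c d → κ 1 :* (x :* a :+ y :* b) :+ κ 1 :* (z :* c :+ w :* d) ⊜ a :* x :+
        (b :* y :+ (c :* z :+ (d :* w :+ κ 0)))) x y z w (dot π (to e₀)) (dot π (to e₁)) (dot π (to e₂))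
        (dot π (to e₃))) ⟩
    dot (pull A π) (x ∷ y ∷ z ∷ w ∷ [])                                              ∎)
    where open Aut A

  pull-inverse : ∀ A π → pull (inverseᴬ A) (pull A π) ≡ π
  pull-inverse A π = dual-ext λ X → trans (dot-pull (inverseᴬ A) (pull A π) X)
    (trans (dot-pull A π _) (cong (dot π) (Aut.to-from A X)))

  pull-scale : ∀ A a π → pull A (scale a π) ≡ scale a (pull A π)
  pull-scale A a π = dual-ext λ X → begin
    dot (pull A (scale a π)) X      ≡⟨ dot-pull A (scale a π) X ⟩
    dot (scale a π) (Aut.to A X)    ≡⟨ scale-dot a π _ ⟩
    a * dot π (Aut.to A X)          ≡⟨ cong (a *_) (dot-pull A π X) ⟨
    a * dot (pull A π) X            ≡⟨ scale-dot a (pull A π) X ⟨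
    dot (scale a (pull A π)) X      ∎

  pull-∝ : ∀ A {π π′} → π ∝ π′ → pull A π ∝ pull A π′
  pull-∝ A {π′ = π} (a , a≢0 , refl) = a , a≢0 , pull-scale A a π

  pull-≢𝟎 : ∀ A {π} → π ≢ 𝟎 → pull A π ≢ 𝟎
  pull-≢𝟎 A {π} π≢0 e = π≢0 (trans (sym (pull-inverse A π))
    (trans (cong (pull (inverseᴬ A)) (trans e (sym (0-scale 𝟎))))
    (trans (pull-scale (inverseᴬ A) 0# 𝟎) (0-scale _))))

  norm : Vec4 → Vec4
  norm v = case v ≟ᵛ 𝟎 of λ { (yes _) → v ; (no v≢0) → Representative.vector (rep v≢0) }

  norm-∝ : ∀ v → norm v ∝ v
  norm-∝ v with v ≟ᵛ 𝟎
  ... | yes _  = ∝-refl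
  ... | no v≢0 = _ , Representative.factor≢0 (rep v≢0) , refl

  norm-∈ : ∀ {v} → v ≢ 𝟎 → norm v ∈ points
  norm-∈ {v} v≢0 with v ≟ᵛ 𝟎
  ... | yes e = ⊥-elim (v≢0 e)
  ... | no h  = ∈-points (Representative.normalisedʳ (rep h))

  ∝⇒≡ : ∀ {u v} → u ∈ points → v ∈ points → u ∝ v → u ≡ v
  ∝⇒≡ u∈ v∈ (a , _ , e) = normalised-unique (points-normalised u∈) (points-normalised v∈) e

  points≢𝟎 : ∀ {u} → u ∈ points → u ≢ 𝟎
  points≢𝟎 = normalised≢𝟎 ∘ points-normalised

  -- A pulled-back plane must be normalised again, hence the condition under proportionality. One
  -- direction under pullback is enough, because inverses are available.
  record Invariant (type : Plane → Bool) : Set where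
    field
      under-∝    : ∀ {π π′} → π ∝ π′ → T (type π′) → T (type π)
      under-pull : ∀ A {π} → T (type π) → T (type (pull A π))

  -- Pulling back and normalising maps the planes through the image line bijectively to those
  -- through the original line, and the inverse map comes from `inverseᴬ A`.
  Π-invariant : ∀ {type} → Invariant type → ∀ A u v →
                Π[ type ∣ lineThrough (Aut.to A u) (Aut.to A v) ] ≡ Π[ type ∣ lineThrough u v ]
  Π-invariant {type} inv A u v = count-bij {p = λ π → type π ∧ containsLine π
    (lineThrough (to u) (to v))} points-unique points-unique
    (norm ∘ pull A) injective {r = λ π → type π ∧ containsLine π (lineThrough u v)} forth back
    where
    open Aut A
    open Invariant inv
    A⁻¹ = inverseᴬ A

    ∝-dot : ∀ {π π′} X → π ∝ π′ → dot π′ X ≡ 0# → dot π X ≡ 0#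
    ∝-dot {π′ = π′} X (a , _ , refl) e = trans (scale-dot a π′ X) (trans (cong (a *_) e) (zeroʳ a))

    injective : ∀ {π π′} → π ∈ points → _ → π′ ∈ points → _ → norm (pull A π) ≡ norm (pull A π′) → π ≡ π′
    injective {π} {π′} π∈ _ π′∈ _ e = ∝⇒≡ π∈ π′∈ (subst₂ _∝_ (pull-inverse A π) (pull-inverse A π′)
      (pull-∝ A⁻¹ {pull A π} {pull A π′} (∝-trans (∝-sym (norm-∝ (pull A π))) (subst (_∝ pull A π′) (sym e)
        (norm-∝ (pull A π′))))))

    forth : ∀ {π} → π ∈ points → T (type π ∧ containsLine π (lineThrough (to u) (to v))) →
            norm (pull A π) ∈ points × T (type (norm (pull A π)) ∧ containsLine (norm (pull A π)) (lineThrough u v))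
    forth {π} π∈ t = let (tπ , c) = T-∧⁻ {type π} t
                         p = norm-∝ (pull A π) in
      norm-∈ (pull-≢𝟎 A (points≢𝟎 π∈)) ,
      T-∧⁺ (under-∝ p (under-pull A {π} tπ))
        (containsLine⁺ {norm (pull A π)} {u} {v}
          (∝-dot {norm (pull A π)} {pull A π} u p (trans (dot-pull A π u) (containsLine⁻ {π} {to u} {to v} c
            (span-left (to u) (to v)))))
          (∝-dot {norm (pull A π)} {pull A π} v p (trans (dot-pull A π v) (containsLine⁻ {π} {to u} {to v} c
            (span-right (to u) (to v))))))

    back : ∀ {π} → π ∈ points → T (type π ∧ containsLine π (lineThrough u v)) →
           ∃ λ π′ → π′ ∈ points × T (type π′ ∧ containsLine π′ (lineThrough (to u) (to v))) × norm (pull A π′) ≡ π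
    back {π} π∈ t = let (tπ , c) = T-∧⁻ {type π} t in
      π′ , π′∈ ,
      T-∧⁺ (under-∝ p (under-pull A⁻¹ {π} tπ))
        (containsLine⁺ {π′} {to u} {to v}
          (∝-dot {π′} {pull A⁻¹ π} (to u) p (trans (dot-pull A⁻¹ π (to u)) (trans (cong (dot π) (from-to u))
            (containsLine⁻ {π} {u} {v} c (span-left u v)))))
          (∝-dot {π′} {pull A⁻¹ π} (to v) p (trans (dot-pull A⁻¹ π (to v)) (trans (cong (dot π) (from-to v))
            (containsLine⁻ {π} {u} {v} c (span-right u v)))))) ,
      ∝⇒≡ (norm-∈ (pull-≢𝟎 A (points≢𝟎 π′∈))) π∈
        (∝-trans (norm-∝ (pull A π′)) (subst (pull A π′ ∝_) (pull-inverse A⁻¹ π) (pull-∝ A {π′} {pull A⁻¹ π} p)))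
      where
      π′ = norm (pull A⁻¹ π)
      p = norm-∝ (pull A⁻¹ π)
      π′∈ = norm-∈ (pull-≢𝟎 A⁻¹ (points≢𝟎 π∈))

  nCurvePoints-pt : ∀ π → nCurvePoints π ≡ count (λ τ → incident π (pt τ)) PG₁-elems
  nCurvePoints-pt π = trans (cong (count (incident π)) curve≡) (count-map {p = incident π} pt PG₁-elems)

  nCurvePoints-∝ : ∀ {π π′} → π ∝ π′ → nCurvePoints π ≡ nCurvePoints π′
  nCurvePoints-∝ {π′ = π} (a , a≢0 , refl) = count-cong {xs = curve} {p = incident (scale a π)}
    {r = incident π} λ X _ →
    (λ t → ==⁺ (cancel-0 a≢0 (trans (sym (scale-dot a π X)) (==⁻ t)))) ,
    (λ t → ==⁺ (trans (scale-dot a π X) (trans (cong (a *_) (==⁻ t)) (zeroʳ a))))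

  nCurvePoints-pull : ∀ A π → nCurvePoints (pull A π) ≡ nCurvePoints π
  nCurvePoints-pull A π = trans (nCurvePoints-pt (pull A π)) (trans
    (count-bij {p = λ τ → incident (pull A π) (pt τ)} PG₁-unique PG₁-unique σ
      (λ {τ} {τ′} _ _ _ _ e → trans (sym (σ⁻¹-σ τ)) (trans (cong σ⁻¹ e) (σ⁻¹-σ τ′)))
      {r = λ τ → incident π (pt τ)}
      (λ {τ} _ t → PG₁-complete _ , ==⁺ (cancel-0 (proj₁ (proj₂ (pt-to τ))) (trans (sym (eq τ)) (==⁻ t))))
      (λ {τ} _ t → σ⁻¹ τ , PG₁-complete _ , ==⁺
        (trans (eq (σ⁻¹ τ)) (trans (cong (_ *_) (trans (cong (dot π ∘ pt) (σ-σ⁻¹ τ)) (==⁻ t))) (zeroʳ _))) , σ-σ⁻¹ τ))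
    (sym (nCurvePoints-pt π)))
    where
    open Aut A
    eq : ∀ τ → dot (pull A π) (pt τ) ≡ proj₁ (pt-to τ) * dot π (pt (σ τ))
    eq τ = trans (dot-pull A π (pt τ)) (trans (cong (dot π) (proj₂ (proj₂ (pt-to τ)))) (dot-scale π _ _))

  pull-osc : ∀ A τ → pull A (oscₚ τ) ∝ oscₚ (Aut.σ⁻¹ A τ)
  pull-osc A τ = let (a , a≢0 , e) = osc-to (σ⁻¹ τ) in a , a≢0 , dual-ext λ X → begin
    dot (pull A (oscₚ τ)) X             ≡⟨ dot-pull A (oscₚ τ) X ⟩
    dot (oscₚ τ) (to X)                 ≡⟨ cong (λ τ → dot (oscₚ τ) (to X)) (σ-σ⁻¹ τ) ⟨
    dot (oscₚ (σ (σ⁻¹ τ))) (to X)       ≡⟨ e X ⟩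
    a * dot (oscₚ (σ⁻¹ τ)) X            ≡⟨ scale-dot a (oscₚ (σ⁻¹ τ)) X ⟨
    dot (scale a (oscₚ (σ⁻¹ τ))) X      ∎
    where open Aut A

  Γ-∝ : ∀ {π π′} → π ∝ π′ → T (isΓPlane π′) → T (isΓPlane π)
  Γ-∝ p t = let (τ , p′) = isΓ-osc⁻ t in isΓ-osc⁺ τ (∝-trans p p′)

  Γ-pull : ∀ A {π} → T (isΓPlane π) → T (isΓPlane (pull A π))
  Γ-pull A {π} t = let (τ , p) = isΓ-osc⁻ t in isΓ-osc⁺ (Aut.σ⁻¹ A τ) (∝-trans (pull-∝ A {π} {oscₚ τ} p)
    (pull-osc A τ))

  Γ-invariant : Invariant isΓPlane
  Γ-invariant = record { under-∝ = λ {π} {π′} → Γ-∝ {π} {π′} ; under-pull = λ A {π} → Γ-pull A {π} }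

  count-invariant : ∀ k → Invariant (λ π → nCurvePoints π ≡ᵇ k)
  count-invariant k = record
    { under-∝ = λ {π} {π′} p → subst (λ n → T (n ≡ᵇ k)) (sym (nCurvePoints-∝ {π} {π′} p))
    ; under-pull = λ A {π} → subst (λ n → T (n ≡ᵇ k)) (sym (nCurvePoints-pull A π)) }

  1bar-invariant : Invariant is1barC
  1bar-invariant = record
    { under-∝ = λ {π} {π′} p t → let (a , b) = T-∧⁻ {nCurvePoints π′ ≡ᵇ 1} t in
        T-∧⁺ (Invariant.under-∝ (count-invariant 1) {π} {π′} p a) (T-not⁺ (T-not⁻ b ∘ Γ-∝ {π′} {π} (∝-sym p)))
    ; under-pull = λ A {π} t → let (a , b) = T-∧⁻ {nCurvePoints π ≡ᵇ 1} t in
        T-∧⁺ (Invariant.under-pull (count-invariant 1) A {π} a)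
             (T-not⁺ (λ Γ → T-not⁻ b (subst (T ∘ isΓPlane) (pull-inverse A π) (Γ-pull (inverseᴬ A) {pull A π} Γ)))) }

  -- Points of `osc∞`: the plane of c₀t³ + c₁t² + c₂t + c₃ contains `U a` when c₁ = ac₀, and `V′ b`
  -- when c₂ = bc₀.
  U V′ : Carrier → Vec4
  U a  = - a ∷ 1# ∷ 0# ∷ 0# ∷ []
  V′ b = - b ∷ 0# ∷ 1# ∷ 0# ∷ []

  -- The planes through line ∞ a b are osc∞ and the cubics t³ + at² + bt + λ; Fᴬ τ moves this pencil to the
  -- osculating plane at τ.
  line : PG₁ → Carrier → Carrier → Line
  line τ a b = lineThrough (Aut.to (Fᴬ τ) (U a)) (Aut.to (Fᴬ τ) (V′ b))

  -- zero exactly when some t³ + at² + bt + λ is a cube, i.e. when line τ a b is a real axis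
  pencil-disc : Carrier → Carrier → Carrier
  pencil-disc a b = a * a + - (ofℕ 3 * b)

  UV-comb : ∀ x y a b → comb x (U a) y (V′ b) ≡ ((x * - a + y * - b) ∷ x ∷ y ∷ 0# ∷ [])
  UV-comb x y a b = vec4 refl (ring 2 (λ x y → x :* κ 1 :+ y :* κ 0 ⊜ x) x y)
    (ring 2 (λ x y → x :* κ 0 :+ y :* κ 1 ⊜ y) x y) (ring 2 (λ x y → x :* κ 0 :+ y :* κ 0 ⊜ κ 0) x y)

  UV-independent : ∀ a b → Independent (U a) (V′ b)
  UV-independent a b x y e = let e′ = trans (sym (UV-comb x y a b)) e in
    VP.∷-injectiveˡ (VP.∷-injectiveʳ e′) , VP.∷-injectiveˡ (VP.∷-injectiveʳ (VP.∷-injectiveʳ e′))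

  Aut-independent : ∀ A {u v} → Independent u v → Independent (Aut.to A u) (Aut.to A v)
  Aut-independent A {u} {v} ind a b e = ind a b
    (trans (sym (from-to _)) (trans (cong from (trans (Linear.f-comb to-linear a u b v) e)) (Linear.f-𝟎 from-linear)))
    where open Aut A

  line-∈ : ∀ τ a b → line τ a b ∈ lines
  line-∈ τ a b = ∈-lines⁺ (Aut-independent (Fᴬ τ) (UV-independent a b))

  from-span : ∀ A {u v w} → InSpan (Aut.to A u) (Aut.to A v) w → InSpan u v (Aut.from A w)
  from-span A s = subst₂ (λ u v → InSpan u v (Aut.from A _)) (Aut.from-to A _) (Aut.from-to A _)
    (Linear.f-span (Aut.from-linear A) s)

  dot-U : ∀ c₀ c₁ c₂ c₃ a → dot (c₀ ∷ c₁ ∷ c₂ ∷ c₃ ∷ []) (U a) ≡ c₁ + - (a * c₀)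
  dot-U c₀ c₁ c₂ c₃ a = ring 5 (λ c₀ c₁ c₂ c₃ a → c₀ :* :- a :+
    (c₁ :* κ 1 :+ (c₂ :* κ 0 :+ (c₃ :* κ 0 :+ κ 0))) ⊜ c₁ :- a :* c₀) c₀ c₁ c₂ c₃ a

  dot-V : ∀ c₀ c₁ c₂ c₃ b → dot (c₀ ∷ c₁ ∷ c₂ ∷ c₃ ∷ []) (V′ b) ≡ c₂ + - (b * c₀)
  dot-V c₀ c₁ c₂ c₃ b = ring 5 (λ c₀ c₁ c₂ c₃ b → c₀ :* :- b :+
    (c₁ :* κ 0 :+ (c₂ :* κ 1 :+ (c₃ :* κ 0 :+ κ 0))) ⊜ c₂ :- b :* c₀) c₀ c₁ c₂ c₃ b

  x-y≡0⇒ : ∀ {x y} → x + - y ≡ 0# → x ≡ y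
  x-y≡0⇒ {x} {y} e = lin 2 (λ x y → (x ⊜ y) , (κ 1 ×[ x :- y ⊜ κ 0 ]) ∷ []) x y (e , _)

  contains-line∞⁻ : ∀ {c₀ c₁ c₂ c₃ a b} → T (containsLine (c₀ ∷ c₁ ∷ c₂ ∷ c₃ ∷ []) (lineThrough (U a) (V′ b))) →
                    c₁ ≡ a * c₀ × c₂ ≡ b * c₀
  contains-line∞⁻ {c₀} {c₁} {c₂} {c₃} {a} {b} t =
    x-y≡0⇒ (trans (sym (dot-U c₀ c₁ c₂ c₃ a)) (containsLine⁻ {c₀ ∷ c₁ ∷ c₂ ∷ c₃ ∷ []} {U a} {V′ b} t
      (span-left _ _))) ,
    x-y≡0⇒ (trans (sym (dot-V c₀ c₁ c₂ c₃ b)) (containsLine⁻ {c₀ ∷ c₁ ∷ c₂ ∷ c₃ ∷ []} {U a} {V′ b} t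
      (span-right _ _)))

  contains-line∞⁺ : ∀ {c₀ c₁ c₂ c₃ a b} → c₁ ≡ a * c₀ → c₂ ≡ b * c₀ →
                    T (containsLine (c₀ ∷ c₁ ∷ c₂ ∷ c₃ ∷ []) (lineThrough (U a) (V′ b)))
  contains-line∞⁺ {c₀} {c₁} {c₂} {c₃} {a} {b} refl refl = containsLine⁺ {c₀ ∷ a * c₀ ∷ b * c₀ ∷ c₃ ∷ []} {U a} {V′ b}
    (trans (dot-U c₀ c₁ c₂ c₃ a) (-‿inverseʳ _)) (trans (dot-V c₀ c₁ c₂ c₃ b) (-‿inverseʳ _))

  osc-∈ : ∀ t → osc t ∈ points
  osc-∈ t = ∈-points {osc t} leading
    where
    leading : T (normalised (osc t))
    leading with 1# ≟ 0#
    ... | yes e = ⊥-elim (1≢0 e)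
    ... | no _  = ==⁺ refl

  osc∞-∈ : osc∞ ∈ points
  osc∞-∈ = ∈-points {osc∞} leading
    where
    leading : T (normalised osc∞)
    leading with 0# ≟ 0# | 1# ≟ 0#
    ... | no h  | _     = ⊥-elim (h refl)
    ... | yes _ | yes e = ⊥-elim (1≢0 e)
    ... | yes _ | no _  = ==⁺ refl

  osc∞-contains : ∀ a b → T (containsLine osc∞ (lineThrough (U a) (V′ b)))
  osc∞-contains a b = contains-line∞⁺ {a = a} {b} (sym (zeroʳ a)) (sym (zeroʳ b))

  -- The cube (t - s)³ belongs to the pencil only if a = -3s and b = 3s², and then a² = 3b.
  nΓ-line∞ : ∀ {a b} → pencil-disc a b ≢ 0# → nΓPlanesThrough (line nothing a b) ≡ 1
  nΓ-line∞ {a} {b} h = count-enum {p = λ π → isΓPlane π ∧ containsLine π (line nothing a b)}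
    {zs = osc∞ ∷ []} points-unique ([] ∷ [])
    (λ {π} π∈ t → let (Γ , c) = T-∧⁻ {isΓPlane π} t ; (τ , p) = isΓ-osc⁻ Γ in here (∝⇒≡ π∈ osc∞-∈ (at-∞ τ p c)))
    (λ { (here refl) → osc∞-∈ , T-∧⁺ (isΓ-osc⁺ {osc∞} nothing ∝-refl) (osc∞-contains a b) })
    where
    at-∞ : ∀ {π} τ → π ∝ oscₚ τ → T (containsLine π (line nothing a b)) → π ∝ osc∞
    at-∞ nothing  p _ = p
    at-∞ (just s) (k , k≢0 , refl) c = let (ea , eb) = contains-line∞⁻ {a = a} {b} c in
      ⊥-elim (h (cancel-0 (*-≢0 k≢0 k≢0) (lin 4 (λ k s a b → (k :* k :* (a :* a :- κ 3 :* b) ⊜ κ 0) ,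
        (:- (k :* a :- κ 3 :* k :* s) ×[ k :* :- (κ 3 :* s) ⊜ a :* (k :* κ 1) ]) ∷
        (κ 3 :* k ×[ k :* (κ 3 :* (s :* s)) ⊜ b :* (k :* κ 1) ]) ∷ []) k s a b (ea , eb , _))))

  nΓ-axis∞ : ∀ {a b} → pencil-disc a b ≡ 0# → 2 ≤ nΓPlanesThrough (line nothing a b)
  nΓ-axis∞ {a} {b} h = unique-⊆-length {xs = osc∞ ∷ osc s ∷ []} ((∞≢s ∷ []) ∷ [] ∷ [])
    (λ { (here refl) → ∈-filterᵇ⁺ {p = λ π → isΓPlane π ∧ containsLine π (line nothing a b)} osc∞-∈
      (T-∧⁺ (isΓ-osc⁺ {osc∞} nothing ∝-refl) (osc∞-contains a b))
       ; (there (here refl)) → ∈-filterᵇ⁺ {p = λ π → isΓPlane π ∧ containsLine π (line nothing a b)} (osc-∈ s)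
         (T-∧⁺ (isΓ-osc⁺ {osc s} (just s) ∝-refl)
            (contains-line∞⁺ {a = a} {b} (lin 2 (λ a h → (:- (κ 3 :* :- (h :* a)) ⊜ a :* κ 1) ,
              (a ×[ κ 3 :* h ⊜ κ 1 ]) ∷ []) a ⅓ (⅓-inverse , _))
               (lin 3 (λ a b h → (κ 3 :* (:- (h :* a) :* :- (h :* a)) ⊜ b :* κ 1) ,
                 (h ×[ a :* a :- κ 3 :* b ⊜ κ 0 ]) ∷ (h :* a :* a :+ b ×[ κ 3 :* h ⊜ κ 1 ]) ∷ []) a b ⅓
                 (h , ⅓-inverse , _)))) })
    where
    -- The triple root of (t + a/3)³ = t³ + at² + (a²/3)t + a³/27, which lies in the pencil because
    -- a² = 3b.
    s = - (⅓ * a)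
    ∞≢s : osc∞ ≢ osc s
    ∞≢s e = 0≢1 (VP.∷-injectiveˡ e)

  nΓ-line : ∀ τ a b → nΓPlanesThrough (line τ a b) ≡ nΓPlanesThrough (line nothing a b)
  nΓ-line τ a b = Π-invariant Γ-invariant (Fᴬ τ) (U a) (V′ b)

  line-misses-curve : ∀ τ a b → ¬ T (meetsCurve (line τ a b))
  line-misses-curve τ a b t =
    let (X , X∈ , oc) = any-T {p = onCurve} (line τ a b) t
        (ρ , k , k≢0 , e) = onCurve⁻ oc
        (m , m≢0 , e′) = Aut.pt-from (Fᴬ τ) ρ
        s = span-unscale k≢0 (subst (InSpan _ _) e (proj₂ (∈-line⁻ X∈)))
    in misses (Aut.σ⁻¹ (Fᴬ τ) ρ) (span-unscale m≢0 (subst (InSpan (U a) (V′ b)) e′ (from-span (Fᴬ τ) s)))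
    where
    misses : ∀ ρ → ¬ InSpan (U a) (V′ b) (pt ρ)
    misses nothing (x , y , e) = let e′ = trans e (UV-comb x y a b) in
      1≢0 (trans (VP.∷-injectiveˡ e′)
        (trans (cong₂ (λ x y → x * - a + y * - b) (sym (VP.∷-injectiveˡ (VP.∷-injectiveʳ e′)))
        (sym (VP.∷-injectiveˡ (VP.∷-injectiveʳ (VP.∷-injectiveʳ e′)))))
          (ring 2 (λ a b → κ 0 :* :- a :+ κ 0 :* :- b ⊜ κ 0) a b)))
    misses (just t) (x , y , e) = let e′ = trans e (UV-comb x y a b) in
      1≢0 (VP.∷-injectiveˡ (VP.∷-injectiveʳ (VP.∷-injectiveʳ (VP.∷-injectiveʳ e′))))

  EΓ-line⁺ : ∀ τ a b → pencil-disc a b ≢ 0# → T (isEΓLine (line τ a b))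
  EΓ-line⁺ τ a b h = T-∧⁺ {not (meetsCurve (line τ a b))} (T-not⁺ (line-misses-curve τ a b))
    (subst (λ n → T ((1 ≤ᵇ n) ∧ not (2 ≤ᵇ n))) (sym (trans (nΓ-line τ a b) (nΓ-line∞ h))) _)

  -- A nonzero combination of `u` and `v` with vanishing middle coordinates would be a multiple of
  -- `P∞`. As the line misses `P∞`, the middle coordinates form an invertible 2 × 2 matrix, and
  -- Cramer's rule gives the basis `U a`, `V′ b`.
  plane-line : ∀ {u v} → Independent u v → dot osc∞ u ≡ 0# → dot osc∞ v ≡ 0# → ¬ InSpan u v P∞ →
               ∃ λ a → ∃ λ b → InSpan u v (U a) × InSpan u v (V′ b) × InSpan (U a) (V′ b) u × InSpan (U a) (V′ b) v
  plane-line {p₀ ∷ p₁ ∷ p₂ ∷ p₃ ∷ []} {r₀ ∷ r₁ ∷ r₂ ∷ r₃ ∷ []} ind eu ev miss =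
    a , b , (r₂ * i , - p₂ * i , vec4
        (ring 5 (λ p₀ p₂ r₀ r₂ i → :- (:- ((r₂ :* p₀ :- p₂ :* r₀) :* i)) ⊜ r₂ :* i :* p₀ :+ :- p₂ :* i :* r₀) p₀ p₂
          r₀ r₂ i)
        (lin 5 (λ p₁ p₂ r₁ r₂ i → (κ 1 ⊜ r₂ :* i :* p₁ :+ :- p₂ :* i :* r₁) ,
          (:- (κ 1) ×[ (p₁ :* r₂ :- p₂ :* r₁) :* i ⊜ κ 1 ]) ∷ []) p₁ p₂ r₁ r₂ i (δi , _))
        (ring 3 (λ p₂ r₂ i → κ 0 ⊜ r₂ :* i :* p₂ :+ :- p₂ :* i :* r₂) p₂ r₂ i)
        (lin 5 (λ p₂ p₃ r₂ r₃ i → (κ 0 ⊜ r₂ :* i :* p₃ :+ :- p₂ :* i :* r₃) , (:- r₂ :* i ×[ p₃ ⊜ κ 0 ]) ∷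
          (p₂ :* i ×[ r₃ ⊜ κ 0 ]) ∷ []) p₂ p₃ r₂ r₃ i (p₃≡0 , r₃≡0 , _))) ,
      (- r₁ * i , p₁ * i , vec4
        (ring 5 (λ p₀ p₁ r₀ r₁ i → :- (:- ((p₁ :* r₀ :- r₁ :* p₀) :* i)) ⊜ :- r₁ :* i :* p₀ :+ p₁ :* i :* r₀) p₀ p₁
          r₀ r₁ i)
        (ring 3 (λ p₁ r₁ i → κ 0 ⊜ :- r₁ :* i :* p₁ :+ p₁ :* i :* r₁) p₁ r₁ i)
        (lin 5 (λ p₁ p₂ r₁ r₂ i → (κ 1 ⊜ :- r₁ :* i :* p₂ :+ p₁ :* i :* r₂) ,
          (:- (κ 1) ×[ (p₁ :* r₂ :- p₂ :* r₁) :* i ⊜ κ 1 ]) ∷ []) p₁ p₂ r₁ r₂ i (δi , _))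
        (lin 5 (λ p₁ p₃ r₁ r₃ i → (κ 0 ⊜ :- r₁ :* i :* p₃ :+ p₁ :* i :* r₃) , (r₁ :* i ×[ p₃ ⊜ κ 0 ]) ∷
          (:- p₁ :* i ×[ r₃ ⊜ κ 0 ]) ∷ []) p₁ p₃ r₁ r₃ i (p₃≡0 , r₃≡0 , _))) ,
      (p₁ , p₂ , vec4
        (lin 7 (λ p₀ p₁ p₂ r₀ r₁ r₂ i → (p₀ ⊜ p₁ :* :- (:- ((r₂ :* p₀ :- p₂ :* r₀) :* i)) :+ p₂ :* :-
          (:- ((p₁ :* r₀ :- r₁ :* p₀) :* i))) ,
          (:- p₀ ×[ (p₁ :* r₂ :- p₂ :* r₁) :* i ⊜ κ 1 ]) ∷ []) p₀ p₁ p₂ r₀ r₁ r₂ i (δi , _))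
        (ring 2 (λ p₁ p₂ → p₁ ⊜ p₁ :* κ 1 :+ p₂ :* κ 0) p₁ p₂) (ring 2 (λ p₁ p₂ → p₂ ⊜ p₁ :* κ 0 :+ p₂ :* κ 1) p₁ p₂)
          (lin 3 (λ p₁ p₂ p₃ → (p₃ ⊜ p₁ :* κ 0 :+ p₂ :* κ 0) , (κ 1 ×[ p₃ ⊜ κ 0 ]) ∷ []) p₁ p₂ p₃ (p₃≡0 , _))) ,
      (r₁ , r₂ , vec4
        (lin 7 (λ p₀ p₁ p₂ r₀ r₁ r₂ i → (r₀ ⊜ r₁ :* :- (:- ((r₂ :* p₀ :- p₂ :* r₀) :* i)) :+ r₂ :* :-
          (:- ((p₁ :* r₀ :- r₁ :* p₀) :* i))) ,
          (:- r₀ ×[ (p₁ :* r₂ :- p₂ :* r₁) :* i ⊜ κ 1 ]) ∷ []) p₀ p₁ p₂ r₀ r₁ r₂ i (δi , _))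
        (ring 2 (λ r₁ r₂ → r₁ ⊜ r₁ :* κ 1 :+ r₂ :* κ 0) r₁ r₂) (ring 2 (λ r₁ r₂ → r₂ ⊜ r₁ :* κ 0 :+ r₂ :* κ 1) r₁ r₂)
          (lin 3 (λ r₁ r₂ r₃ → (r₃ ⊜ r₁ :* κ 0 :+ r₂ :* κ 0) , (κ 1 ×[ r₃ ⊜ κ 0 ]) ∷ []) r₁ r₂ r₃ (r₃≡0 , _)))
    where
    p₃≡0 : p₃ ≡ 0#
    p₃≡0 = trans (ring 4 (λ p₀ p₁ p₂ p₃ → p₃ ⊜ κ 0 :* p₀ :+
      (κ 0 :* p₁ :+ (κ 0 :* p₂ :+ (κ 1 :* p₃ :+ κ 0)))) p₀ p₁ p₂ p₃) eu

    r₃≡0 : r₃ ≡ 0#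
    r₃≡0 = trans (ring 4 (λ r₀ r₁ r₂ r₃ → r₃ ⊜ κ 0 :* r₀ :+
      (κ 0 :* r₁ :+ (κ 0 :* r₂ :+ (κ 1 :* r₃ :+ κ 0)))) r₀ r₁ r₂ r₃) ev

    δ = p₁ * r₂ + - (p₂ * r₁)
    i = δ ⁻¹
    a = - ((r₂ * p₀ + - (p₂ * r₀)) * i)
    b = - ((p₁ * r₀ + - (r₁ * p₀)) * i)

    trivial : ∀ x y → x * p₁ + y * r₁ ≡ 0# → x * p₂ + y * r₂ ≡ 0# → x ≡ 0# × y ≡ 0#
    trivial x y h₁ h₂ = case (x * p₀ + y * r₀) ≟ 0# of λ
      { (yes h₀) → ind x y (vec4 h₀ h₁ h₂ h₃)
      ; (no k≢0) → ⊥-elim (miss (span-unscale k≢0 (x , y , vec4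
          (ring 1 (λ k → k :* κ 1 ⊜ k) (x * p₀ + y * r₀)) (trans (zeroʳ _) (sym h₁)) (trans (zeroʳ _) (sym h₂))
            (trans (zeroʳ _) (sym h₃))))) }
      where
      h₃ : x * p₃ + y * r₃ ≡ 0#
      h₃ = lin 4 (λ x y p₃ r₃ → (x :* p₃ :+ y :* r₃ ⊜ κ 0) , (x ×[ p₃ ⊜ κ 0 ]) ∷ (y ×[ r₃ ⊜ κ 0 ]) ∷ []) x y p₃ r₃
        (p₃≡0 , r₃≡0 , _)

    δ≢0 : δ ≢ 0#
    δ≢0 δ≡0 = 1≢0 (proj₁ (trivial 1# 0# (only p₁ r₁ p₁≡0) (only p₂ r₂ p₂≡0)))
      where
      only : ∀ p r → p ≡ 0# → 1# * p + 0# * r ≡ 0#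
      only p r e = lin 2 (λ p r → (κ 1 :* p :+ κ 0 :* r ⊜ κ 0) , (κ 1 ×[ p ⊜ κ 0 ]) ∷ []) p r (e , _)
      p₂≡0 : p₂ ≡ 0#
      p₂≡0 = let (_ , e) = trivial r₂ (- p₂) (lin 4 (λ p₁ p₂ r₁ r₂ → (r₂ :* p₁ :+ :- p₂ :* r₁ ⊜ κ 0) , (κ 1 ×[ p₁ :* r₂ :- p₂ :* r₁ ⊜ κ 0 ]) ∷ []) p₁ p₂ r₁ r₂ (δ≡0 , _)) (ring 2 (λ p₂ r₂ → r₂ :* p₂ :+ :- p₂ :* r₂ ⊜ κ 0) p₂ r₂)
             in (lin 1 (λ p₂ → (p₂ ⊜ κ 0) , (:- (κ 1) ×[ :- p₂ ⊜ κ 0 ]) ∷ []) p₂ (e , _))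
      p₁≡0 : p₁ ≡ 0#
      p₁≡0 = proj₂ (trivial (- r₁) p₁ (ring 2 (λ p₁ r₁ → :- r₁ :* p₁ :+ p₁ :* r₁ ⊜ κ 0) p₁ r₁)
        (lin 4 (λ p₁ p₂ r₁ r₂ → (:- r₁ :* p₂ :+ p₁ :* r₂ ⊜ κ 0) ,
        (κ 1 ×[ p₁ :* r₂ :- p₂ :* r₁ ⊜ κ 0 ]) ∷ []) p₁ p₂ r₁ r₂ (δ≡0 , _)))

    δi : δ * i ≡ 1#
    δi = ⁻¹-inverse δ≢0

  -- A Γ-plane through the line has some parameter τ, and the inverse of `Fᴬ τ` carries it to
  -- `osc∞`; a vanishing `pencil-disc` would produce a second Γ-plane.
  EΓ-line⁻ : ∀ {ℓ} → ℓ ∈ lines → T (isEΓLine ℓ) → ∃ λ τ → ∃ λ a → ∃ λ b → ℓ ≡ line τ a b × pencil-disc a b ≢ 0#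
  EΓ-line⁻ {ℓ} ℓ∈ t =
    let (misses , t′) = T-∧⁻ {not (meetsCurve ℓ)} t
        (some , ¬axis) = T-∧⁻ {1 ≤ᵇ nΓPlanesThrough ℓ} t′
        (π , π∈ , t″) = count-suc⇒∃ {p = λ π → isΓPlane π ∧ containsLine π ℓ} planes (ℕP.≤ᵇ⇒≤ 1 _ some)
        (Γ , c) = T-∧⁻ {isΓPlane π} t″
        (u , v , ind , ℓ≡) = ∈-lines⁻ ℓ∈
        (τ , p) = isΓ-osc⁻ Γ
        (a , b , e) = from-osc τ p (subst (T ∘ containsLine π) ℓ≡ c) ind (subst (λ ℓ → ¬ T (meetsCurve ℓ)) ℓ≡
          (T-not⁻ misses))
        ℓ≡line = trans ℓ≡ e
    in τ , a , b , ℓ≡line , λ h → T-not⁻ ¬axis (ℕP.≤⇒≤ᵇ (subst (2 ≤_)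
         (sym (trans (cong nΓPlanesThrough ℓ≡line) (nΓ-line τ a b))) (nΓ-axis∞ h)))
    where
    from-osc : ∀ {π u v} τ → π ∝ oscₚ τ → T (containsLine π (lineThrough u v)) → Independent u v → ¬ T
      (meetsCurve (lineThrough u v)) →
               ∃ λ a → ∃ λ b → lineThrough u v ≡ line τ a b
    from-osc {u = u} {v} τ (k , k≢0 , refl) c ind misses =
      let (a , b , s₁ , s₂ , s₃ , s₄) = plane-line (Aut-independent (inverseᴬ A) ind) (at-∞ (span-left u v)) (at-∞ (span-right u v)) miss
      in a , b , trans (cong₂ lineThrough (sym (to-from u)) (sym (to-from v)))
        (Linear.f-line-cong to-linear s₃ s₄ s₁ s₂)
      where
      A = Fᴬ τ
      open Aut A
      at-∞ : ∀ {w} → InSpan u v w → dot osc∞ (from w) ≡ 0#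
      at-∞ {w} s = let (m , m≢0 , e) = osc-to nothing in cancel-0 m≢0 (trans (sym (e (from w)))
        (trans (cong₂ (λ τ X → dot (oscₚ τ) X) (F-∞ τ) (to-from w))
          (cancel-0 k≢0 (trans (sym (scale-dot k (oscₚ τ) w)) (containsLine⁻ {scale k (oscₚ τ)} {u} {v} c s)))))

      miss : ¬ InSpan (from u) (from v) P∞
      miss s = misses (T-any {p = onCurve} (∈-line⁺ (norm-∈ X≢0) (span-norm s′))
        (onCurve⁺ (σ nothing) (∝-trans (norm-∝ X) (pt-to nothing))))
        where
        X = to P∞
        s′ : InSpan u v X
        s′ = from-span (inverseᴬ A) s
        X≢0 : X ≢ 𝟎
        X≢0 e = 1≢0 (VP.∷-injectiveˡ (trans (sym (from-to P∞)) (trans (cong from e) (Linear.f-𝟎 from-linear))))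
        span-norm : ∀ {w} → InSpan u v w → InSpan u v (norm w)
        span-norm {w} s = let (a , _ , e) = norm-∝ w in subst (InSpan u v) (sym e) (span-scale a s)

-- The group of the cubic and its orbits on pencils

module GqOrbits (F : FiniteField) (2≢0 : PG.ofℕ F 2 ≢ FiniteField.0# F) (3≢0 : PG.ofℕ F 3 ≢ FiniteField.0# F)
  (5≤q : 5 ≤ FiniteField.q F) where
  open AxisLines F 2≢0 3≢0 public
  open ≡-Reasoning

  columns : Vec4 → Vec4 → Vec4 → Vec4 → Mat
  columns (a ∷ b ∷ c ∷ d ∷ []) (a′ ∷ b′ ∷ c′ ∷ d′ ∷ []) (a″ ∷ b″ ∷ c″ ∷ d″ ∷ []) (a‴ ∷ b‴ ∷ c‴ ∷ d‴ ∷ []) =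
    (a ∷ a′ ∷ a″ ∷ a‴ ∷ []) ∷ (b ∷ b′ ∷ b″ ∷ b‴ ∷ []) ∷ (c ∷ c′ ∷ c″ ∷ c‴ ∷ []) ∷ (d ∷ d′ ∷ d″ ∷ d‴ ∷ []) ∷ []

  apply-columns : ∀ A B C D x y z w → apply (columns A B C D) (x ∷ y ∷ z ∷ w ∷ []) ≡ comb 1# (comb x A y B) 1#
    (comb z C w D)
  apply-columns (a ∷ b ∷ c ∷ d ∷ []) (a′ ∷ b′ ∷ c′ ∷ d′ ∷ []) (a″ ∷ b″ ∷ c″ ∷ d″ ∷ [])
    (a‴ ∷ b‴ ∷ c‴ ∷ d‴ ∷ []) x y z w =
    vec4 (row a a′ a″ a‴) (row b b′ b″ b‴) (row c c′ c″ c‴) (row d d′ d″ d‴)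
    where
    row : ∀ a b c d → dot (a ∷ b ∷ c ∷ d ∷ []) (x ∷ y ∷ z ∷ w ∷ []) ≡ 1# * (x * a + y * b) + 1# * (z * c + w * d)
    row a b c d = ring 8 (λ a b c d x y z w → a :* x :+ (b :* y :+ (c :* z :+ (d :* w :+ κ 0))) ⊜ κ 1 :*
      (x :* a :+ y :* b) :+ κ 1 :* (z :* c :+ w :* d)) a b c d x y z w

  matrix : Aut → Mat
  matrix A = columns (to e₀) (to e₁) (to e₂) (to e₃)
    where open Aut A

  apply-matrix : ∀ A v → apply (matrix A) v ≡ Aut.to A v
  apply-matrix A (x ∷ y ∷ z ∷ w ∷ []) = trans (apply-columns (to e₀) (to e₁) (to e₂) (to e₃) x y z w)
    (sym (linear-basis to-linear x y z w))
    where open Aut A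

  isZeroVec⁺ : ∀ {n} {v : Vec Carrier n} → v ≡ 𝟎 → T (isZeroVec v)
  isZeroVec⁺ {v = []}    _ = _
  isZeroVec⁺ {v = x ∷ v} e = T-∧⁺ (==⁺ (VP.∷-injectiveˡ e)) (isZeroVec⁺ (VP.∷-injectiveʳ e))

  isZeroVec⁻ : ∀ {n} {v : Vec Carrier n} → T (isZeroVec v) → v ≡ 𝟎
  isZeroVec⁻ {v = []}    _ = refl
  isZeroVec⁻ {v = x ∷ v} t = let (a , b) = T-∧⁻ {x == 0#} t in cong₂ _∷_ (==⁻ a) (isZeroVec⁻ b)

  matrix-inGq : ∀ A → T (inGq (matrix A))
  matrix-inGq A = T-∧⁺ {nonsingular M} nonsing (T-∧⁺ maps-to onto)
    where
    open Aut A
    M = matrix A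

    nonsing : T (nonsingular M)
    nonsing = T-all {xs = allVec4} {p = λ v → isZeroVec v ∨ not (isZeroVec (apply M v))} λ v _ → case v ≟ᵛ 𝟎 of λ
      { (yes e) → T-∨⁺ˡ (isZeroVec⁺ e)
      ; (no h)  → T-∨⁺ʳ {isZeroVec v} (T-not⁺ λ t → h (trans (sym (from-to v))
          (trans (cong from (trans (sym (apply-matrix A v)) (isZeroVec⁻ t))) (Linear.f-𝟎 from-linear)))) }

    maps-to : T (all (λ X → onCurve (apply M X)) curve)
    maps-to = T-all {xs = curve} {p = λ X → onCurve (apply M X)} λ X X∈ → let (τ , X≡) = ∈-curve⁻ X∈ in
      onCurve⁺ (σ τ) (subst (_∝ pt (σ τ)) (trans (cong to (sym X≡)) (sym (apply-matrix A X))) (pt-to τ))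

    onto : T (all (λ Y → any (λ X → proportional Y (apply M X)) curve) curve)
    onto = T-all {xs = curve} {p = λ Y → any (λ X → proportional Y (apply M X)) curve} λ Y Y∈ →
      let (τ , Y≡) = ∈-curve⁻ Y∈
          (a , a≢0 , e) = ∝-sym (subst₂ _∝_ (sym (apply-matrix A (pt (σ⁻¹ τ)))) (trans (cong pt (σ-σ⁻¹ τ)) (sym Y≡))
            (pt-to (σ⁻¹ τ)))
      in T-any {p = λ X → proportional Y (apply M X)} (∈-curve⁺ (σ⁻¹ τ)) (proportional⁺ a a≢0 e)

  allMats-complete : ∀ M → M ∈ allMats
  allMats-complete = allVecs-complete allVec4-complete

  inOrbit⁺ : ∀ A u v → T (inOrbit (lineThrough u v) (lineThrough (Aut.to A u) (Aut.to A v)))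
  inOrbit⁺ A u v = T-any {p = λ M → inGq M ∧ (imageLine M (lineThrough u v) =l lineThrough (to u) (to v))}
    (allMats-complete (matrix A))
    (T-∧⁺ (matrix-inGq A) (fromWitness (trans (imageLine-span (matrix A) u v) (cong₂ lineThrough (apply-matrix A u)
      (apply-matrix A v)))))
    where open Aut A

  -- What is used of a matrix in the group. Without an explicit inverse or parameter action it can
  -- still be composed with known maps, before it is recognised as one of them.
  record CurveMap (f : Vec4 → Vec4) : Set where
    field
      linear    : Linear f
      injective : ∀ {v} → f v ≡ 𝟎 → v ≡ 𝟎
      on-curve  : ∀ τ → ∃ λ ρ → f (pt τ) ∝ pt ρ

  inGq⇒CurveMap : ∀ {M} → T (inGq M) → CurveMap (apply M)
  inGq⇒CurveMap {M} t = record
    { linear = apply-linear M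
    ; injective = λ {v} e → case T-∨⁻ {isZeroVec v}
      (all-T {p = λ v → isZeroVec v ∨ not (isZeroVec (apply M v))} allVec4 (proj₁ t₁) (allVec4-complete v)) of λ
        { (inj₁ z) → isZeroVec⁻ z ; (inj₂ n) → ⊥-elim (T-not⁻ n (isZeroVec⁺ e)) }
    ; on-curve = λ τ → onCurve⁻ (all-T {p = λ X → onCurve (apply M X)} curve (proj₁ t₂) (∈-curve⁺ τ)) }
    where
    t₁ = T-∧⁻ {nonsingular M} t
    t₂ = T-∧⁻ {all (λ X → onCurve (apply M X)) curve} (proj₂ t₁)

  after : ∀ A {f} → CurveMap f → CurveMap (Aut.from A ∘ f)
  after A {f} cm = record
    { linear = record { f-comb = λ a u b v → trans (cong from (Linear.f-comb linear a u b v))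
      (Linear.f-comb from-linear a _ b _) }
    ; injective = λ e → injective (trans (sym (to-from _)) (trans (cong to e) (Linear.f-𝟎 to-linear)))
    ; on-curve = λ τ → let (ρ , a , a≢0 , e) = on-curve τ in
        σ⁻¹ ρ , ∝-trans (a , a≢0 , trans (cong from e) (Linear.f-scale from-linear a _)) (pt-from ρ) }
    where
    open Aut A
    open CurveMap cm

  linear-vanishes : ∀ {a b r s} → r ≢ s → a * r + b ≡ 0# → a * s + b ≡ 0# → a ≡ 0# × b ≡ 0#
  linear-vanishes {a} {b} {r} {s} r≢s hr hs = a≡0 , (lin 3 (λ a b r → (b ⊜ κ 0) , (κ 1 ×[ a :* r :+ b ⊜ κ 0 ]) ∷
    (:- r ×[ a ⊜ κ 0 ]) ∷ []) a b r (hr , a≡0 , _))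
    where
    a≡0 : a ≡ 0#
    a≡0 = cancel-0 (λ e → r≢s (x-y≡0⇒ e)) (lin 4 (λ a b r s → ((r :- s) :* a ⊜ κ 0) , (κ 1 ×[ a :* r :+ b ⊜ κ 0 ]) ∷
      (:- (κ 1) ×[ a :* s :+ b ⊜ κ 0 ]) ∷ []) a b r s (hr , hs , _))

  quadratic-vanishes : ∀ {a b c r s t} → r ≢ s → r ≢ t → s ≢ t → a * (r * r) + b * r + c ≡ 0# → a *
    (s * s) + b * s + c ≡ 0# →
                       a * (t * t) + b * t + c ≡ 0# → a ≡ 0# × b ≡ 0# × c ≡ 0#
  quadratic-vanishes {a} {b} {c} {r} {s} {t} r≢s r≢t s≢t hr hs ht =
    let (a≡0 , e) = linear-vanishes {a} {b + a * r} s≢t (quotient s r≢s hs) (quotient t r≢t ht)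
        b≡0 = lin 3 (λ a b r → (b ⊜ κ 0) , (κ 1 ×[ b :+ a :* r ⊜ κ 0 ]) ∷ (:- r ×[ a ⊜ κ 0 ]) ∷ []) a b r
          (e , a≡0 , _)
    in a≡0 , b≡0 , (lin 4 (λ a b c r → (c ⊜ κ 0) , (κ 1 ×[ a :* (r :* r) :+ b :* r :+ c ⊜ κ 0 ]) ∷
      (:- (r :* r) ×[ a ⊜ κ 0 ]) ∷ (:- r ×[ b ⊜ κ 0 ]) ∷ []) a b c r (hr , a≡0 , b≡0 , _))
    where
    quotient : ∀ s → r ≢ s → a * (s * s) + b * s + c ≡ 0# → a * s + (b + a * r) ≡ 0#
    quotient s r≢s hs = cancel-0 (λ e → r≢s (x-y≡0⇒ e))
      (lin 5 (λ a b c r s → ((r :- s) :* (a :* s :+ (b :+ a :* r)) ⊜ κ 0) ,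
      (κ 1 ×[ a :* (r :* r) :+ b :* r :+ c ⊜ κ 0 ]) ∷
      (:- (κ 1) ×[ a :* (s :* s) :+ b :* s :+ c ⊜ κ 0 ]) ∷ []) a b c r s (hr , hs , _))

  -- q ≥ 5 provides four nonzero arguments.
  cubic-vanishes : ∀ {a b c d} → (∀ t → t ≢ 0# → a * (t * t * t) + b * (t * t) + c * t + d ≡ 0#) → a ≡ 0# × b
    ≡ 0# × c ≡ 0# × d ≡ 0#
  cubic-vanishes {a} {b} {c} {d} h = four (filterᵇ nonzero elems) (filterᵇ-unique elems-unique)
      (λ t∈ → λ { refl → T-not⁻ (proj₂ (∈-filterᵇ⁻ {p = nonzero} elems t∈)) (==⁺ refl) }) enough
    where
    nonzero : Carrier → Bool
    nonzero t = not (t == 0#)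

    enough : 4 ≤ # nonzero
    enough = ℕ.s≤s⁻¹ (subst (5 ≤_) (trans (sym (count-not (_== 0#) elems)) (cong (ℕ._+ # nonzero) #≡0)) 5≤q)

    four : ∀ ts → Unique ts → (∀ {t} → t ∈ ts → t ≢ 0#) → 4 ≤ length ts → a ≡ 0# × b ≡ 0# × c ≡ 0# × d ≡ 0#
    four (r ∷ s ∷ t ∷ u ∷ _) ((r≢s ∷ r≢t ∷ r≢u ∷ _) ∷ (s≢t ∷ s≢u ∷ _) ∷ (t≢u ∷ _) ∷ _) nz _ =
      let (a≡0 , e₁ , e₂) = quadratic-vanishes {a} {b + a * r} {c + b * r + a * (r * r)} s≢t s≢u t≢u
                              (quotient s r≢s (nz (there (here refl))))
                                (quotient t r≢t (nz (there (there (here refl)))))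
                              (quotient u r≢u (nz (there (there (there (here refl))))))
          b≡0 = lin 3 (λ a b r → (b ⊜ κ 0) , (κ 1 ×[ b :+ a :* r ⊜ κ 0 ]) ∷ (:- r ×[ a ⊜ κ 0 ]) ∷ []) a b r
            (e₁ , a≡0 , _)
          c≡0 = lin 4 (λ a b c r → (c ⊜ κ 0) , (κ 1 ×[ c :+ b :* r :+ a :* (r :* r) ⊜ κ 0 ]) ∷
            (:- (r :* r) ×[ a ⊜ κ 0 ]) ∷ (:- r ×[ b ⊜ κ 0 ]) ∷ []) a b c r (e₂ , a≡0 , b≡0 , _)
      in a≡0 , b≡0 , c≡0 , (lin 5 (λ a b c d r → (d ⊜ κ 0) , (κ 1 ×[ a :* (r :* r :* r) :+ b :*
        (r :* r) :+ c :* r :+ d ⊜ κ 0 ]) ∷ (:- (r :* r :* r) ×[ a ⊜ κ 0 ]) ∷ (:- (r :* r) ×[ b ⊜ κ 0 ]) ∷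
        (:- r ×[ c ⊜ κ 0 ]) ∷ []) a b c d r (h r (nz (here refl)) , a≡0 , b≡0 , c≡0 , _))
      where
      quotient : ∀ s → r ≢ s → s ≢ 0# → a * (s * s) + (b + a * r) * s + (c + b * r + a * (r * r)) ≡ 0#
      quotient s r≢s s≢0 = cancel-0 (λ e → r≢s (x-y≡0⇒ e))
        (lin 6 (λ a b c d r s → ((r :- s) :* (a :* (s :* s) :+ (b :+ a :* r) :* s :+
        (c :+ b :* r :+ a :* (r :* r))) ⊜ κ 0) , (κ 1 ×[ a :* (r :* r :* r) :+ b :*
        (r :* r) :+ c :* r :+ d ⊜ κ 0 ]) ∷ (:- (κ 1) ×[ a :* (s :* s :* s) :+ b :*
        (s :* s) :+ c :* s :+ d ⊜ κ 0 ]) ∷ []) a b c d r s (h r (nz (here refl)) , h s s≢0 , _))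
    four [] _ _ ()
    four (_ ∷ []) _ _ (s≤s ())
    four (_ ∷ _ ∷ []) _ _ (s≤s (s≤s ()))
    four (_ ∷ _ ∷ _ ∷ []) _ _ (s≤s (s≤s (s≤s ())))

  -- Two of the quadrics that contain the twisted cubic.
  on-cone : ∀ {x y z w} ρ → (x ∷ y ∷ z ∷ w ∷ []) ∝ pt ρ → x * z ≡ y * y × y * w ≡ z * z
  on-cone nothing (k , _ , refl) = (ring 1 (λ k → k :* κ 1 :* (k :* κ 0) ⊜ k :* κ 0 :* (k :* κ 0)) k) ,
    (ring 1 (λ k → k :* κ 0 :* (k :* κ 0) ⊜ k :* κ 0 :* (k :* κ 0)) k)
  on-cone (just t) (k , _ , refl) = (ring 2 (λ k t → k :* (t :* t :* t) :* (k :* t) ⊜ k :* (t :* t) :*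
    (k :* (t :* t))) k t) , (ring 2 (λ k t → k :* (t :* t) :* (k :* κ 1) ⊜ k :* t :* (k :* t)) k t)

  -- A linear map preserving the cubic and fixing the points of 0 and ∞ is diagonal: comparing coefficients in
  -- y₀y₂ = y₁² and y₁y₃ = y₂² along the image of P(t) kills every off-diagonal entry.
  diagonal : ∀ {f a d} → CurveMap f → a ≢ 0# → d ≢ 0# → f e₀ ≡ scale a e₀ → f e₃ ≡ scale d e₃ →
             ∃ λ e → ∃ λ h → h ≢ 0# × e ≢ 0# × a * h ≡ e * e × f e₁ ≡ scale e e₁ × f e₂ ≡ scale h e₂
  diagonal {fn} {a} {d} cm a≢0 d≢0 E₀ E₃ = go (fn e₁) (fn e₂) refl refl
    where
    open CurveMap cm
    go : ∀ X Y → fn e₁ ≡ X → fn e₂ ≡ Y → ∃ λ e → ∃ λ h → h ≢ 0# × e ≢ 0# × a * h ≡ e * e × X ≡ scale e e₁ × Y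
      ≡ scale h e₂
    go (b ∷ e ∷ g ∷ k ∷ []) (c ∷ f ∷ h ∷ l ∷ []) E₁ E₂ =
      e , h , h≢0 , e≢0 , ah≡ee ,
      vec4 (trans b≡0 (sym (zeroʳ e))) (sym (*-identityʳ e)) (trans g≡0 (sym (zeroʳ e))) (trans k≡0 (sym (zeroʳ e))) ,
      vec4 (trans c≡0 (sym (zeroʳ h))) (trans f≡0 (sym (zeroʳ h))) (sym (*-identityʳ h)) (trans l≡0 (sym (zeroʳ h)))
      where
      f-at : ∀ x y z w → fn (x ∷ y ∷ z ∷ w ∷ []) ≡
             ((a * x + b * y + c * z) ∷ (e * y + f * z) ∷ (g * y + h * z) ∷ (k * y + l * z + d * w) ∷ [])
      f-at x y z w = trans (linear-basis linear x y z w) (trans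
        (cong₂ (λ u v → comb 1# u 1# v) (cong₂ (λ u v → comb x u y v) E₀ E₁) (cong₂ (λ u v → comb z u w v) E₂ E₃))
        (vec4 (ring 8 (λ a b c d x y z w → κ 1 :* (x :* (a :* κ 1) :+ y :* b) :+ κ 1 :*
          (z :* c :+ w :* (d :* κ 0)) ⊜ a :* x :+ b :* y :+ c :* z) a b c d x y z w)
              (ring 8 (λ a e f d x y z w → κ 1 :* (x :* (a :* κ 0) :+ y :* e) :+ κ 1 :*
                (z :* f :+ w :* (d :* κ 0)) ⊜ e :* y :+ f :* z) a e f d x y z w)
              (ring 8 (λ a g h d x y z w → κ 1 :* (x :* (a :* κ 0) :+ y :* g) :+ κ 1 :*
                (z :* h :+ w :* (d :* κ 0)) ⊜ g :* y :+ h :* z) a g h d x y z w)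
              (ring 8 (λ a k l d x y z w → κ 1 :* (x :* (a :* κ 0) :+ y :* k) :+ κ 1 :*
                (z :* l :+ w :* (d :* κ 1)) ⊜ k :* y :+ l :* z :+ d :* w) a k l d x y z w)))

      cone : ∀ t → let y₁ = e * (t * t) + f * t ; y₂ = g * (t * t) + h * t in
             (a * (t * t * t) + b * (t * t) + c * t) * y₂ ≡ y₁ * y₁ × y₁ * (k * (t * t) + l * t + d * 1#) ≡ y₂ * y₂
      cone t = let (ρ , p) = on-curve (just t) in on-cone ρ (subst (_∝ pt ρ) (f-at _ _ _ _) p)

      -- Both sides of the cone equation are divisible by t². Dividing leaves a cubic polynomial,
      -- known to vanish only where t ≠ 0.
      first = cubic-vanishes {a * g} {a * h + b * g + - (e * e)} {b * h + c * g + - (ofℕ 2 * (e * f))}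
        {c * h + - (f * f)}
        (λ t t≢0 → cancel-0 (*-≢0 t≢0 t≢0)
          (lin 8 (λ a b c e f g h t → (t :* t :* (a :* g :* (t :* t :* t) :+ (a :* h :+ b :* g :- e :* e) :*
          (t :* t) :+ (b :* h :+ c :* g :- κ 2 :* (e :* f)) :* t :+ (c :* h :- f :* f)) ⊜ κ 0) ,
          (κ 1 ×[ (a :* (t :* t :* t) :+ b :* (t :* t) :+ c :* t) :* (g :* (t :* t) :+ h :* t) ⊜
          (e :* (t :* t) :+ f :* t) :* (e :* (t :* t) :+ f :* t) ]) ∷ []) a b c e f g h t (proj₁ (cone t) , _)))

      g≡0 : g ≡ 0#
      g≡0 = cancel-0 a≢0 (proj₁ first)

      second = cubic-vanishes {e * k} {e * l + f * k} {e * d + f * l + - (h * h)} {f * d}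
        (λ t t≢0 → cancel-0 t≢0 (lin 8 (λ d e f g h k l t → (t :* (e :* k :* (t :* t :* t) :+ (e :* l :+ f :* k) :*
          (t :* t) :+ (e :* d :+ f :* l :- h :* h) :* t :+ f :* d) ⊜ κ 0) , (κ 1 ×[ (e :* (t :* t) :+ f :* t) :*
          (k :* (t :* t) :+ l :* t :+ d :* κ 1) ⊜ (g :* (t :* t) :+ h :* t) :* (g :* (t :* t) :+ h :* t) ]) ∷
          (g :* t :* t :* t :* t :+ κ 2 :* h :* t :* t :* t ×[ g ⊜ κ 0 ]) ∷ []) d e f g h k l t
          (proj₂ (cone t) , g≡0 , _)))

      ah≡ee : a * h ≡ e * e
      ah≡ee = lin 5 (λ a h b g e → (a :* h ⊜ e :* e) , (κ 1 ×[ a :* h :+ b :* g :- e :* e ⊜ κ 0 ]) ∷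
        (:- b ×[ g ⊜ κ 0 ]) ∷ []) a h b g e (proj₁ (proj₂ first) , g≡0 , _)

      f≡0 : f ≡ 0#
      f≡0 = cancel-0 d≢0 (trans (*-comm d f) (proj₂ (proj₂ (proj₂ second))))

      -- With e = g = 0 the vector below is in the kernel: its first and last coordinates are chosen
      -- to cancel the contributions of b and k.
      e≢0 : e ≢ 0#
      e≢0 e≡0 = *-≢0 a≢0 d≢0 (VP.∷-injectiveˡ (VP.∷-injectiveʳ (injective { - (b * d) ∷ a * d ∷ 0# ∷ - (a * k) ∷ []}
        (trans (f-at _ _ _ _) (vec4 (ring 4 (λ a b c d → a :* :- (b :* d) :+ b :* (a :* d) :+ c :* κ 0 ⊜ κ 0) a b c d)
          (lin 4 (λ a d e f → (e :* (a :* d) :+ f :* κ 0 ⊜ κ 0) , (a :* d ×[ e ⊜ κ 0 ]) ∷ []) a d e f (e≡0 , _))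
          (lin 4 (λ a d g h → (g :* (a :* d) :+ h :* κ 0 ⊜ κ 0) , (a :* d ×[ g ⊜ κ 0 ]) ∷ []) a d g h (g≡0 , _))
          (ring 4 (λ a d k l → k :* (a :* d) :+ l :* κ 0 :+ d :* :- (a :* k) ⊜ κ 0) a d k l))))))

      h≢0 : h ≢ 0#
      h≢0 h≡0 = *-≢0 e≢0 e≢0 (trans (sym ah≡ee) (trans (cong (a *_) h≡0) (zeroʳ a)))

      k≡0 : k ≡ 0#
      k≡0 = cancel-0 e≢0 (proj₁ second)

      l≡0 : l ≡ 0#
      l≡0 = cancel-0 e≢0 (lin 4 (λ e f k l → (e :* l ⊜ κ 0) , (κ 1 ×[ e :* l :+ f :* k ⊜ κ 0 ]) ∷
        (:- k ×[ f ⊜ κ 0 ]) ∷ []) e f k l (proj₁ (proj₂ second) , f≡0 , _))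

      c≡0 : c ≡ 0#
      c≡0 = cancel-0 h≢0 (lin 3 (λ c f h → (h :* c ⊜ κ 0) , (κ 1 ×[ c :* h :- f :* f ⊜ κ 0 ]) ∷
        (f ×[ f ⊜ κ 0 ]) ∷ []) c f h (proj₂ (proj₂ (proj₂ first)) , f≡0 , _))

      b≡0 : b ≡ 0#
      b≡0 = cancel-0 h≢0 (lin 6 (λ b c e f g h → (h :* b ⊜ κ 0) , (κ 1 ×[ b :* h :+ c :* g :- κ 2 :*
        (e :* f) ⊜ κ 0 ]) ∷ (:- c ×[ g ⊜ κ 0 ]) ∷ (κ 2 :* e ×[ f ⊜ κ 0 ]) ∷ []) b c e f g h
        (proj₁ (proj₂ (proj₂ first)) , g≡0 , f≡0 , _))

  -- t³ + bt + λ under t ↦ mt + k, up to the choice of λ and of a scalar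
  affine-spans : ∀ {a b b′ k m} → m ≢ 0# → - a ≡ ofℕ 3 * k → b′ ≡ m * m * b + ofℕ 3 * (k * k) →
    let X = translate k (dilate m (U 0#)) ; Y = translate k (dilate m (V′ b)) in
    InSpan (U a) (V′ b′) X × InSpan (U a) (V′ b′) Y × InSpan X Y (U a) × InSpan X Y (V′ b′)
  affine-spans {a} {b} {b′} {k} {m} m≢0 ea eb = from-UV (m * m) 0# X≡ , from-UV (ofℕ 2 * k * m) m Y≡ ,
    (i * i , 0# , trans Ua≡ (cong₂ (λ X Y → comb (i * i) X 0# Y) (sym X≡) (sym Y≡))) ,
    (- (ofℕ 2 * k * (i * i)) , i , trans Vb≡ (cong₂ (λ X Y → comb (- (ofℕ 2 * k * (i * i))) X i Y) (sym X≡) (sym Y≡)))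
    where
    i = m ⁻¹
    mi = ⁻¹-inverse m≢0
    X′ Y′ : Vec4
    X′ = (m * m * - a + 0# * - b′) ∷ (m * m) ∷ 0# ∷ 0# ∷ []
    Y′ = (ofℕ 2 * k * m * - a + m * - b′) ∷ (ofℕ 2 * k * m) ∷ m ∷ 0# ∷ []

    X≡ : translate k (dilate m (U 0#)) ≡ X′
    X≡ = vec4 (lin 4 (λ k m a c → (m :* m :* m :* :- (κ 0) :+ κ 3 :* k :* (m :* m :* κ 1) :+ κ 3 :* (k :* k) :*
      (m :* κ 0) :+ k :* k :* k :* κ 0 ⊜ m :* m :* :- a :+ κ 0 :* :- c) ,
      (:- m :* m ×[ :- a ⊜ κ 3 :* k ]) ∷ []) k m a b′ (ea , _))
              (ring 2 (λ k m → m :* m :* κ 1 :+ κ 2 :* k :* (m :* κ 0) :+ k :* k :* κ 0 ⊜ m :* m) k m)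
                (ring 2 (λ k m → m :* κ 0 :+ k :* κ 0 ⊜ κ 0) k m) refl

    Y≡ : translate k (dilate m (V′ b)) ≡ Y′
    Y≡ = vec4 (lin 5 (λ k m a b c → (m :* m :* m :* :- b :+ κ 3 :* k :* (m :* m :* κ 0) :+ κ 3 :* (k :* k) :*
      (m :* κ 1) :+ k :* k :* k :* κ 0 ⊜ κ 2 :* k :* m :* :- a :+ m :* :- c) ,
      (:- (κ 2 :* k :* m) ×[ :- a ⊜ κ 3 :* k ]) ∷ (m ×[ c ⊜ m :* m :* b :+ κ 3 :* (k :* k) ]) ∷ []) k m a b b′
      (ea , eb , _))
              (ring 2 (λ k m → m :* m :* κ 0 :+ κ 2 :* k :* (m :* κ 1) :+ k :* k :* κ 0 ⊜ κ 2 :* k :* m) k m)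
                (ring 2 (λ k m → m :* κ 1 :+ k :* κ 0 ⊜ m) k m) refl

    from-UV : ∀ x y {w} → w ≡ ((x * - a + y * - b′) ∷ x ∷ y ∷ 0# ∷ []) → InSpan (U a) (V′ b′) w
    from-UV x y e = x , y , trans e (sym (UV-comb x y a b′))

    Ua≡ : U a ≡ comb (i * i) X′ 0# Y′
    Ua≡ = vec4 (lin 5 (λ i m k a c → (:- a ⊜ i :* i :* (m :* m :* :- a :+ κ 0 :* :- c) :+ κ 0 :*
      (κ 2 :* k :* m :* :- a :+ m :* :- c)) , (a :* (m :* i :+ κ 1) ×[ m :* i ⊜ κ 1 ]) ∷ []) i m k a b′ (mi , _))
               (lin 3 (λ i m k → (κ 1 ⊜ i :* i :* (m :* m) :+ κ 0 :* (κ 2 :* k :* m)) ,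
                 (:- (m :* i :+ κ 1) ×[ m :* i ⊜ κ 1 ]) ∷ []) i m k (mi , _))
               (ring 2 (λ i m → κ 0 ⊜ i :* i :* κ 0 :+ κ 0 :* m) i m)
                 (ring 1 (λ i → κ 0 ⊜ i :* i :* κ 0 :+ κ 0 :* κ 0) i)

    Vb≡ : V′ b′ ≡ comb (- (ofℕ 2 * k * (i * i))) X′ i Y′
    Vb≡ = vec4 (lin 5 (λ i m k a c → (:- c ⊜ :- (κ 2 :* k :* (i :* i)) :* (m :* m :* :- a :+ κ 0 :* :- c) :+ i :*
      (κ 2 :* k :* m :* :- a :+ m :* :- c)) , (c :- κ 2 :* k :* a :* m :* i ×[ m :* i ⊜ κ 1 ]) ∷ []) i m k a b′
      (mi , _))
               (lin 3 (λ i m k → (κ 0 ⊜ :- (κ 2 :* k :* (i :* i)) :* (m :* m) :+ i :* (κ 2 :* k :* m)) ,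
                 (κ 2 :* k :* m :* i ×[ m :* i ⊜ κ 1 ]) ∷ []) i m k (mi , _))
               (lin 3 (λ i m k → (κ 1 ⊜ :- (κ 2 :* k :* (i :* i)) :* κ 0 :+ i :* m) ,
                 (:- (κ 1) ×[ m :* i ⊜ κ 1 ]) ∷ []) i m k (mi , _))
                 (ring 2 (λ i k → κ 0 ⊜ :- (κ 2 :* k :* (i :* i)) :* κ 0 :+ i :* κ 0) i k)

  -- s ↦ σ + 1/(κs + k), or s ↦ κs + k for τ = ∞
  Wᴬ : ∀ (τ : PG₁) (k : Carrier) {κ} → κ ≢ 0# → Aut
  Wᴬ τ k κ≢0 = Fᴬ τ ∘ᴬ Tᴬ k ∘ᴬ Dᴬ κ≢0

  W-line : PG₁ → Carrier → ∀ {κ} → κ ≢ 0# → Carrier → Line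
  W-line τ k κ≢0 b = lineThrough (Aut.to (Wᴬ τ k κ≢0) (U 0#)) (Aut.to (Wᴬ τ k κ≢0) (V′ b))

  W-line≡ : ∀ τ {k m a b b′} (m≢0 : m ≢ 0#) → - a ≡ ofℕ 3 * k → b′ ≡ m * m * b + ofℕ 3 * (k * k) → W-line τ k m≢0 b
    ≡ line τ a b′
  W-line≡ τ m≢0 ea eb = let (s₁ , s₂ , s₃ , s₄) = affine-spans m≢0 ea eb in Linear.f-line-cong
    (Aut.to-linear (Fᴬ τ)) s₁ s₂ s₃ s₄

  -- Membership in the orbit of `line nothing 0# b` expressed by three parameters of an explicit map
  -- instead of an arbitrary matrix.
  record OrbitLine (b : Carrier) (ℓ : Line) : Set where
    constructor orbitLine
    field
      τ       : PG₁
      k       : Carrier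
      {m}     : Carrier
      m≢0     : m ≢ 0#
      ℓ≡      : ℓ ≡ W-line τ k m≢0 b

  orbit⁺ : ∀ {b ℓ} → OrbitLine b ℓ → T (inOrbit (line nothing 0# b) ℓ)
  orbit⁺ {b} (orbitLine τ k m≢0 refl) = inOrbit⁺ (Wᴬ τ k m≢0) (U 0#) (V′ b)

  private
    P0≡e₃ : P 0# ≡ e₃
    P0≡e₃ = vec4 (ring 0 (κ 0 :* κ 0 :* κ 0 ⊜ κ 0)) (ring 0 (κ 0 :* κ 0 ⊜ κ 0)) refl refl

    -- If 0 and ∞ had the same image, injectivity would force yP(0) - xP∞ = 0, whose last coordinate
    -- is y.
    CurveMap-≢∞ : ∀ {f x y} → CurveMap f → y ≢ 0# → f (P 0#) ≡ scale x P∞ → f P∞ ≡ scale y P∞ → ⊥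
    CurveMap-≢∞ {f} {x} {y} cm y≢0 h₀ h∞ = y≢0 (trans (ring 2 (λ x y → y ⊜ y :* κ 1 :+ :- x :* κ 0) x y)
      (VP.∷-injectiveˡ (VP.∷-injectiveʳ (VP.∷-injectiveʳ (VP.∷-injectiveʳ
      (injective {comb y (P 0#) (- x) P∞} (trans (Linear.f-comb linear y (P 0#) (- x) P∞)
        (trans (cong₂ (λ u v → comb y u (- x) v) h₀ h∞)
        (vec4 (ring 2 (λ x y → y :* (x :* κ 1) :+ :- x :* (y :* κ 1) ⊜ κ 0) x y)
          (ring 2 (λ x y → y :* (x :* κ 0) :+ :- x :* (y :* κ 0) ⊜ κ 0) x y)
              (ring 2 (λ x y → y :* (x :* κ 0) :+ :- x :* (y :* κ 0) ⊜ κ 0) x y)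
                (ring 2 (λ x y → y :* (x :* κ 0) :+ :- x :* (y :* κ 0) ⊜ κ 0) x y))))))))))
      where open CurveMap cm

  fixing-0∞ : ∀ {f b a d} → CurveMap f → a ≢ 0# → d ≢ 0# → f e₀ ≡ scale a e₀ → f e₃ ≡ scale d e₃ →
              ∃ λ m → m ≢ 0# × f (U 0#) ∝ dilate m (U 0#) × f (V′ b) ∝ dilate m (V′ b)
  fixing-0∞ {f} {b} {a} {d} cm a≢0 d≢0 E₀ E₃ =
    let (e , h , h≢0 , e≢0 , ah≡ee , E₁ , E₂) = diagonal cm a≢0 d≢0 E₀ E₃
        i = h ⁻¹ ; j = e ⁻¹ ; hi = ⁻¹-inverse h≢0 ; ej = ⁻¹-inverse e≢0
    -- The ratio m = e/h: the entries m³, m², m times h²/e are e²/h = a, e and h. The last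
    -- coordinate vanishes on `U 0#` and `V′ b`.
    in e * i , *-≢0 e≢0 (⁻¹-≢0 h≢0) ,
       (h * h * j , *-≢0 (*-≢0 h≢0 h≢0) (⁻¹-≢0 e≢0) , trans (cong f U0≡e₁) (trans E₁ (vec4
         (ring 4 (λ e h i j → e :* κ 0 ⊜ h :* h :* j :* (e :* i :* (e :* i) :* (e :* i) :* :- (κ 0))) e h i j)
         (lin 4 (λ e h i j → (e :* κ 1 ⊜ h :* h :* j :* (e :* i :* (e :* i) :* κ 1)) ,
           (:- (e :* e :* j :* (h :* i :+ κ 1)) ×[ h :* i ⊜ κ 1 ]) ∷ (:- e ×[ e :* j ⊜ κ 1 ]) ∷ []) e h i j
           (hi , ej , _))
         (ring 4 (λ e h i j → e :* κ 0 ⊜ h :* h :* j :* (e :* i :* κ 0)) e h i j)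
           (ring 3 (λ e h j → e :* κ 0 ⊜ h :* h :* j :* κ 0) e h j)))) ,
       (h * h * j , *-≢0 (*-≢0 h≢0 h≢0) (⁻¹-≢0 e≢0) , trans (cong f V≡) (trans (Linear.f-comb linear (- b) e₀ 1# e₂)
         (trans (cong₂ (λ u v → comb (- b) u 1# v) E₀ E₂) (vec4
         (lin 6 (λ a b e h i j → (:- b :* (a :* κ 1) :+ κ 1 :* (h :* κ 0) ⊜ h :* h :* j :*
           (e :* i :* (e :* i) :* (e :* i) :* :- b)) , (a :* b :+ b :* e :* e :* e :* j :* i :*
           (h :* i :+ κ 1) ×[ h :* i ⊜ κ 1 ]) ∷ (e :* e :* i :* b ×[ e :* j ⊜ κ 1 ]) ∷
           (:- b :* i ×[ a :* h ⊜ e :* e ]) ∷ []) a b e h i j (hi , ej , ah≡ee , _))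
         (ring 6 (λ a b e h i j → :- b :* (a :* κ 0) :+ κ 1 :* (h :* κ 0) ⊜ h :* h :* j :*
           (e :* i :* (e :* i) :* κ 0)) a b e h i j)
         (lin 6 (λ a b e h i j → (:- b :* (a :* κ 0) :+ κ 1 :* (h :* κ 1) ⊜ h :* h :* j :* (e :* i :* κ 1)) ,
           (:- (h :* e :* j) ×[ h :* i ⊜ κ 1 ]) ∷ (:- h ×[ e :* j ⊜ κ 1 ]) ∷ []) a b e h i j (hi , ej , _))
         (ring 4 (λ a b h j → :- b :* (a :* κ 0) :+ κ 1 :* (h :* κ 0) ⊜ h :* h :* j :* κ 0) a b h j)))))
    where
    open CurveMap cm
    U0≡e₁ : U 0# ≡ e₁
    U0≡e₁ = vec4 (ring 0 (:- (κ 0) ⊜ κ 0)) refl refl refl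
    V≡ : V′ b ≡ comb (- b) e₀ 1# e₂
    V≡ = vec4 (ring 1 (λ b → :- b ⊜ :- b :* κ 1 :+ κ 1 :* κ 0) b) (ring 1 (λ b → κ 0 ⊜ :- b :* κ 0 :+ κ 1 :* κ 0) b)
      (ring 1 (λ b → κ 1 ⊜ :- b :* κ 0 :+ κ 1 :* κ 1) b) (ring 1 (λ b → κ 0 ⊜ :- b :* κ 0 :+ κ 1 :* κ 0) b)

  orbit⁻ : ∀ {b ℓ} → T (inOrbit (line nothing 0# b) ℓ) → OrbitLine b ℓ
  orbit⁻ {b} {ℓ} t =
    let (M , _ , t′) = any-T {p = λ M → inGq M ∧ (imageLine M (line nothing 0# b) =l ℓ)} allMats t
        (gq , e) = T-∧⁻ {inGq M} t′
    in with-map (inGq⇒CurveMap {M} gq) (trans (sym (toWitness e)) (imageLine-span M (U 0#) (V′ b)))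
    where
    with-map : ∀ {f} → CurveMap f → ℓ ≡ lineThrough (f (U 0#)) (f (V′ b)) → OrbitLine b ℓ
    with-map {f} cm ℓ≡ = move-∞ (CurveMap.on-curve cm nothing)
      where
      move-0 : ∀ τ y → y ≢ 0# → Aut.from (Fᴬ τ) (f P∞) ≡ scale y P∞ → ∃ (λ ρ → Aut.from (Fᴬ τ) (f (P 0#)) ∝ pt ρ) →
        OrbitLine b ℓ
      move-0 τ y y≢0 h∞ (nothing , x , _ , h₀) = ⊥-elim (CurveMap-≢∞ (after (Fᴬ τ) cm) y≢0 h₀ h∞)
      move-0 τ y y≢0 h∞ (just k , x , x≢0 , h₀) =
        let (m , m≢0 , (c , c≢0 , eu) , (c′ , c′≢0 , ev)) = fixing-0∞ {b = b} (after B (after A cm)) (*-≢0 y≢0 (proj₁ (proj₂ fix∞))) (*-≢0 x≢0 (proj₁ (proj₂ fix0))) E₀ E₃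
        in orbitLine τ k m≢0 (trans ℓ≡ (trans (cong₂ lineThrough (image eu) (image ev))
          (line-scale (A.to (B.to (dilate m (U 0#)))) (A.to (B.to (dilate m (V′ b)))) c≢0 c′≢0)))
        where
        A = Fᴬ τ
        B = Tᴬ k
        module A = Aut A
        module B = Aut B
        fix∞ = B.pt-from nothing
        fix0 = B.pt-from (just k)
        g : Vec4 → Vec4
        g = B.from ∘ A.from ∘ f

        E₀ : g e₀ ≡ scale (y * proj₁ fix∞) e₀
        E₀ = trans (cong B.from h∞) (trans (Linear.f-scale B.from-linear y P∞)
          (trans (cong (scale y) (proj₂ (proj₂ fix∞))) (scale-scale y _ P∞)))

        E₃ : g e₃ ≡ scale (x * proj₁ fix0) e₃
        E₃ = trans (cong g (sym P0≡e₃)) (trans (cong B.from h₀) (trans (Linear.f-scale B.from-linear x (P k))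
          (trans (cong (scale x) (proj₂ (proj₂ fix0)))
          (trans (scale-scale x _ _) (cong (scale (x * proj₁ fix0)) (trans (cong P (-‿inverseʳ k)) P0≡e₃))))))

        image : ∀ {v w c} → g v ≡ scale c w → f v ≡ scale c (A.to (B.to w))
        image {v} {w} {c} e = begin
          f v                               ≡⟨ A.to-from (f v) ⟨
          A.to (A.from (f v))               ≡⟨ cong A.to (B.to-from _) ⟨
          A.to (B.to (g v))                 ≡⟨ cong (A.to ∘ B.to) e ⟩
          A.to (B.to (scale c w))           ≡⟨ cong A.to (Linear.f-scale B.to-linear c w) ⟩
          A.to (scale c (B.to w))           ≡⟨ Linear.f-scale A.to-linear c _ ⟩
          scale c (A.to (B.to w))           ∎

      move-∞ : ∃ (λ τ → f P∞ ∝ pt τ) → OrbitLine b ℓ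
      move-∞ (τ , x , x≢0 , e) =
        let (y , y≢0 , e′) = subst (A.from (pt τ) ∝_) (cong pt (trans (cong A.σ⁻¹ (sym (F-∞ τ))) (A.σ⁻¹-σ nothing))) (A.pt-from τ)
        in move-0 τ (x * y) (*-≢0 x≢0 y≢0) (trans (cong A.from e) (trans (Linear.f-scale A.from-linear x _)
          (trans (cong (scale x) e′) (scale-scale x y P∞))))
             (CurveMap.on-curve (after (Fᴬ τ) cm) (just 0#))
        where module A = Aut (Fᴬ τ)

  -- The product of two nonzero elements of one class is a square r², and m = r/y.
  same-class : ∀ {x y} → y ≢ 0# → χ x ≡ χ y → ∃ λ m → m ≢ 0# × x ≡ m * m * y
  same-class {x} {y} y≢0 e =
    let (r , r≢0 , rr) = χ-square⁻ (trans (χ-* x y) (trans (cong (_· χ y) e) (self (χ y) (χ≢null y≢0)))) in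
    r * y ⁻¹ , *-≢0 r≢0 (⁻¹-≢0 y≢0) ,
    (lin 4 (λ x y r i → (x ⊜ r :* i :* (r :* i) :* y) , (:- (i :* i :* y) ×[ r :* r ⊜ x :* y ]) ∷
      (:- (x :* (y :* i :+ κ 1)) ×[ y :* i ⊜ κ 1 ]) ∷ []) x y r (y ⁻¹) (rr , ⁻¹-inverse y≢0 , _))
    where
    self : ∀ c → c ≢ null → c · c ≡ square
    self null      h = ⊥-elim (h refl)
    self square    _ = refl
    self nonsquare _ = refl

  -- Depressing t³ + at² + b′t by the shift a/3 leaves the linear coefficient -(a² - 3b′)/3, and
  -- dilations multiply it by arbitrary nonzero squares.
  orbit-line⁺ : ∀ {b} τ a b′ → b ≢ 0# → χ (pencil-disc a b′) ≡ χ (- ofℕ 3 * b) → OrbitLine b (line τ a b′)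
  orbit-line⁺ {b} τ a b′ b≢0 e =
    let (m , m≢0 , h) = same-class (*-≢0 (-‿≢0 3≢0) b≢0) e in
    orbitLine τ (- (⅓ * a)) m≢0 (sym
      (W-line≡ τ m≢0 (lin 2 (λ a i → (:- a ⊜ κ 3 :* :- (i :* a)) , (a ×[ κ 3 :* i ⊜ κ 1 ]) ∷ []) a ⅓ (⅓-inverse , _))
      (cancel 3≢0 (lin 5 (λ a b c m i → (κ 3 :* c ⊜ κ 3 :* (m :* m :* b :+ κ 3 :* (:- (i :* a) :* :- (i :* a)))) ,
        (:- (κ 1) ×[ a :* a :- κ 3 :* c ⊜ m :* m :* (:- (κ 3) :* b) ]) ∷
        (:- (a :* a :* (κ 3 :* i :+ κ 1)) ×[ κ 3 :* i ⊜ κ 1 ]) ∷ []) a b b′ m ⅓ (h , ⅓-inverse , _)))))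

  orbit-line⁻ : ∀ {b ℓ} → OrbitLine b ℓ → ∃ λ τ → ∃ λ a → ∃ λ b′ → ℓ ≡ line τ a b′ × χ (pencil-disc a b′) ≡ χ
    (- ofℕ 3 * b)
  orbit-line⁻ {b} (orbitLine τ k {m} m≢0 ℓ≡) = τ , - (ofℕ 3 * k) , m * m * b + ofℕ 3 * (k * k) ,
    trans ℓ≡ (W-line≡ τ m≢0 (ring 1 (λ k → :- (:- (κ 3 :* k)) ⊜ κ 3 :* k) k) refl) ,
    trans (cong χ (ring 3 (λ k m b → :- (κ 3 :* k) :* :- (κ 3 :* k) :- κ 3 :*
      (m :* m :* b :+ κ 3 :* (k :* k)) ⊜ m :* m :* (:- (κ 3) :* b)) k m b)) (χ-*-square (χ-square m≢0 refl))

-- Unique parameters of lines, and the counts for an orbit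

module OrbitCounts (F : FiniteField) (2≢0 : PG.ofℕ F 2 ≢ FiniteField.0# F) (3≢0 : PG.ofℕ F 3 ≢ FiniteField.0# F)
  (5≤q : 5 ≤ FiniteField.q F) where
  open GqOrbits F 2≢0 3≢0 5≤q public
  open ≡-Reasoning

  osc-through-line∞ : ∀ {a b} ρ → pencil-disc a b ≢ 0# → dot (oscₚ ρ) (U a) ≡ 0# → dot (oscₚ ρ) (V′ b) ≡ 0# → ρ
    ≡ nothing
  osc-through-line∞ nothing _ _ _ = refl
  osc-through-line∞ {a} {b} (just s) h eu ev = ⊥-elim
    (h (lin 3 (λ a b s → (a :* a :- κ 3 :* b ⊜ κ 0) , (:- (a :- κ 3 :* s) ×[ κ 1 :* :- a :+
    (:- (κ 3 :* s) :* κ 1 :+ (κ 3 :* (s :* s) :* κ 0 :+ (:- (s :* s :* s) :* κ 0 :+ κ 0))) ⊜ κ 0 ]) ∷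
    (κ 3 ×[ κ 1 :* :- b :+ (:- (κ 3 :* s) :* κ 0 :+ (κ 3 :* (s :* s) :* κ 1 :+
    (:- (s :* s :* s) :* κ 0 :+ κ 0))) ⊜ κ 0 ]) ∷ []) a b s (eu , ev , _)))

  pull-contains⁻ : ∀ A {π u v} → T (containsLine π (lineThrough (Aut.to A u) (Aut.to A v))) → dot (pull A π) u
    ≡ 0# × dot (pull A π) v ≡ 0#
  pull-contains⁻ A {π} {u} {v} c =
    trans (dot-pull A π u) (containsLine⁻ {π} {Aut.to A u} {Aut.to A v} c (span-left _ _)) ,
    trans (dot-pull A π v) (containsLine⁻ {π} {Aut.to A u} {Aut.to A v} c (span-right _ _))

  pull-contains⁺ : ∀ A {π u v} → dot (pull A π) u ≡ 0# → dot (pull A π) v ≡ 0# → T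
    (containsLine π (lineThrough (Aut.to A u) (Aut.to A v)))
  pull-contains⁺ A {π} {u} {v} eu ev =
    containsLine⁺ {π} {Aut.to A u} {Aut.to A v} (trans (sym (dot-pull A π u)) eu) (trans (sym (dot-pull A π v)) ev)

  σ⁻¹-F : ∀ τ → Aut.σ⁻¹ (Fᴬ τ) τ ≡ nothing
  σ⁻¹-F τ = trans (cong (Aut.σ⁻¹ (Fᴬ τ)) (sym (F-∞ τ))) (Aut.σ⁻¹-σ (Fᴬ τ) nothing)

  osc-contains-line : ∀ τ a b → T (containsLine (oscₚ τ) (line τ a b))
  osc-contains-line τ a b = let (k , _ , e) = pull-osc (Fᴬ τ) τ
                                e′ = trans e (cong (scale k ∘ oscₚ) (σ⁻¹-F τ)) in
    pull-contains⁺ (Fᴬ τ) {oscₚ τ} {U a} {V′ b}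
      (trans (cong (λ π → dot π (U a)) e′)
        (ring 2 (λ k a → k :* κ 0 :* :- a :+
        (k :* κ 0 :* κ 1 :+ (k :* κ 0 :* κ 0 :+ (k :* κ 1 :* κ 0 :+ κ 0))) ⊜ κ 0) k a))
      (trans (cong (λ π → dot π (V′ b)) e′)
        (ring 2 (λ k b → k :* κ 0 :* :- b :+
        (k :* κ 0 :* κ 0 :+ (k :* κ 0 :* κ 1 :+ (k :* κ 1 :* κ 0 :+ κ 0))) ⊜ κ 0) k b))

  -- The plane `oscₚ τ′` contains the common line; pulled back by `Fᴬ τ` it becomes an osculating
  -- plane through a line at ∞ that is not a real axis, and only `osc∞` qualifies.
  line-τ-unique : ∀ {τ τ′ a b a′ b′} → pencil-disc a b ≢ 0# → line τ a b ≡ line τ′ a′ b′ → τ′ ≡ τ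
  line-τ-unique {τ} {τ′} {a} {b} {a′} {b′} h e =
    let (k , k≢0 , e′) = pull-osc (Fᴬ τ) τ′
        (eu , ev) = pull-contains⁻ (Fᴬ τ) {oscₚ τ′} {U a} {V′ b} (subst (T ∘ containsLine (oscₚ τ′)) (sym e)
          (osc-contains-line τ′ a′ b′))
        ρ = Aut.σ⁻¹ (Fᴬ τ) τ′
        drop : ∀ X → dot (pull (Fᴬ τ) (oscₚ τ′)) X ≡ 0# → dot (oscₚ ρ) X ≡ 0#
        drop X h = cancel-0 k≢0 (trans (sym (scale-dot k (oscₚ ρ) X)) (trans (cong (λ π → dot π X) (sym e′)) h))
    in begin
      τ′                          ≡⟨ Aut.σ-σ⁻¹ (Fᴬ τ) τ′ ⟨
      Aut.σ (Fᴬ τ) ρ ≡⟨ cong (Aut.σ (Fᴬ τ)) (osc-through-line∞ {a} {b} ρ h (drop (U a) eu) (drop (V′ b) ev)) ⟩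
      Aut.σ (Fᴬ τ) nothing        ≡⟨ F-∞ τ ⟩
      τ                           ∎

  line-ab-unique : ∀ τ {a b a′ b′} → line τ a b ≡ line τ a′ b′ → a ≡ a′ × b ≡ b′
  line-ab-unique τ {a} {b} {a′} {b′} e =
    same-a (back (span-left (to (U a)) (to (V′ b)))) , same-b (back (span-right (to (U a)) (to (V′ b))))
    where
    open Aut (Fᴬ τ)
    back : ∀ {w} → InSpan (to (U a)) (to (V′ b)) (to w) → InSpan (U a′) (V′ b′) w
    back {w} s = subst (InSpan (U a′) (V′ b′)) (from-to w) (from-span (Fᴬ τ) (line-≡⇒span {to (U a)} {to (V′ b)}
      {to (U a′)} {to (V′ b′)} e s))

    entries : ∀ {x y p r s t} → (p ∷ r ∷ s ∷ t ∷ []) ≡ comb x (U a′) y (V′ b′) → p ≡ r * - a′ + s * - b′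
    entries {x} {y} h with refl ← trans h (UV-comb x y a′ b′) = refl

    same-a : InSpan (U a′) (V′ b′) (U a) → a ≡ a′
    same-a (x , y , h) = lin 3 (λ a c d → (a ⊜ c) , (:- (κ 1) ×[ :- a ⊜ κ 1 :* :- c :+ κ 0 :* :- d ]) ∷ []) a a′ b′
      (entries h , _)

    same-b : InSpan (U a′) (V′ b′) (V′ b) → b ≡ b′
    same-b (x , y , h) = lin 3 (λ b c d → (b ⊜ d) , (:- (κ 1) ×[ :- b ⊜ κ 0 :* :- c :+ κ 1 :* :- d ]) ∷ []) b a′ b′
      (entries h , _)

  line-injective : ∀ {τ τ′ a b a′ b′} → pencil-disc a b ≢ 0# → line τ a b ≡ line τ′ a′ b′ → (τ , a , b) ≡
    (τ′ , a′ , b′)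
  line-injective {τ} {τ′} {a} {b} {a′} {b′} h e = case line-τ-unique {τ} {τ′} {a} {b} {a′} {b′} h e of λ
    { refl → let (ea , eb) = line-ab-unique τ {a} {b} {a′} {b′} e in cong₂ (λ a b → τ , a , b) ea eb }

  pencil-disc-unique : ∀ {τ τ′ a b a′ b′} → pencil-disc a b ≢ 0# → line τ a b ≡ line τ′ a′ b′ → pencil-disc a b
    ≡ pencil-disc a′ b′
  pencil-disc-unique {τ} {τ′} {a} {b} {a′} {b′} h e =
    cong (λ (_ , a , b) → pencil-disc a b) (line-injective {τ} {τ′} {a} {b} {a′} {b′} h e)

  -- One orbit, indexed by the class of `pencil-disc`

  module Orbit (c : Class) (c≢null : c ≢ null) (b : Carrier) (χ≡c : χ (- ofℕ 3 * b) ≡ c) where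
    ℓ₀ : Line
    ℓ₀ = line nothing 0# b

    ℓ₀∈lines : ℓ₀ ∈ lines
    ℓ₀∈lines = line-∈ nothing 0# b

    O : Line → Bool
    O = inOrbit ℓ₀

    b≢0 : b ≢ 0#
    b≢0 refl = c≢null (trans (sym χ≡c) (χ-null (zeroʳ _)))

    O⁺ : ∀ τ a b′ → χ (pencil-disc a b′) ≡ c → T (O (line τ a b′))
    O⁺ τ a b′ e = orbit⁺ (orbit-line⁺ τ a b′ b≢0 (trans e (sym χ≡c)))

    O⁻ : ∀ {ℓ} → T (O ℓ) → ∃ λ τ → ∃ λ a → ∃ λ b′ → ℓ ≡ line τ a b′ × χ (pencil-disc a b′) ≡ c
    O⁻ {ℓ} t = let (τ , a , b′ , e , h) = orbit-line⁻ (orbit⁻ {b} {ℓ} t) in τ , a , b′ , e , trans h χ≡c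

    nonzero : ∀ {x} → χ x ≡ c → x ≢ 0#
    nonzero e = χ≢null⁻ (c≢null ∘ trans (sym e))

    ∉-O : ∀ {b′} → χ (- ofℕ 3 * b′) ≢ null → χ (- ofℕ 3 * b′) ≢ c → ¬ T (O (line nothing 0# b′))
    ∉-O {b′} h h′ t = let (τ , a , b″ , e , h″) = O⁻ {line nothing 0# b′} t in
      h′ (trans (cong χ (sym pd≡)) (trans (cong χ (pencil-disc-unique {nothing} {τ} {0#} {b′} {a} {b″}
        (χ≢null⁻ (h ∘ trans (cong χ (sym pd≡)))) e)) h″))
      where
      pd≡ : pencil-disc 0# b′ ≡ - ofℕ 3 * b′
      pd≡ = ring 1 (λ b → κ 0 :* κ 0 :- κ 3 :* b ⊜ :- (κ 3) :* b) b′

    O⇒EΓ : ∀ {ℓ} → T (O ℓ) → T (isEΓLine ℓ)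
    O⇒EΓ {ℓ} t = let (τ , a , b′ , e , h) = O⁻ {ℓ} t in subst (T ∘ isEΓLine) (sym e) (EΓ-line⁺ τ a b′ (nonzero h))

    private
      parameters : List (PG₁ × Carrier × Carrier)
      parameters = cartesianProduct PG₁-elems (cartesianProduct elems elems)

      of-class : PG₁ × Carrier × Carrier → Bool
      of-class (τ , a , b) = is c (pencil-disc a b)

      -- The parameters (τ, a, b) of an EΓ-line are unique. There are q + 1 values of τ and q of a,
      -- and for each a the map b ↦ a² - 3b is a bijection of the field.
      size≡parameters : size O ≡ count of-class parameters
      size≡parameters = sym (count-bij {p = of-class} (Unique.cartesianProduct⁺ PG₁-unique pairs-unique) lines-unique
        (λ (τ , a , b) → line τ a b)
        (λ {(τ , a , b)} {(τ′ , a′ , b′)} _ t _ _ e → line-injective {τ} {τ′} {a} {b} {a′} {b′} (nonzero (is⁻ t)) e)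
        {r = O} (λ {(τ , a , b)} _ t → line-∈ τ a b , O⁺ τ a b (is⁻ t))
        (λ {ℓ} _ t → let (τ , a , b′ , e , h) = O⁻ {ℓ} t in
          (τ , a , b′) , ∈-cartesianProduct⁺ (PG₁-complete τ) (pairs-complete (a , b′)) , is⁺ h , sym e))

      #pencils : ∀ a → # (λ b → is c (pencil-disc a b)) ≡ # (is c)
      #pencils a = #-bij (pencil-disc a) (λ y → ⅓ * (a * a + - y))
        (λ b → (lin 3 (λ a b t → (t :* (a :* a :- (a :* a :- κ 3 :* b)) ⊜ b) , (b ×[ κ 3 :* t ⊜ κ 1 ]) ∷ []) a b ⅓
          (⅓-inverse , _)))
        (λ y → (lin 3 (λ a y t → (a :* a :- κ 3 :* (t :* (a :* a :- y)) ⊜ y) ,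
          (:- (a :* a :- y) ×[ κ 3 :* t ⊜ κ 1 ]) ∷ []) a y ⅓ (⅓-inverse , _)))
        (λ h → h) (λ h → h)

      ∑-const : ∀ {A : Set} (xs : List A) k → ∑ xs (λ _ → k) ≡ k ℕ.* length xs
      ∑-const xs k = trans (∑-cong xs (λ _ _ → sym (ℕP.*-identityʳ k))) (trans (∑-* k (λ _ → 1) xs)
        (cong (k ℕ.*_) (∑-1 xs)))

      count-parameters : count of-class parameters ≡ # (is c) ℕ.* q ℕ.* suc q
      count-parameters = begin
        count of-class parameters ≡⟨ count-product of-class PG₁-elems (cartesianProduct elems elems) ⟩
        ∑ PG₁-elems (λ τ → count (λ (a , b) → is c (pencil-disc a b)) (cartesianProduct elems elems))
          ≡⟨ ∑-const PG₁-elems _ ⟩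
        count (λ (a , b) → is c (pencil-disc a b)) (cartesianProduct elems elems) ℕ.* length PG₁-elems
          ≡⟨ cong₂ ℕ._*_ (trans (count-product (λ (a , b) → is c (pencil-disc a b)) elems elems)
                           (trans (∑-cong elems (λ a _ → #pencils a)) (∑-const elems _)))
                             (cong suc (LP.length-map just elems)) ⟩
        # (is c) ℕ.* q ℕ.* suc q                                                             ∎

      #class : ∀ c → c ≢ null → # (is c) ≡ # (is square)
      #class null      h = ⊥-elim (h refl)
      #class square    _ = refl
      #class nonsquare _ = #nonsquare≡#square

    2size≡q³∸q : 2 ℕ.* size O ≡ q ^ 3 ∸ q
    2size≡q³∸q = trans (cong (2 ℕ.*_) (trans size≡parameters (trans count-parameters (cong (λ n → n ℕ.* q ℕ.* suc q)
      (#class c c≢null)))))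
      (orbit-size (# (is square)) q 1+2#square≡q)

    private
      plane : Carrier → Plane
      plane d = 1# ∷ 0# ∷ b ∷ d ∷ []

      plane-∈ : ∀ d → plane d ∈ points
      plane-∈ d = ∈-points {plane d} leading
        where
        leading : T (normalised (plane d))
        leading with 1# ≟ 0#
        ... | yes e = ⊥-elim (1≢0 e)
        ... | no _  = ==⁺ refl

      plane-contains : ∀ d → T (containsLine (plane d) ℓ₀)
      plane-contains d = contains-line∞⁺ {a = 0#} {b} (sym (zeroˡ 1#)) (sym (*-identityʳ b))

      through-ℓ₀ : ∀ {π} → π ∈ points → T (containsLine π ℓ₀) → π ≡ osc∞ ⊎ ∃ λ d → π ≡ plane d
      through-ℓ₀ {c₀ ∷ c₁ ∷ c₂ ∷ c₃ ∷ []} π∈ t =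
        let (e₁ , e₂) = contains-line∞⁻ {c₀} {c₁} {c₂} {c₃} {0#} {b} t in case c₀ ≟ 0# of λ
        { (yes refl) → inj₁ (∝⇒≡ π∈ osc∞-∈ (c₃ ,
            (λ { refl → points≢𝟎 π∈ (vec4 refl (trans e₁ (zeroˡ _)) (trans e₂ (zeroʳ b)) refl) }) ,
            vec4 (sym (zeroʳ c₃)) (trans e₁ (trans (zeroˡ 0#) (sym (zeroʳ c₃))))
              (trans e₂ (trans (zeroʳ b) (sym (zeroʳ c₃)))) (sym (*-identityʳ c₃))))
        ; (no c₀≢0) → inj₂ (c₀ ⁻¹ * c₃ , ∝⇒≡ π∈ (plane-∈ _) (c₀ , c₀≢0 ,
            vec4 (sym (*-identityʳ c₀)) (trans e₁ (ring 1 (λ c → κ 0 :* c ⊜ c :* κ 0) c₀)) (trans e₂ (*-comm b c₀))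
              (lin 3 (λ c i d → (d ⊜ c :* (i :* d)) , (:- d ×[ c :* i ⊜ κ 1 ]) ∷ []) c₀ (c₀ ⁻¹) c₃
                (⁻¹-inverse c₀≢0 , _)))) }

      Π-ℓ₀ : ∀ type → ¬ T (type osc∞) → Π[ type ∣ ℓ₀ ] ≡ # (type ∘ plane)
      Π-ℓ₀ type ¬∞ = sym (count-bij {p = type ∘ plane} elems-unique points-unique plane
        (λ _ _ _ _ e → VP.∷-injectiveˡ (VP.∷-injectiveʳ (VP.∷-injectiveʳ (VP.∷-injectiveʳ e))))
        {r = λ π → type π ∧ containsLine π ℓ₀} (λ {d} _ t → plane-∈ d , T-∧⁺ t (plane-contains d))
        (λ {π} π∈ t → let (tπ , c) = T-∧⁻ {type π} t in case through-ℓ₀ π∈ c of λ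
          { (inj₁ refl) → ⊥-elim (¬∞ tπ) ; (inj₂ (d , refl)) → d , elems-complete d , tπ , refl }))

      osc∞-Γ : T (isΓPlane osc∞)
      osc∞-Γ = isΓ-osc⁺ {osc∞} nothing ∝-refl

      plane-¬Γ : ∀ d → ¬ T (isΓPlane (plane d))
      plane-¬Γ d t = let (τ , k , k≢0 , e) = isΓ-osc⁻ {plane d} t in
        no-multiple k k≢0 τ e
          (osc-through-line∞ {0#} {b} τ (nonzero
            (trans (cong χ (ring 1 (λ b → κ 0 :* κ 0 :- κ 3 :* b ⊜ :- (κ 3) :* b) b)) χ≡c))
            (drop k≢0 e (U 0#) (containsLine⁻ {plane d} {U 0#} {V′ b} (plane-contains d) (span-left _ _)))
            (drop k≢0 e (V′ b) (containsLine⁻ {plane d} {U 0#} {V′ b} (plane-contains d) (span-right _ _))))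
        where
        no-multiple : ∀ k → k ≢ 0# → ∀ τ → plane d ≡ scale k (oscₚ τ) → τ ≢ nothing
        no-multiple k _ _ e refl = 1≢0 (trans (VP.∷-injectiveˡ e) (zeroʳ k))

        drop : ∀ {k τ} → k ≢ 0# → plane d ≡ scale k (oscₚ τ) → ∀ X → dot (plane d) X ≡ 0# → dot (oscₚ τ) X ≡ 0#
        drop {k} {τ} k≢0 e X h = cancel-0 k≢0 (trans (sym (scale-dot k (oscₚ τ) X))
          (trans (cong (λ π → dot π X) (sym e)) h))

      nCurvePoints-plane : ∀ d → nCurvePoints (plane d) ≡ ν b d
      nCurvePoints-plane d = trans (nCurvePoints≡ (plane d)) (cong₂ ℕ._+_ (ι-no 1≢0) (#-cong
        (λ {t} h → ==⁺ (trans (sym (eq t)) (==⁻ h))) (λ {t} h → ==⁺ (trans (eq t) (==⁻ h)))))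
        where
        eq : ∀ t → cub (plane d) t ≡ t * t * t + b * t + d
        eq t = ring 3 (λ b d t → κ 1 :* (t :* t :* t) :+ κ 0 :*
          (t :* t) :+ b :* t :+ d ⊜ t :* t :* t :+ b :* t :+ d) b d t

    open Pencil b≢0

    Π-orbit : ∀ {type} → Invariant type → ∀ {ℓ} → T (O ℓ) → Π[ type ∣ ℓ ] ≡ Π[ type ∣ ℓ₀ ]
    Π-orbit {type} inv {ℓ} t = let open OrbitLine (orbit⁻ {b} {ℓ} t) in
      trans (cong Π[ type ∣_] ℓ≡) (Π-invariant inv (Wᴬ τ k m≢0) (U 0#) (V′ b))

    -- `osc∞` passes through `ℓ₀` and has one curve point, so k ≠ 1 keeps it out of the count; for
    -- `is1barC` the exclusion of Γ-planes does the same.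
    Π-count : ∀ k → 1 ≢ k → ∀ {ℓ} → T (O ℓ) → Π[ (λ π → nCurvePoints π ≡ᵇ k) ∣ ℓ ] ≡ #ν k
    Π-count k 1≢k {ℓ} t = trans (Π-orbit (count-invariant k) {ℓ} t) (trans
      (Π-ℓ₀ (λ π → nCurvePoints π ≡ᵇ k) (λ h → 1≢k (trans (sym (Γ⇒1 {osc∞} osc∞-Γ)) (ℕP.≡ᵇ⇒≡ _ k h))))
      (#-cong (λ {d} → subst (λ n → T (n ≡ᵇ k)) (nCurvePoints-plane d)) (λ {d} → subst (λ n → T (n ≡ᵇ k))
        (sym (nCurvePoints-plane d)))))

    Π-1bar : ∀ {ℓ} → T (O ℓ) → Π[ is1barC ∣ ℓ ] ≡ #ν 1
    Π-1bar {ℓ} t = trans (Π-orbit 1bar-invariant {ℓ} t) (trans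
      (Π-ℓ₀ is1barC (λ h → T-not⁻ (proj₂ (T-∧⁻ {nCurvePoints osc∞ ≡ᵇ 1} h)) osc∞-Γ))
      (#-cong (λ {d} h → subst (λ n → T (n ≡ᵇ 1)) (nCurvePoints-plane d)
        (proj₁ (T-∧⁻ {nCurvePoints (plane d) ≡ᵇ 1} h)))
              (λ {d} h → T-∧⁺ (subst (λ n → T (n ≡ᵇ 1)) (sym (nCurvePoints-plane d)) h) (T-not⁺ (plane-¬Γ d)))))

    η≡c : η ≡ c
    η≡c = χ≡c

    Π-counts : ∀ {ℓ} → T (O ℓ) →
        Π[ is2C ∣ ℓ ] ≡ #roots c
      × pos 6 ℤ.* pos Π[ is3C ∣ ℓ ] ≡ pos q ℤ.- sign ε ℤ.- pos 3 ℤ.* pos (#roots c)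
      × pos 3 ℤ.* pos Π[ is0C ∣ ℓ ] ≡ pos q ℤ.- sign ε
      × pos 2 ℤ.* pos Π[ is1barC ∣ ℓ ] ≡ pos q ℤ.+ sign ε ℤ.- pos (#roots c)
    Π-counts {ℓ} t =
      trans (Π-count 2 (λ ()) {ℓ} t) (trans #ν2 (cong #roots η≡c)) ,
      trans (cong (λ n → pos 6 ℤ.* pos n) (Π-count 3 (λ ()) {ℓ} t))
        (trans #ν3 (cong (λ c → pos q ℤ.- sign ε ℤ.- pos 3 ℤ.* pos (#roots c)) η≡c)) ,
      trans (cong (λ n → pos 3 ℤ.* pos n) (Π-count 0 (λ ()) {ℓ} t)) #ν0 ,
      trans (cong (λ n → pos 2 ℤ.* pos n) (Π-1bar {ℓ} t))
        (trans #ν1 (cong (λ c → pos q ℤ.+ sign ε ℤ.- pos (#roots c)) η≡c))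

    -- The witness is the number of members of the pencil without a root; this divisibility is what
    -- identifies the character of -3.
    3∣q-ε : ∃ λ n → pos 3 ℤ.* pos n ≡ pos q ℤ.- sign ε
    3∣q-ε = #ν 0 , #ν0

    private
      value hessian : Plane → PG₁ → Carrier
      value π nothing  = lead π
      value π (just t) = cub π t
      hessian π nothing  = HA π
      hessian π (just t) = H π t

      good : Plane → PG₁ → Bool
      good π τ = not (value π τ == 0#) ∧ is c (hessian π τ)

      #outside≡ : ∀ π → #outside c π ≡ count (good π) PG₁-elems
      #outside≡ π = sym (trans (count-∷ {p = good π} nothing (map just elems)) (cong (ι (good π nothing) ℕ.+_)
        (count-map {p = good π} just elems)))

      c₀ᴾ c₁ᴾ c₂ᴾ : Plane → Carrier
      c₀ᴾ (c₀ ∷ _) = c₀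
      c₁ᴾ (_ ∷ c₁ ∷ _) = c₁
      c₂ᴾ (_ ∷ _ ∷ c₂ ∷ _) = c₂

      pulled : PG₁ → Plane → Plane
      pulled τ π = pull (Fᴬ τ) π

      pulled-nothing : ∀ π → pulled nothing π ≡ π
      pulled-nothing π = dual-ext (dot-pull idᴬ π)

      -- Moving τ to ∞ makes the value of the cubic at τ its leading coefficient.
      pulled-value : ∀ τ π → c₀ᴾ (pulled τ π) ≡ value π τ
      pulled-value nothing π = dot-P∞ π
      pulled-value (just t) (c₀ ∷ c₁ ∷ c₂ ∷ c₃ ∷ []) = ring 5
        (λ c₀ c₁ c₂ c₃ t → c₀ :* (κ 0 :+ κ 3 :* t :* κ 0 :+ κ 3 :* (t :* t) :* κ 0 :+ t :* t :* t :* κ 1) :+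
        (c₁ :* (κ 0 :+ κ 2 :* t :* κ 0 :+ t :* t :* κ 1) :+ (c₂ :* (κ 0 :+ t :* κ 1) :+ (c₃ :* κ 1 :+ κ 0))) ⊜ c₀ :*
        (t :* t :* t) :+ c₁ :* (t :* t) :+ c₂ :* t :+ c₃) c₀ c₁ c₂ c₃ t

      -- The Hessian is a covariant of weight 2, and s ↦ t + 1/s has determinant -1, so no factor
      -- appears.
      pulled-hessian : ∀ τ π → HA (pulled τ π) ≡ hessian π τ
      pulled-hessian nothing π = cong HA (pulled-nothing π)
      pulled-hessian (just t) (c₀ ∷ c₁ ∷ c₂ ∷ c₃ ∷ []) = ring 5
        (λ c₀ c₁ c₂ c₃ t → (c₀ :* (κ 0 :+ κ 3 :* t :* κ 0 :+ κ 3 :* (t :* t) :* κ 1 :+ t :* t :* t :* κ 0) :+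
        (c₁ :* (κ 0 :+ κ 2 :* t :* κ 1 :+ t :* t :* κ 0) :+ (c₂ :* (κ 1 :+ t :* κ 0) :+ (c₃ :* κ 0 :+ κ 0)))) :*
        (c₀ :* (κ 0 :+ κ 3 :* t :* κ 0 :+ κ 3 :* (t :* t) :* κ 1 :+ t :* t :* t :* κ 0) :+
        (c₁ :* (κ 0 :+ κ 2 :* t :* κ 1 :+ t :* t :* κ 0) :+ (c₂ :* (κ 1 :+ t :* κ 0) :+ (c₃ :* κ 0 :+ κ 0)))) :- κ 3
        :* ((c₀ :* (κ 0 :+ κ 3 :* t :* κ 0 :+ κ 3 :* (t :* t) :* κ 0 :+ t :* t :* t :* κ 1) :+
        (c₁ :* (κ 0 :+ κ 2 :* t :* κ 0 :+ t :* t :* κ 1) :+ (c₂ :* (κ 0 :+ t :* κ 1) :+ (c₃ :* κ 1 :+ κ 0)))) :*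
        (c₀ :* (κ 0 :+ κ 3 :* t :* κ 1 :+ κ 3 :* (t :* t) :* κ 0 :+ t :* t :* t :* κ 0) :+
        (c₁ :* (κ 1 :+ κ 2 :* t :* κ 0 :+ t :* t :* κ 0) :+ (c₂ :* (κ 0 :+ t :* κ 0) :+ (c₃ :* κ 0 :+ κ 0))))) ⊜
        (c₁ :* c₁ :- κ 3 :* (c₀ :* c₂)) :* (t :* t) :+ (c₁ :* c₂ :- κ 9 :* (c₀ :* c₃)) :* t :+
        (c₂ :* c₂ :- κ 3 :* (c₁ :* c₃))) c₀ c₁ c₂ c₃ t

      contains⁺ : ∀ τ π {a b} → c₁ᴾ (pulled τ π) ≡ a * c₀ᴾ (pulled τ π) → c₂ᴾ (pulled τ π) ≡ b * c₀ᴾ (pulled τ π) → T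
        (containsLine π (line τ a b))
      contains⁺ τ π {a} {b} e₁ e₂ = pull-contains⁺ (Fᴬ τ) {π} {U a} {V′ b}
        (trans (dot-U _ _ _ _ a) (trans (cong (_+ - (a * c₀ᴾ (pulled τ π))) e₁) (-‿inverseʳ _)))
          (trans (dot-V _ _ _ _ b) (trans (cong (_+ - (b * c₀ᴾ (pulled τ π))) e₂) (-‿inverseʳ _)))

      contains⁻ : ∀ τ π {a b} → T (containsLine π (line τ a b)) → c₁ᴾ (pulled τ π) ≡ a * c₀ᴾ (pulled τ π) × c₂ᴾ
        (pulled τ π) ≡ b * c₀ᴾ (pulled τ π)
      contains⁻ τ π {a} {b} t = let (eu , ev) = pull-contains⁻ (Fᴬ τ) {π} {U a} {V′ b} t in
        x-y≡0⇒ (trans (sym (dot-U _ _ _ _ a)) eu) , x-y≡0⇒ (trans (sym (dot-V _ _ _ _ b)) ev)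

      hessian-disc : ∀ π {a b} → c₁ᴾ π ≡ a * c₀ᴾ π → c₂ᴾ π ≡ b * c₀ᴾ π → HA π ≡ c₀ᴾ π * c₀ᴾ π * pencil-disc a b
      hessian-disc (c₀ ∷ c₁ ∷ c₂ ∷ c₃ ∷ []) {a} {b} refl refl = ring 3 (λ c₀ a b → a :* c₀ :* (a :* c₀) :- κ 3 :*
        (c₀ :* (b :* c₀)) ⊜ c₀ :* c₀ :* (a :* a :- κ 3 :* b)) c₀ a b

      leadless-Γ : ∀ π → π ≢ 𝟎 → c₀ᴾ π ≡ 0# → c₁ᴾ π ≡ 0# → c₂ᴾ π ≡ 0# → T (isΓPlane π)
      leadless-Γ (_ ∷ _ ∷ _ ∷ c₃ ∷ []) π≢0 refl refl refl = isΓ-osc⁺ nothing (c₃ , (λ { refl → π≢0 refl }) ,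
        vec4 (sym (zeroʳ c₃)) (sym (zeroʳ c₃)) (sym (zeroʳ c₃)) (sym (*-identityʳ c₃)))

    -- A line of the orbit lies in exactly one osculating plane, so within π it is the intersection
    -- with that plane, and `g` recovers it from τ. The points τ with f(τ) = 0 drop out, because
    -- there the intersection contains the point of the cubic at τ.
    Λ≡#outside : ∀ {π} → π ∈ planes → ¬ T (isΓPlane π) → Λ[ O ∣ π ] ≡ #outside c π
    Λ≡#outside {π} π∈ ¬Γ = sym (trans (#outside≡ π) (count-bij {p = good π} PG₁-unique lines-unique g injective
      {r = λ ℓ → O ℓ ∧ containsLine π ℓ} forth back))
      where
      aτ bτ : PG₁ → Carrier
      aτ τ = c₁ᴾ (pulled τ π) * c₀ᴾ (pulled τ π) ⁻¹
      bτ τ = c₂ᴾ (pulled τ π) * c₀ᴾ (pulled τ π) ⁻¹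

      g : PG₁ → Line
      g τ = line τ (aτ τ) (bτ τ)

      module _ (τ : PG₁) (t : T (good π τ)) where
        lead≢0 : c₀ᴾ (pulled τ π) ≢ 0#
        lead≢0 e = T-not⁻ (proj₁ (T-∧⁻ {not (value π τ == 0#)} t)) (==⁺ (trans (sym (pulled-value τ π)) e))

        divide : ∀ x → x ≡ x * c₀ᴾ (pulled τ π) ⁻¹ * c₀ᴾ (pulled τ π)
        divide x = lin 3 (λ x k i → (x ⊜ x :* i :* k) , (:- x ×[ k :* i ⊜ κ 1 ]) ∷ []) x (c₀ᴾ (pulled τ π))
          (c₀ᴾ (pulled τ π) ⁻¹) (⁻¹-inverse lead≢0 , _)

        χ-disc : χ (pencil-disc (aτ τ) (bτ τ)) ≡ c
        χ-disc = trans (sym (χ-*-square (χ-square lead≢0 refl)))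
          (trans (cong χ (trans (sym (hessian-disc (pulled τ π) {aτ τ} {bτ τ} (divide (c₁ᴾ (pulled τ π)))
            (divide (c₂ᴾ (pulled τ π))))) (pulled-hessian τ π)))
            (is⁻ (proj₂ (T-∧⁻ {not (value π τ == 0#)} t))))

      injective : ∀ {τ τ′} → τ ∈ PG₁-elems → T (good π τ) → τ′ ∈ PG₁-elems → T (good π τ′) → g τ ≡ g τ′ → τ ≡ τ′
      injective {τ} {τ′} _ t _ _ e = sym (line-τ-unique {τ} {τ′} {aτ τ} {bτ τ} {aτ τ′} {bτ τ′}
        (nonzero (χ-disc τ t)) e)

      forth : ∀ {τ} → τ ∈ PG₁-elems → T (good π τ) → g τ ∈ lines × T (O (g τ) ∧ containsLine π (g τ))
      forth {τ} _ t = line-∈ τ _ _ , T-∧⁺ (O⁺ τ (aτ τ) (bτ τ) (χ-disc τ t))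
        (contains⁺ τ π (divide τ t (c₁ᴾ (pulled τ π))) (divide τ t (c₂ᴾ (pulled τ π))))

      module _ (τ : PG₁) {a b′ : Carrier} (e₁ : c₁ᴾ (pulled τ π) ≡ a * c₀ᴾ (pulled τ π))
        (e₂ : c₂ᴾ (pulled τ π) ≡ b′ * c₀ᴾ (pulled τ π)) where
        k = c₀ᴾ (pulled τ π)

        k≢0 : k ≢ 0#
        k≢0 z = ¬Γ (subst (T ∘ isΓPlane) (pull-inverse (Fᴬ τ) π) (Γ-pull (inverseᴬ (Fᴬ τ)) {pulled τ π}
          (leadless-Γ (pulled τ π) (pull-≢𝟎 (Fᴬ τ) (points≢𝟎 π∈)) z
            (trans e₁ (trans (cong (a *_) z) (zeroʳ a))) (trans e₂ (trans (cong (b′ *_) z) (zeroʳ b′))))))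

        quotient : ∀ x {y} → y ≡ x * k → y * k ⁻¹ ≡ x
        quotient x e = trans (cong (_* k ⁻¹) e) (lin 3 (λ x k i → (x :* k :* i ⊜ x) , (x ×[ k :* i ⊜ κ 1 ]) ∷ []) x k
          (k ⁻¹) (⁻¹-inverse k≢0 , _))

        is-good : χ (pencil-disc a b′) ≡ c → T (good π τ)
        is-good h = T-∧⁺ (T-not⁺ λ z → k≢0 (trans (pulled-value τ π) (==⁻ z)))
          (is⁺ (trans (cong χ (trans (sym (pulled-hessian τ π)) (hessian-disc (pulled τ π) {a} {b′} e₁ e₂)))
            (trans (χ-*-square (χ-square k≢0 refl)) h)))

        g≡line : g τ ≡ line τ a b′
        g≡line = cong₂ (line τ) (quotient a e₁) (quotient b′ e₂)

      from-line : ∀ τ a b′ → χ (pencil-disc a b′) ≡ c → T (containsLine π (line τ a b′)) → T (good π τ) × g τ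
        ≡ line τ a b′
      from-line τ a b′ h t = let (e₁ , e₂) = contains⁻ τ π {a} {b′} t in is-good τ e₁ e₂ h , g≡line τ e₁ e₂

      back : ∀ {ℓ} → ℓ ∈ lines → T (O ℓ ∧ containsLine π ℓ) → ∃ λ τ → τ ∈ PG₁-elems × T (good π τ) × g τ ≡ ℓ
      back {ℓ} _ t =
        let (o , cℓ) = T-∧⁻ {O ℓ} t
            (τ , a , b′ , e , h) = O⁻ {ℓ} o
            (t′ , e′) = from-line τ a b′ h (subst (T ∘ containsLine π) e cℓ)
        in τ , PG₁-complete τ , t′ , trans e′ (sym e)

  plane-shape : ∀ {π} → π ∈ planes → ¬ T (isΓPlane π) → Shape π
  plane-shape {π} π∈ ¬Γ = shape π (points≢𝟎 π∈) (¬Γ⇒NoTripleRoot {π} ¬Γ)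

  class-of : ∀ {π} → π ∈ planes → (¬Γ : ¬ T (isΓPlane π)) → RootCount (χ (- ofℕ 3 * Δ π)) (nCurvePoints π)
  class-of {π} π∈ ¬Γ = subst (RootCount _) (sym (nCurvePoints≡ π)) (Shape.count-roots (plane-shape π∈ ¬Γ))

  count≢1⇒¬Γ : ∀ {π n} → nCurvePoints π ≡ n → n ≢ 1 → ¬ T (isΓPlane π)
  count≢1⇒¬Γ {π} refl h t = h (Γ⇒1 {π} t)

-- Congruences modulo 3 that determine the sign ξ

¬3∣small : ∀ {r} x → pos 3 ℤ.* x ≡ r → 1 ≤ ℤ.∣ r ∣ → ℤ.∣ r ∣ ≤ 2 → ⊥
¬3∣small {r} x e 1≤ ≤2 = ℕP.<⇒≱ (s≤s ≤2) (ℕD.∣⇒≤ ⦃ ℕ.>-nonZero 1≤ ⦄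
  (ℤS.∣⇒∣ᵤ (ℤS.divides x (trans (sym e) (ℤP.*-comm (pos 3) x)))))

±1 : ℤ → Set
±1 ξ = ξ ≡ pos 1 ⊎ ξ ≡ -[1+ 0 ]

-- Two different signs would make 3 divide their difference, which is ±2.
±1-unique : ∀ {q ξ ζ} x y → ±1 ξ → ±1 ζ → pos 3 ℤ.* x ≡ q ℤ.- ξ → pos 3 ℤ.* y ≡ q ℤ.- ζ → ξ ≡ ζ
±1-unique x y (inj₁ refl) (inj₁ refl) _ _ = refl
±1-unique x y (inj₂ refl) (inj₂ refl) _ _ = refl
±1-unique {q} x y (inj₁ refl) (inj₂ refl) e e′ = ⊥-elim (¬3∣small {pos 2} (y ℤ.- x) (difference e e′) (s≤s z≤n)
  (s≤s (s≤s z≤n)))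
  where
  open IntegerSolver
  difference : pos 3 ℤ.* x ≡ q ℤ.- pos 1 → pos 3 ℤ.* y ≡ q ℤ.- -[1+ 0 ] → pos 3 ℤ.* (y ℤ.- x) ≡ pos 2
  difference e e′ = lin 3 (λ x y q → (κ 3 :* (y :- x) ⊜ κ 2) , (:- (κ 1) ×[ κ 3 :* x ⊜ q :- κ 1 ]) ∷
    (κ 1 ×[ κ 3 :* y ⊜ q :- :- (κ 1) ]) ∷ []) x y q (e , e′ , _)
±1-unique {q} x y (inj₂ refl) (inj₁ refl) e e′ = ⊥-elim (¬3∣small {pos 2} (x ℤ.- y) (difference e e′) (s≤s z≤n)
  (s≤s (s≤s z≤n)))
  where
  open IntegerSolver
  difference : pos 3 ℤ.* x ≡ q ℤ.- -[1+ 0 ] → pos 3 ℤ.* y ≡ q ℤ.- pos 1 → pos 3 ℤ.* (x ℤ.- y) ≡ pos 2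
  difference e e′ = lin 3 (λ x y q → (κ 3 :* (x :- y) ⊜ κ 2) , (κ 1 ×[ κ 3 :* x ⊜ q :- :- (κ 1) ]) ∷
    (:- (κ 1) ×[ κ 3 :* y ⊜ q :- κ 1 ]) ∷ []) x y q (e , e′ , _)

-- Dividing both q and q - ξ, 3 would divide ξ = ±1.
¬3∣q : ∀ {q ξ} m k → ±1 ξ → q ≡ m ℕ.* 3 → pos 3 ℤ.* k ≡ pos q ℤ.- ξ → ⊥
¬3∣q {q} {ξ} m k ξ±1 e h = case ξ±1 of λ
  { (inj₁ refl) → ¬3∣small {pos 1} (pos m ℤ.- k) (multiple h) (s≤s z≤n) (s≤s z≤n)
  ; (inj₂ refl) → ¬3∣small { -[1+ 0 ]} (pos m ℤ.- k) (multiple h) (s≤s z≤n) (s≤s z≤n) }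
  where
  open IntegerSolver
  q≡ : pos q ≡ pos m ℤ.* pos 3
  q≡ = trans (cong pos e) (ℤP.pos-* m 3)
  multiple : ∀ {ξ} → pos 3 ℤ.* k ≡ pos q ℤ.- ξ → pos 3 ℤ.* (pos m ℤ.- k) ≡ ξ
  multiple {ξ} h = lin 4 (λ m k q x → (κ 3 :* (m :- k) ⊜ x) , (:- (κ 1) ×[ κ 3 :* k ⊜ q :- x ]) ∷
    (:- (κ 1) ×[ q ⊜ m :* κ 3 ]) ∷ []) (pos m) k (pos q) ξ (h , q≡ , _)

square≢null : square ≢ null
square≢null ()

nonsquare≢null : nonsquare ≢ null
nonsquare≢null ()

sign-±1 : ∀ {c} → c ≢ null → ±1 (sign c)
sign-±1 {null}      h = ⊥-elim (h refl)
sign-±1 {square}    _ = inj₁ refl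
sign-±1 {nonsquare} _ = inj₂ refl

sign-·-nonsquare : ∀ c → sign (c · nonsquare) ≡ ℤ.- sign c
sign-·-nonsquare null      = refl
sign-·-nonsquare square    = refl
sign-·-nonsquare nonsquare = refl

·-square : ∀ c → c · square ≡ c
·-square null      = refl
·-square square    = refl
·-square nonsquare = refl

-- The two orbits together, and their tables

module Assemble (F : FiniteField) (ξ : ℤ) (odd : FiniteField.q F % 2 ≡ 1) (5≤q : 5 ≤ FiniteField.q F)
  (ξ±1 : ±1 ξ) (3∣q-ξ : pos 3 ℤD.∣ (pos (FiniteField.q F) ℤ.- ξ)) where

  private
    third : ∃ λ k → pos 3 ℤ.* k ≡ pos (FiniteField.q F) ℤ.- ξ
    third = let (ℤS.divides k e) = ℤS.∣ᵤ⇒∣ {pos 3} 3∣q-ξ in k , trans (ℤP.*-comm (pos 3) k) (sym e)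

  2≢0 : PG.ofℕ F 2 ≢ FiniteField.0# F
  2≢0 e = case trans (sym odd) (ℕD.n∣m⇒m%n≡0 (FiniteField.q F) 2 (Characteristic.2≡0⇒2∣q F e)) of λ ()

  3≢0 : PG.ofℕ F 3 ≢ FiniteField.0# F
  3≢0 e = let (ℕD.divides m q≡) = Characteristic.3≡0⇒3∣q F e ; (k , h) = third in ¬3∣q m k ξ±1 q≡ h

  open OrbitCounts F 2≢0 3≢0 5≤q public

  abstract
    -- For a nonsquare ρ the choice b = -ρ/3 gives -3b = ρ. The witness comes from a count and is
    -- kept opaque.
    some-nonsquare : ∃ λ b → χ (- ofℕ 3 * b) ≡ nonsquare
    some-nonsquare =
      let (ρ , _ , t) = count-suc⇒∃ {p = is nonsquare} elems (subst (1 ≤_) (sym #nonsquare≡#square) (positive _ 1+2#square≡q 5≤q))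
      in - (⅓ * ρ) , trans (cong χ (lin 2 (λ r t → (:- (κ 3) :* :- (t :* r) ⊜ r) , (r ×[ κ 3 :* t ⊜ κ 1 ]) ∷ []) ρ ⅓
        (⅓-inverse , _))) (is⁻ t)
      where
      positive : ∀ s {q} → 1 ℕ.+ 2 ℕ.* s ≡ q → 5 ≤ q → 1 ≤ s
      positive zero    refl (s≤s ())
      positive (suc s) _    _ = s≤s z≤n

    some-square : ∃ λ b → χ (- ofℕ 3 * b) ≡ square
    some-square = - ⅓ , χ-square {r = 1#} 1≢0
      (lin 1 (λ t → (κ 1 :* κ 1 ⊜ :- (κ 3) :* :- t) , (:- (κ 1) ×[ κ 3 :* t ⊜ κ 1 ]) ∷ []) ⅓ (⅓-inverse , _))

  module O₁ = Orbit nonsquare nonsquare≢null (proj₁ some-nonsquare) (proj₂ some-nonsquare)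
  module O₂ = Orbit square square≢null (proj₁ some-square) (proj₂ some-square)

  -- Both q - ξ and q - `sign ε` are multiples of 3, the latter as three times a number of planes.
  sign-ε : sign ε ≡ ξ
  sign-ε = let (k , h) = third ; (n , h′) = O₁.3∣q-ε in ±1-unique {pos q} (pos n) k (sign-±1 ε≢null) ξ±1 h′ h

  ℓ₂∉O₁ : ¬ T (O₁.O O₂.ℓ₀)
  ℓ₂∉O₁ = O₁.∉-O {proj₁ some-square} (λ e → case trans (sym (proj₂ some-square)) e of λ ())
    (λ e → case trans (sym (proj₂ some-square)) e of λ ())

  EΓ⇔ : ∀ ℓ → ℓ ∈ lines → T (isEΓLine ℓ) ⇔ (T (O₁.O ℓ) ⊎ T (O₂.O ℓ))
  EΓ⇔ ℓ ℓ∈ = mk⇔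
    (λ t → let (τ , a , b , e , h) = EΓ-line⁻ {ℓ} ℓ∈ t in subst (λ ℓ → T (O₁.O ℓ) ⊎ T (O₂.O ℓ)) (sym e)
      (by-class τ a b (χ≢null h)))
    (λ { (inj₁ t) → O₁.O⇒EΓ {ℓ} t ; (inj₂ t) → O₂.O⇒EΓ {ℓ} t })
    where
    by-class : ∀ τ a b → χ (pencil-disc a b) ≢ null → T (O₁.O (line τ a b)) ⊎ T (O₂.O (line τ a b))
    by-class τ a b h = choose (χ (pencil-disc a b)) refl
      where
      choose : ∀ c → χ (pencil-disc a b) ≡ c → T (O₁.O (line τ a b)) ⊎ T (O₂.O (line τ a b))
      choose null      e = ⊥-elim (h e)
      choose square    e = inj₂ (O₂.O⁺ τ a b e)
      choose nonsquare e = inj₁ (O₁.O⁺ τ a b e)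

  Π₁ : ∀ {ℓ} → T (O₁.O ℓ) →
       Π[ is2C ∣ ℓ ] ≡ 0
     × pos 6 ℤ.* pos Π[ is3C ∣ ℓ ] ≡ pos q ℤ.- ξ
     × pos 3 ℤ.* pos Π[ is0C ∣ ℓ ] ≡ pos q ℤ.- ξ
     × pos 2 ℤ.* pos Π[ is1barC ∣ ℓ ] ≡ pos q ℤ.+ ξ
  Π₁ {ℓ} t = let (h₂ , h₃ , h₀ , h₁) = O₁.Π-counts {ℓ} t in
    h₂ , trans h₃ (trans (ℤP.+-identityʳ _) (cong (λ ξ → pos q ℤ.- ξ) sign-ε)) , trans h₀
      (cong (λ ξ → pos q ℤ.- ξ) sign-ε) ,
    trans h₁ (trans (ℤP.+-identityʳ _) (cong (λ ξ → pos q ℤ.+ ξ) sign-ε))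

  Π₂ : ∀ {ℓ} → T (O₂.O ℓ) →
       Π[ is2C ∣ ℓ ] ≡ 2
     × pos 6 ℤ.* pos Π[ is3C ∣ ℓ ] ≡ pos q ℤ.- ξ ℤ.- pos 6
     × pos 3 ℤ.* pos Π[ is0C ∣ ℓ ] ≡ pos q ℤ.- ξ
     × pos 2 ℤ.* pos Π[ is1barC ∣ ℓ ] ≡ pos q ℤ.+ ξ ℤ.- pos 2
  Π₂ {ℓ} t = let (h₂ , h₃ , h₀ , h₁) = O₂.Π-counts {ℓ} t in
    h₂ , trans h₃ (cong (λ ξ → pos q ℤ.- ξ ℤ.- pos 6) sign-ε) , trans h₀ (cong (λ ξ → pos q ℤ.- ξ) sign-ε) ,
    trans h₁ (cong (λ ξ → pos q ℤ.+ ξ ℤ.- pos 2) sign-ε)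

  private
    Λ-counts : ∀ {π n c} → π ∈ planes → ¬ T (isΓPlane π) → nCurvePoints π ≡ n → χ (- ofℕ 3 * Δ π) ≡ c → c ≢ null →
               pos 2 ℤ.* pos Λ[ O₁.O ∣ π ] ≡ pos q ℤ.- sign (ε · c) ×
               pos 2 ℤ.* pos Λ[ O₂.O ∣ π ] ≡ pos q ℤ.- sign (ε · c) ℤ.- pos 2 ℤ.* pos n
    Λ-counts {π} π∈ ¬Γ eₙ e c≢ = let (h₁ , h₂) = outside-counts {π} e (trans (sym (nCurvePoints≡ π)) eₙ) c≢ in
      trans (cong (λ n → pos 2 ℤ.* pos n) (O₁.Λ≡#outside {π} π∈ ¬Γ)) h₁ ,
      trans (cong (λ n → pos 2 ℤ.* pos n) (O₂.Λ≡#outside {π} π∈ ¬Γ)) h₂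

    sign-εsquare : sign (ε · square) ≡ ξ
    sign-εsquare = trans (cong sign (·-square ε)) sign-ε

    -sign-εnonsquare : ∀ x → x ℤ.- sign (ε · nonsquare) ≡ x ℤ.+ ξ
    -sign-εnonsquare x = cong (λ y → x ℤ.+ y) (trans (cong ℤ.-_ (trans (sign-·-nonsquare ε) (cong ℤ.-_ sign-ε)))
      (ℤP.neg-involutive ξ))

    class-at : ∀ {c n k} → RootCount c n → n ≡ k → RootCount c k
    class-at r refl = r

  -- Two curve points mean a double root, so the discriminant vanishes and the Hessian is a nonzero
  -- square at all of the q + 1 - 2 points off the roots: every such line falls into the second
  -- orbit.
  Λ-2C : ∀ {π} → π ∈ planes → T (is2C π) → Λ[ O₁.O ∣ π ] ≡ 0 × Λ[ O₂.O ∣ π ] ≡ q ∸ 1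
  Λ-2C {π} π∈ t =
    trans (O₁.Λ≡#outside {π} π∈ ¬Γ) (outside-nonsquare-null {π} sh Δ≡0) ,
    trans (O₂.Λ≡#outside {π} π∈ ¬Γ)
      (subtract (trans (cong (#outside square π ℕ.+_) (trans (sym n≡2) (nCurvePoints≡ π)))
      (outside-square-null {π} sh Δ≡0)))
    where
    n≡2 = ℕP.≡ᵇ⇒≡ (nCurvePoints π) 2 t
    ¬Γ = count≢1⇒¬Γ {π} n≡2 λ ()
    sh = plane-shape {π} π∈ ¬Γ
    two : ∀ {c} → RootCount c 2 → c ≡ null
    two double = refl
    Δ≡0 = Δ-null {π} (two (class-at (class-of {π} π∈ ¬Γ) n≡2))
    subtract : ∀ {m q} → m ℕ.+ 2 ≡ 1 ℕ.+ q → m ≡ q ∸ 1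
    subtract {m} {q} e = trans (sym (ℕP.m+n∸n≡m m 1)) (cong (_∸ 1) (ℕP.suc-injective (trans (sym (ℕP.+-suc m 1)) e)))

  Λ-3C : ∀ {π} → π ∈ planes → T (is3C π) →
         pos 2 ℤ.* pos Λ[ O₁.O ∣ π ] ≡ pos q ℤ.- ξ × pos 2 ℤ.* pos Λ[ O₂.O ∣ π ] ≡ pos q ℤ.- ξ ℤ.- pos 6
  Λ-3C {π} π∈ t =
    let (h₁ , h₂) = Λ-counts {π} π∈ ¬Γ n≡3 (all-square (class-at (class-of {π} π∈ ¬Γ) n≡3)) λ ()
    in trans h₁ (cong (λ ξ → pos q ℤ.- ξ) sign-εsquare) , trans h₂ (cong (λ ξ → pos q ℤ.- ξ ℤ.- pos 6) sign-εsquare)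
    where
    n≡3 = ℕP.≡ᵇ⇒≡ (nCurvePoints π) 3 t
    ¬Γ = count≢1⇒¬Γ {π} n≡3 λ ()
    all-square : ∀ {c} → RootCount c 3 → c ≡ square
    all-square three = refl

  Λ-0C : ∀ {π} → π ∈ planes → T (is0C π) →
         pos 2 ℤ.* pos Λ[ O₁.O ∣ π ] ≡ pos q ℤ.- ξ × pos 2 ℤ.* pos Λ[ O₂.O ∣ π ] ≡ pos q ℤ.- ξ
  Λ-0C {π} π∈ t =
    let (h₁ , h₂) = Λ-counts {π} π∈ ¬Γ n≡0 (all-square (class-at (class-of {π} π∈ ¬Γ) n≡0)) λ ()
    in trans h₁ (cong (λ ξ → pos q ℤ.- ξ) sign-εsquare) , trans h₂ (trans (ℤP.+-identityʳ _)
      (cong (λ ξ → pos q ℤ.- ξ) sign-εsquare))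
    where
    n≡0 = ℕP.≡ᵇ⇒≡ (nCurvePoints π) 0 t
    ¬Γ = count≢1⇒¬Γ {π} n≡0 λ ()
    all-square : ∀ {c} → RootCount c 0 → c ≡ square
    all-square zero = refl

  Λ-1bar : ∀ {π} → π ∈ planes → T (is1barC π) →
           pos 2 ℤ.* pos Λ[ O₁.O ∣ π ] ≡ pos q ℤ.+ ξ × pos 2 ℤ.* pos Λ[ O₂.O ∣ π ] ≡ pos q ℤ.+ ξ ℤ.- pos 2
  Λ-1bar {π} π∈ t =
    let (h₁ , h₂) = Λ-counts {π} π∈ ¬Γ n≡1 (all-nonsquare (class-at (class-of {π} π∈ ¬Γ) n≡1)) λ ()
    in trans h₁ (-sign-εnonsquare (pos q)) , trans h₂ (cong (λ x → x ℤ.- pos 2) (-sign-εnonsquare (pos q)))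
    where
    parts = T-∧⁻ {nCurvePoints π ≡ᵇ 1} t
    n≡1 = ℕP.≡ᵇ⇒≡ (nCurvePoints π) 1 (proj₁ parts)
    ¬Γ = T-not⁻ (proj₂ parts)
    all-nonsquare : ∀ {c} → RootCount c 1 → c ≡ nonsquare
    all-nonsquare one = refl

open import Data.Bool using (T)
open import Data.Nat using (ℕ; _≤_; _%_; _^_; _∸_)
open import Data.Integer using (ℤ; +_; -_; _-_; _+_; _*_)
open import Data.Integer.Divisibility using (_∣_)
open import Data.Product using (Σ-syntax; _×_; _,_)
open import Data.Sum using (_⊎_)
open import Data.List.Membership.Propositional using (_∈_)
open import Relation.Binary.PropositionalEquality using (_≡_)
open import Relation.Nullary using (¬_)
open import Function.Bundles using (_⇔_)

theorem7p6 : (F : FiniteField) (ξ : ℤ) →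
  let open FiniteField F using (q)
      open PG F
  in
  q % 2 ≡ 1 → 5 ≤ q →
  (ξ ≡ + 1 ⊎ ξ ≡ - (+ 1)) → (+ 3) ∣ ((+ q) - ξ) →
  Σ[ ℓ₁ ∈ Line ] Σ[ ℓ₂ ∈ Line ]
    let O₁ = inOrbit ℓ₁
        O₂ = inOrbit ℓ₂
    in
    -- the EΓ-lines form exactly the two distinct G_q-orbits O₁, O₂
    ℓ₁ ∈ lines × ℓ₂ ∈ lines × ¬ T (O₁ ℓ₂) ×
    (∀ ℓ → ℓ ∈ lines → (T (isEΓLine ℓ) ⇔ (T (O₁ ℓ) ⊎ T (O₂ ℓ)))) ×
    -- each of size (q^3 - q)/2
    2 Data.Nat.* size O₁ ≡ q ^ 3 ∸ q × 2 Data.Nat.* size O₂ ≡ q ^ 3 ∸ q ×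
    -- the numbers Π_{π,j} (for every line ℓ of O_j)
    (∀ ℓ → ℓ ∈ lines → T (O₁ ℓ) →
        Π[ is2C ∣ ℓ ] ≡ 0
      × (+ 6) * (+ Π[ is3C ∣ ℓ ]) ≡ (+ q) - ξ
      × (+ 3) * (+ Π[ is0C ∣ ℓ ]) ≡ (+ q) - ξ
      × (+ 2) * (+ Π[ is1barC ∣ ℓ ]) ≡ (+ q) + ξ) ×
    (∀ ℓ → ℓ ∈ lines → T (O₂ ℓ) →
        Π[ is2C ∣ ℓ ] ≡ 2
      × (+ 6) * (+ Π[ is3C ∣ ℓ ]) ≡ (+ q) - ξ - (+ 6)
      × (+ 3) * (+ Π[ is0C ∣ ℓ ]) ≡ (+ q) - ξ
      × (+ 2) * (+ Π[ is1barC ∣ ℓ ]) ≡ (+ q) + ξ - (+ 2)) ×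
    -- the numbers Λ_{j,π} (for every plane π of the given type)
    (∀ π → π ∈ planes → T (is2C π) → Λ[ O₁ ∣ π ] ≡ 0 × Λ[ O₂ ∣ π ] ≡ q ∸ 1) ×
    (∀ π → π ∈ planes → T (is3C π) →
        (+ 2) * (+ Λ[ O₁ ∣ π ]) ≡ (+ q) - ξ
      × (+ 2) * (+ Λ[ O₂ ∣ π ]) ≡ (+ q) - ξ - (+ 6)) ×
    (∀ π → π ∈ planes → T (is0C π) →
        (+ 2) * (+ Λ[ O₁ ∣ π ]) ≡ (+ q) - ξ
      × (+ 2) * (+ Λ[ O₂ ∣ π ]) ≡ (+ q) - ξ) ×
    (∀ π → π ∈ planes → T (is1barC π) →
        (+ 2) * (+ Λ[ O₁ ∣ π ]) ≡ (+ q) + ξ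
      × (+ 2) * (+ Λ[ O₂ ∣ π ]) ≡ (+ q) + ξ - (+ 2))
theorem7p6 F ξ odd 5≤q ξ±1 3∣q-ξ =
  O₁.ℓ₀ , O₂.ℓ₀ , O₁.ℓ₀∈lines , O₂.ℓ₀∈lines , ℓ₂∉O₁ , EΓ⇔ , O₁.2size≡q³∸q , O₂.2size≡q³∸q ,
  (λ ℓ _ → Π₁ {ℓ}) , (λ ℓ _ → Π₂ {ℓ}) , (λ π → Λ-2C {π}) , (λ π → Λ-3C {π}) , (λ π → Λ-0C {π}) , (λ π → Λ-1bar {π})
  where open Assemble F ξ odd 5≤q ξ±1 3∣q-ξ
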